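{- Let $(G,B,N,S)$ be a Tits system of rank $\ell+1$ with $G$ a finite group, and let $\mathfrak{B}$ be its building, a finite simplicial complex of dimension $\ell$. For every integer $i$ with $0\leq i\leq \ell-1$, the maximal eigenvalue $M^i(\mathfrak{B})$ of the Laplace operator $\Delta=\delta d$ acting on $C^i(\mathfrak{B})$ is $$M^i(\mathfrak{B})=\ell+1.$$
   Context: Tits system (BN-pair) has its usual meaning; its rank is $|S|$. The building $\mathfrak{B}$ of $(G,B,N,S)$ is the simplicial complex whose simplices correspond to the proper parabolic subgroups of $G$ (proper subgroups containing a conjugate of $B$), with the face relation being reverse inclusion; thus vertices correspond to maximal proper parabolic subgroups, and $\ell$-simplices to conjugates of $B$. Every simplex of $\mathfrak{B}$ is a face of an $\ell$-simplex. Let $X$ be a finite simplicial complex of dimension $n$ in which every simplex is a face of some $n$-simplex (for $X=\mathfrak{B}$, $n=\ell$). $\mathrm{Ver}(X)$ is the set of vertices and $S_i(X)$ is the set of oriented $i$-simplices ($i$-simplices with an ordering of the vertices up to even permutation); $\bar s$ is $s$ with the opposite orientation. $C^i(X)$ is the real vector space of functions $f:S_i(X)\to\mathbb{R}$ with $f(\bar s)=-f(s)$ (no condition if $i=0$), and $C^i(X)=0$ for $i<0$ or $i>n$. For a simplex $s$, $w(s)$ is the number of (non-oriented) $n$-simplices of $X$ containing $s$. The coboundary $d:C^i(X)\to C^{i+1}(X)$ is $(df)([v_0,\dots,v_{i+1}])=\sum_{j=0}^{i+1}(-1)^jf([v_0,\dots,\hat v_j,\dots,v_{i+1}])$. The map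 $\delta:C^{i+1}(X)\to C^{i}(X)$ is $(\delta f)(s)=\sum_{v}\frac{w([v,s])}{w(s)}f([v,s])$, the sum being over $v\in\mathrm{Ver}(X)$ such that $\{v\}\cup s$ is an $(i+1)$-simplex, where for $s=[v_0,\dots,v_i]$ one puts $[v,s]=[v,v_0,\dots,v_i]$. The Laplace operator on $C^i(X)$ is $\Delta=\delta d$. It is self-adjoint and positive semi-definite for the inner product $(f,g)=\sum_{s}w(s)f(s)g(s)$ (sum over non-oriented $i$-simplices, each with an arbitrary orientation), so it is diagonalizable with non-negative real eigenvalues. -}

module Defs where

open import Algebra.Bundles using (Group)
import Data.Bool.Properties
open import Data.Fin.Base as Fin using (Fin)
open import Data.Fin.Properties as Fin using (any?; all?)
open import Data.Fin.Subset
  using (Subset; inside; outside; ⊤; _∈_; _∉_; _⊆_; _∩_; _∪_; ∣_∣; ⁅_⁆; ⋃; Nonempty)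
import Data.Fin.Subset.Properties as Sub
open import Data.Integer.Base using (+_)
open import Data.List.Base as List using (List; []; _∷_; _++_)
import Data.List.Membership.Propositional as ListMem
import Data.List.Membership.Propositional.Properties as ListMem
open import Data.List.Relation.Unary.Any using (here; there)
open import Data.Maybe.Base as Maybe using (Maybe)
open import Data.Nat.Base as ℕ using (ℕ; zero; suc; NonZero)
import Data.Nat.Properties as ℕ
open import Data.Parity.Base as ℙ using (Parity; 0ℙ; 1ℙ)
open import Data.Product.Base using (Σ; ∃; ∃₂; _×_; _,_)
open import Data.Rational.Base as ℚ using (ℚ; 0ℚ; 1ℚ; ½)
import Data.Rational.Properties as ℚ
import Data.Rational.Solver as ℚ
open import Data.Sum.Base using (_⊎_; inj₁; inj₂)
open import Data.Vec.Base as Vec using (Vec; []; _∷_)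
import Data.Vec.Properties
import Data.Vec.Relation.Unary.All as VecAll
open import Data.Vec.Relation.Unary.AllPairs using ([]; _∷_)
open import Data.Vec.Relation.Unary.Unique.Propositional using (Unique)
open import Function.Base using (_∘_)
open import Function.Bundles using (Inverse)
open import Level using (_⊔_) renaming (suc to lsuc; zero to 0ℓ)
open import Relation.Binary.Core using (Rel)
open import Relation.Binary.Definitions using (_Respects_)
open import Relation.Binary.PropositionalEquality
  using (_≡_; _≢_; refl; sym; trans; cong; subst; setoid)
open import Relation.Nullary.Decidable
  using (Dec; yes; no; does; map′; ¬?; _×-dec_; _→-dec_; dec⇒maybe; decidable-stable)
open import Relation.Nullary.Negation using (¬_)
open import Relation.Unary using (Pred; Decidable)

-- Real numbers: Cauchy sequences of rationals.  ℝ is a setoid; _≈ℝ_ holds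
-- when the difference of the two sequences tends to 0.

IsCauchy : (ℕ → ℚ) → Set
IsCauchy x = ∀ ε → 0ℚ ℚ.< ε → ∃ λ N → ∀ m n → N ℕ.≤ m → N ℕ.≤ n →
  ℚ.∣ x m ℚ.- x n ∣ ℚ.< ε

record ℝ : Set where
  constructor mkℝ
  field
    seq    : ℕ → ℚ
    cauchy : IsCauchy seq

open ℝ public

infix 4 _≈ℝ_ _≤ℝ_

_≈ℝ_ : Rel ℝ 0ℓ
x ≈ℝ y = ∀ ε → 0ℚ ℚ.< ε → ∃ λ N → ∀ n → N ℕ.≤ n → ℚ.∣ seq x n ℚ.- seq y n ∣ ℚ.< ε

_≤ℝ_ : Rel ℝ 0ℓ
x ≤ℝ y = ∀ ε → 0ℚ ℚ.< ε → ∃ λ N → ∀ n → N ℕ.≤ n → seq x n ℚ.≤ seq y n ℚ.+ ε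

fromℚ : ℚ → ℝ
fromℚ q = mkℝ (λ _ → q) λ ε 0<ε → 0 , λ _ _ _ _ →
  subst (ℚ._< ε) (sym (cong ℚ.∣_∣ (ℚ.+-inverseʳ q))) 0<ε

fromℕ : ℕ → ℝ
fromℕ n = fromℚ (+ n ℚ./ 1)

0ℝ : ℝ
0ℝ = fromℚ 0ℚ

open ℚ.+-*-Solver using (solve; _:+_; _:*_; _:-_; :-_; _:=_; con)

half-pos : ∀ {ε} → 0ℚ ℚ.< ε → 0ℚ ℚ.< ½ ℚ.* ε
half-pos {ε} p = ℚ.positive⁻¹ _ {{ℚ.pos*pos⇒pos ½ ε {{ℚ.positive p}}}}

half+half : ∀ ε → ½ ℚ.* ε ℚ.+ ½ ℚ.* ε ≡ ε
half+half ε = trans (sym (ℚ.*-distribʳ-+ ε ½ ½)) (ℚ.*-identityˡ ε)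

sum-< : ∀ {a b ε} → ℚ.∣ a ∣ ℚ.< ½ ℚ.* ε → ℚ.∣ b ∣ ℚ.< ½ ℚ.* ε → ℚ.∣ a ℚ.+ b ∣ ℚ.< ε
sum-< {a} {b} {ε} p q = ℚ.≤-<-trans (ℚ.∣p+q∣≤∣p∣+∣q∣ a b)
  (subst (_ ℚ.<_) (half+half ε) (ℚ.+-mono-< p q))

bounded : ∀ {x} → IsCauchy x →
          ∃₂ λ M N → 0ℚ ℚ.< M × (∀ n → N ℕ.≤ n → ℚ.∣ x n ∣ ℚ.< M)
bounded {x} cx with cx 1ℚ (ℚ.positive⁻¹ 1ℚ)
... | N , h = 1ℚ ℚ.+ ℚ.∣ x N ∣ , N
    , ℚ.<-≤-trans (ℚ.positive⁻¹ 1ℚ)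
        (subst (ℚ._≤ 1ℚ ℚ.+ ℚ.∣ x N ∣) (ℚ.+-identityʳ 1ℚ)
          (ℚ.+-monoʳ-≤ 1ℚ (ℚ.0≤∣p∣ (x N))))
    , λ n N≤n → ℚ.≤-<-trans
        (subst (λ t → ℚ.∣ t ∣ ℚ.≤ ℚ.∣ x n ℚ.- x N ∣ ℚ.+ ℚ.∣ x N ∣)
          (solve 2 (λ a b → (a :- b) :+ b := a) refl (x n) (x N))
          (ℚ.∣p+q∣≤∣p∣+∣q∣ (x n ℚ.- x N) (x N)))
        (ℚ.+-monoˡ-< ℚ.∣ x N ∣ (h n N N≤n ℕ.≤-refl))

product-small : ∀ {M} → 0ℚ ℚ.< M → ∀ {ε} → 0ℚ ℚ.< ε → ∃ λ η → 0ℚ ℚ.< η ×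
                (∀ a b → ℚ.∣ a ∣ ℚ.< M → ℚ.∣ b ∣ ℚ.< η → ℚ.∣ a ℚ.* b ∣ ℚ.< ε)
product-small {M} 0<M {ε} 0<ε = η , 0<η , λ a b a<M b<η →
    subst (ℚ._< ε) (sym (ℚ.∣p*q∣≡∣p∣*∣q∣ a b))
      (ℚ.≤-<-trans (ℚ.*-monoʳ-≤-nonNeg ℚ.∣ b ∣ {{ℚ.nonNegative (ℚ.0≤∣p∣ b)}} (ℚ.<⇒≤ a<M))
        (subst (M ℚ.* ℚ.∣ b ∣ ℚ.<_) M*η≡ε (ℚ.*-monoʳ-<-pos M b<η)))
  where
  instance
    M-pos : ℚ.Positive M
    M-pos = ℚ.positive 0<M
    M-nonZero : ℚ.NonZero M
    M-nonZero = ℚ.pos⇒nonZero M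
    ε-pos : ℚ.Positive ε
    ε-pos = ℚ.positive 0<ε
  η = ℚ.1/ M ℚ.* ε
  0<η : 0ℚ ℚ.< η
  0<η = ℚ.positive⁻¹ η {{ℚ.pos*pos⇒pos (ℚ.1/ M) {{ℚ.1/pos⇒pos M}} ε}}
  M*η≡ε : M ℚ.* η ≡ ε
  M*η≡ε = trans (sym (ℚ.*-assoc M (ℚ.1/ M) ε))
    (trans (cong (ℚ._* ε) (ℚ.*-inverseʳ M)) (ℚ.*-identityˡ ε))

infixl 6 _+ℝ_
infixl 7 _*ℝ_
infix  8 -ℝ_

_+ℝ_ : ℝ → ℝ → ℝ
x +ℝ y = mkℝ (λ n → seq x n ℚ.+ seq y n) λ ε 0<ε →
  let (N₁ , h₁) = cauchy x (½ ℚ.* ε) (half-pos 0<ε)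
      (N₂ , h₂) = cauchy y (½ ℚ.* ε) (half-pos 0<ε)
  in N₁ ℕ.⊔ N₂ , λ m n N≤m N≤n →
     subst (λ t → ℚ.∣ t ∣ ℚ.< ε)
       (solve 4 (λ a b c d → (a :- c) :+ (b :- d) := (a :+ b) :- (c :+ d)) refl
         (seq x m) (seq y m) (seq x n) (seq y n))
       (sum-< (h₁ m n (ℕ.m⊔n≤o⇒m≤o N₁ N₂ N≤m) (ℕ.m⊔n≤o⇒m≤o N₁ N₂ N≤n))
              (h₂ m n (ℕ.m⊔n≤o⇒n≤o N₁ N₂ N≤m) (ℕ.m⊔n≤o⇒n≤o N₁ N₂ N≤n)))

-ℝ_ : ℝ → ℝ
-ℝ x = mkℝ (λ n → ℚ.- seq x n) λ ε 0<ε →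
  let (N , h) = cauchy x ε 0<ε
  in N , λ m n N≤m N≤n →
     subst (ℚ._< ε)
       (trans (sym (ℚ.∣-p∣≡∣p∣ (seq x m ℚ.- seq x n)))
         (cong ℚ.∣_∣ (solve 2 (λ a b → :- (a :- b) := (:- a) :- (:- b)) refl (seq x m) (seq x n))))
       (h m n N≤m N≤n)

_*ℝ_ : ℝ → ℝ → ℝ
x *ℝ y = mkℝ (λ n → seq x n ℚ.* seq y n) λ ε 0<ε →
  let (Mx , Bx , 0<Mx , bx) = bounded (cauchy x)
      (My , By , 0<My , by) = bounded (cauchy y)
      (ηx , 0<ηx , px)      = product-small 0<Mx (half-pos 0<ε)
      (ηy , 0<ηy , py)      = product-small 0<My (half-pos 0<ε)
      (N₁ , h₁)             = cauchy y ηx 0<ηx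
      (N₂ , h₂)             = cauchy x ηy 0<ηy
      N                     = (Bx ℕ.⊔ By) ℕ.⊔ (N₁ ℕ.⊔ N₂)
      ≥Bx = λ {m} (p : N ℕ.≤ m) → ℕ.m⊔n≤o⇒m≤o Bx By (ℕ.m⊔n≤o⇒m≤o (Bx ℕ.⊔ By) (N₁ ℕ.⊔ N₂) p)
      ≥By = λ {m} (p : N ℕ.≤ m) → ℕ.m⊔n≤o⇒n≤o Bx By (ℕ.m⊔n≤o⇒m≤o (Bx ℕ.⊔ By) (N₁ ℕ.⊔ N₂) p)
      ≥N₁ = λ {m} (p : N ℕ.≤ m) → ℕ.m⊔n≤o⇒m≤o N₁ N₂ (ℕ.m⊔n≤o⇒n≤o (Bx ℕ.⊔ By) (N₁ ℕ.⊔ N₂) p)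
      ≥N₂ = λ {m} (p : N ℕ.≤ m) → ℕ.m⊔n≤o⇒n≤o N₁ N₂ (ℕ.m⊔n≤o⇒n≤o (Bx ℕ.⊔ By) (N₁ ℕ.⊔ N₂) p)
  in N , λ m n N≤m N≤n →
     subst (λ t → ℚ.∣ t ∣ ℚ.< ε)
       (solve 4 (λ a b c d → a :* (b :- d) :+ d :* (a :- c) := a :* b :- c :* d) refl
         (seq x m) (seq y m) (seq x n) (seq y n))
       (sum-< (px (seq x m) (seq y m ℚ.- seq y n) (bx m (≥Bx N≤m)) (h₁ m n (≥N₁ N≤m) (≥N₁ N≤n)))
              (py (seq y n) (seq x m ℚ.- seq x n) (by n (≥By N≤n)) (h₂ m n (≥N₂ N≤m) (≥N₂ N≤n))))

∑ : List ℝ → ℝ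
∑ = List.foldr _+ℝ_ 0ℝ

-- ±^ j x  is  (-1)^j x.
±^ : ℕ → ℝ → ℝ
±^ zero    x = x
±^ (suc j) x = -ℝ (±^ j x)

allSubsets : ∀ n → List (Subset n)
allSubsets zero    = [] ∷ []
allSubsets (suc n) = List.map (inside ∷_) (allSubsets n) ++ List.map (outside ∷_) (allSubsets n)

∈-allSubsets : ∀ {n} (σ : Subset n) → σ ListMem.∈ allSubsets n
∈-allSubsets []            = here refl
∈-allSubsets (inside  ∷ σ) = ListMem.∈-++⁺ˡ (ListMem.∈-map⁺ (inside ∷_) (∈-allSubsets σ))
∈-allSubsets (outside ∷ σ) =
  ListMem.∈-++⁺ʳ (List.map (inside ∷_) (allSubsets _)) (ListMem.∈-map⁺ (outside ∷_) (∈-allSubsets σ))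

record SetFamily p : Set (lsuc p) where
  field
    #Ver     : ℕ
    Simplex  : Pred (Subset #Ver) p
    Simplex? : Decidable Simplex

  -- The n-simplices are the simplices with n + 1 vertices.
  IsSimplex : ℕ → Pred (Subset #Ver) p
  IsSimplex n σ = Simplex σ × ∣ σ ∣ ≡ suc n

-- The family is a simplicial complex of dimension n all of whose simplices
-- are faces of n-simplices.
record IsPureComplex {p} (n : ℕ) (K : SetFamily p) : Set p where
  open SetFamily K
  field
    nonempty  : ∀ {σ} → Simplex σ → Nonempty σ
    vertex    : ∀ v → Simplex ⁅ v ⁆
    face      : ∀ {σ τ} → Simplex σ → Nonempty τ → τ ⊆ σ → Simplex τ
    inhabited : ∃ Simplex
    pure      : ∀ {σ} → Simplex σ → ∃ λ τ → IsSimplex n τ × σ ⊆ τ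

⟦_⟧ : ∀ {k m} → Vec (Fin k) m → Subset k
⟦ vs ⟧ = ⋃ (Vec.toList (Vec.map ⁅_⁆ vs))

-- ys is xs reordered by a permutation of the given parity; when xs has
-- distinct entries that parity is determined by xs and ys.
infix 4 _~[_]_

data _~[_]_ {a} {A : Set a} : ∀ {m} → Vec A m → Parity → Vec A m → Set a where
  ~refl  : ∀ {m} {xs : Vec A m} → xs ~[ 0ℙ ] xs
  ~swap  : ∀ {m} x y {xs : Vec A m} → x ∷ y ∷ xs ~[ 1ℙ ] y ∷ x ∷ xs
  ~prep  : ∀ {m} x {p} {xs ys : Vec A m} → xs ~[ p ] ys → x ∷ xs ~[ p ] x ∷ ys
  ~trans : ∀ {m} {p q} {xs ys zs : Vec A m} →
           xs ~[ p ] ys → ys ~[ q ] zs → xs ~[ p ℙ.+ q ] zs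

All-removeAt : ∀ {a p} {A : Set a} {P : Pred A p} {m} {xs : Vec A (suc m)} j →
               VecAll.All P xs → VecAll.All P (Vec.removeAt xs j)
All-removeAt Fin.zero    (_ VecAll.∷ pxs) = pxs
All-removeAt {xs = _ ∷ _ ∷ _} (Fin.suc j) (px VecAll.∷ pxs) = px VecAll.∷ All-removeAt j pxs

Unique-removeAt : ∀ {a} {A : Set a} {m} {xs : Vec A (suc m)} j →
                  Unique xs → Unique (Vec.removeAt xs j)
Unique-removeAt Fin.zero    (_ ∷ u) = u
Unique-removeAt {xs = _ ∷ _ ∷ _} (Fin.suc j) (x∉ ∷ u) = All-removeAt j x∉ ∷ Unique-removeAt j u

⟦removeAt⟧⊆ : ∀ {k m} (xs : Vec (Fin k) (suc m)) j → ⟦ Vec.removeAt xs j ⟧ ⊆ ⟦ xs ⟧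
⟦removeAt⟧⊆ (x ∷ xs) Fin.zero = Sub.q⊆p∪q ⁅ x ⁆ ⟦ xs ⟧
⟦removeAt⟧⊆ (x ∷ xs@(_ ∷ _)) (Fin.suc j) v∈ with Sub.x∈p∪q⁻ ⁅ x ⁆ _ v∈
... | inj₁ v∈x = Sub.p⊆p∪q ⟦ xs ⟧ v∈x
... | inj₂ v∈r = Sub.q⊆p∪q ⁅ x ⁆ ⟦ xs ⟧ (⟦removeAt⟧⊆ xs j v∈r)

⟦⟧-nonempty : ∀ {k m} (xs : Vec (Fin k) (suc m)) → Nonempty ⟦ xs ⟧
⟦⟧-nonempty (x ∷ xs) = x , Sub.p⊆p∪q ⟦ xs ⟧ (Sub.x∈⁅x⁆ x)

∉⟦⟧⇒All≢ : ∀ {k m} {v : Fin k} (xs : Vec (Fin k) m) → v ∉ ⟦ xs ⟧ → VecAll.All (v ≢_) xs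
∉⟦⟧⇒All≢ []       v∉ = VecAll.[]
∉⟦⟧⇒All≢ (x ∷ xs) v∉ =
  (λ { refl → v∉ (Sub.p⊆p∪q ⟦ xs ⟧ (Sub.x∈⁅x⁆ x)) })
    VecAll.∷ ∉⟦⟧⇒All≢ xs (v∉ ∘ Sub.q⊆p∪q ⁅ x ⁆ ⟦ xs ⟧)

module Laplacian {p} {n : ℕ} (X : SetFamily p) (isPure : IsPureComplex n X) where
  open SetFamily X
  open IsPureComplex isPure

  -- An ordered simplex [v₀ , … , vᵢ].  Two of them define the same oriented
  -- simplex when they are related by _~[ 0ℙ ]_, and opposite ones when they are
  -- related by _~[ 1ℙ ]_.
  record OrderedSimplex (i : ℕ) : Set p where
    field
      vertices  : Vec (Fin #Ver) (suc i)
      distinct  : Unique vertices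
      isSimplex : Simplex ⟦ vertices ⟧

  open OrderedSimplex public

  -- For i = 0 the condition `odd` is void.
  record C (i : ℕ) : Set p where
    field
      at   : OrderedSimplex i → ℝ
      even : ∀ s t → vertices s ~[ 0ℙ ] vertices t → at t ≈ℝ at s
      odd  : ∀ s t → vertices s ~[ 1ℙ ] vertices t → at t ≈ℝ -ℝ (at s)

  open C public

  remove : ∀ {i} → Fin (suc (suc i)) → OrderedSimplex (suc i) → OrderedSimplex i
  remove j s = record
    { vertices  = Vec.removeAt (vertices s) j
    ; distinct  = Unique-removeAt j (distinct s)
    ; isSimplex = face (isSimplex s) (⟦⟧-nonempty (Vec.removeAt (vertices s) j))
                    (⟦removeAt⟧⊆ (vertices s) j)
    }

  cone? : ∀ {i} (s : OrderedSimplex i) v →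
          Dec (v ∉ ⟦ vertices s ⟧ × Simplex (⁅ v ⁆ ∪ ⟦ vertices s ⟧))
  cone? s v = ¬? (v Sub.∈? ⟦ vertices s ⟧) ×-dec Simplex? (⁅ v ⁆ ∪ ⟦ vertices s ⟧)

  cone : ∀ {i} (s : OrderedSimplex i) v →
         v ∉ ⟦ vertices s ⟧ × Simplex (⁅ v ⁆ ∪ ⟦ vertices s ⟧) → OrderedSimplex (suc i)
  cone s v (v∉s , v∪s) = record
    { vertices  = v ∷ vertices s
    ; distinct  = ∉⟦⟧⇒All≢ (vertices s) v∉s ∷ distinct s
    ; isSimplex = v∪s
    }

  cones : ∀ {i} → OrderedSimplex i → List (OrderedSimplex (suc i))
  cones s = List.mapMaybe (λ v → Maybe.map (cone s v) (dec⇒maybe (cone? s v))) (List.allFin #Ver)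

  IsSimplex? : ∀ m → Decidable (IsSimplex m)
  IsSimplex? m σ = Simplex? σ ×-dec (∣ σ ∣ ℕ.≟ suc m)

  over? : ∀ σ → Decidable (λ τ → IsSimplex n τ × σ ⊆ τ)
  over? σ τ = IsSimplex? n τ ×-dec (σ Sub.⊆? τ)

  -- The number of n-simplices containing s.
  w : ∀ {i} → OrderedSimplex i → ℕ
  w s = List.length (List.filter (over? ⟦ vertices s ⟧) (allSubsets #Ver))

  w-nonZero : ∀ {i} (s : OrderedSimplex i) → NonZero (w s)
  w-nonZero s with pure (isSimplex s)
  ... | τ , h with List.filter (over? ⟦ vertices s ⟧) (allSubsets #Ver)
                 | ListMem.∈-filter⁺ (over? ⟦ vertices s ⟧) (∈-allSubsets τ) h
  ...   | _ ∷ _ | _ = _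

  -- d, δ and Δ are given by their formulas on arbitrary functions of ordered
  -- simplices; they preserve the conditions defining C.
  d : ∀ {i} → (OrderedSimplex i → ℝ) → OrderedSimplex (suc i) → ℝ
  d {i} f s = ∑ (List.map (λ j → ±^ (Fin.toℕ j) (f (remove j s))) (List.allFin (suc (suc i))))

  δ : ∀ {i} → (OrderedSimplex (suc i) → ℝ) → OrderedSimplex i → ℝ
  δ f s = ∑ (List.map (λ t → fromℚ ((+ w t ℚ./ w s) {{w-nonZero s}}) *ℝ f t) (cones s))

  Δ : ∀ {i} → (OrderedSimplex i → ℝ) → OrderedSimplex i → ℝ
  Δ f = δ (d f)

  IsEigenvalue : ℕ → ℝ → Set p
  IsEigenvalue i μ = Σ (C i) λ f →
    ¬ (∀ s → at f s ≈ℝ 0ℝ) × (∀ s → Δ (at f) s ≈ℝ μ *ℝ at f s)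

  IsMaximalEigenvalue : ℕ → ℝ → Set p
  IsMaximalEigenvalue i μ = IsEigenvalue i μ × (∀ ν → IsEigenvalue i ν → ν ≤ℝ μ)

record FiniteGroup c r : Set (lsuc (c ⊔ r)) where
  field
    group       : Group c r
    order       : ℕ
    enumeration : Inverse (Group.setoid group) (setoid (Fin order))

  open Group group public hiding (refl; sym; trans; setoid)
  open Inverse enumeration public using (to; from; to-cong; strictlyInverseʳ)

  infix 4 _∈ᴳ_

  _∈ᴳ_ : Carrier → Subset order → Set
  x ∈ᴳ A = to x ∈ A

  record IsSubgroup (H : Subset order) : Set c where
    field
      ε∈  : ε ∈ᴳ H
      ∙∈  : ∀ x y → x ∈ᴳ H → y ∈ᴳ H → x ∙ y ∈ᴳ H
      ⁻¹∈ : ∀ x → x ∈ᴳ H → x ⁻¹ ∈ᴳ H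

  data ⟨_⟩ {a} (A : Pred Carrier a) : Pred Carrier (c ⊔ r ⊔ a) where
    gen  : ∀ {x} → A x → ⟨ A ⟩ x
    ε∈   : ⟨ A ⟩ ε
    ∙∈   : ∀ {x y} → ⟨ A ⟩ x → ⟨ A ⟩ y → ⟨ A ⟩ (x ∙ y)
    ⁻¹∈  : ∀ {x} → ⟨ A ⟩ x → ⟨ A ⟩ (x ⁻¹)
    resp : ∀ {x y} → x ≈ y → ⟨ A ⟩ x → ⟨ A ⟩ y

  ∈-resp : ∀ A → (_∈ᴳ A) Respects _≈_
  ∈-resp A x≈y = subst (_∈ A) (to-cong x≈y)

  _∈ᴳ?_ : ∀ x A → Dec (x ∈ᴳ A)
  x ∈ᴳ? A = to x Sub.∈? A

  all-∈? : ∀ {a} {P : Pred Carrier a} → P Respects _≈_ → Decidable P → Dec (∀ x → P x)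
  all-∈? P-resp P? =
    map′ (λ h x → P-resp (strictlyInverseʳ x) (h (to x))) (λ h k → h (from k))
         (all? (λ k → P? (from k)))

  any-∈? : ∀ {a} {P : Pred Carrier a} → P Respects _≈_ → Decidable P → Dec (∃ P)
  any-∈? P-resp P? =
    map′ (λ (k , h) → from k , h)
         (λ (x , h) → to x , P-resp (Group.sym group (strictlyInverseʳ x)) h)
         (any? (λ k → P? (from k)))

  IsSubgroup? : Decidable IsSubgroup
  IsSubgroup? H =
    map′ (λ (e , m , i) → record { ε∈ = e ; ∙∈ = m ; ⁻¹∈ = i })
         (λ h → IsSubgroup.ε∈ h , IsSubgroup.∙∈ h , IsSubgroup.⁻¹∈ h)
      ((ε ∈ᴳ? H)
        ×-dec all-∈?
          (λ x≈ h y x∈ y∈ →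
             ∈-resp H (∙-congʳ x≈) (h y (∈-resp H (Group.sym group x≈) x∈) y∈))
          (λ x → all-∈?
            (λ y≈ h x∈ y∈ →
               ∈-resp H (∙-congˡ y≈) (h x∈ (∈-resp H (Group.sym group y≈) y∈)))
            (λ y → (x ∈ᴳ? H) →-dec ((y ∈ᴳ? H) →-dec ((x ∙ y) ∈ᴳ? H))))
        ×-dec all-∈?
          (λ x≈ h x∈ → ∈-resp H (⁻¹-cong x≈) (h (∈-resp H (Group.sym group x≈) x∈)))
          (λ x → (x ∈ᴳ? H) →-dec ((x ⁻¹) ∈ᴳ? H)))

  ContainsConjugate : Subset order → Subset order → Carrier → Set c
  ContainsConjugate P B g = ∀ b → b ∈ᴳ B → g ∙ b ∙ g ⁻¹ ∈ᴳ P

  containsConjugate? : ∀ P B → Dec (∃ (ContainsConjugate P B))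
  containsConjugate? P B = any-∈?
    (λ g≈ h b b∈ → ∈-resp P (∙-cong (∙-congʳ g≈) (⁻¹-cong g≈)) (h b b∈))
    (λ g → all-∈?
      (λ b≈ h b∈ →
         ∈-resp P (∙-congʳ (∙-congˡ b≈)) (h (∈-resp B (Group.sym group b≈) b∈)))
      (λ b → (b ∈ᴳ? B) →-dec ((g ∙ b ∙ g ⁻¹) ∈ᴳ? P)))

-- Elements of W = N / (B ∩ N) are given by representatives in N.  The subset
-- S of W is listed without repetition, so that |S| = rank.
record TitsSystem {c r} (G : FiniteGroup c r) (rank : ℕ) : Set (c ⊔ r) where
  open FiniteGroup G

  field
    B N        : Subset order
    B-subgroup : IsSubgroup B
    N-subgroup : IsSubgroup N
    s          : Fin rank → Carrier
    s∈N        : ∀ j → s j ∈ᴳ N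
    s-distinct : ∀ {j k} → j ≢ k → ¬ (s j ⁻¹ ∙ s k ∈ᴳ B ∩ N)

  B⟨_⟩B : Carrier → Pred Carrier (c ⊔ r)
  B⟨ g ⟩B x = ∃₂ λ b b′ → b ∈ᴳ B × b′ ∈ᴳ B × x ≈ b ∙ g ∙ b′

  field
    generated     : ∀ x → ⟨ (λ y → y ∈ᴳ B ∪ N) ⟩ x
    normal        : ∀ x t → x ∈ᴳ N → t ∈ᴳ B ∩ N → x ∙ t ∙ x ⁻¹ ∈ᴳ B ∩ N
    -- S generates W: lifted to N, S together with B ∩ N generates N.
    S-generates   : ∀ x → x ∈ᴳ N → ⟨ (λ y → (∃ λ j → y ≈ s j) ⊎ y ∈ᴳ B ∩ N) ⟩ x
    s-nontrivial  : ∀ j → ¬ (s j ∈ᴳ B ∩ N)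
    s-involutive  : ∀ j → s j ∙ s j ∈ᴳ B ∩ N
    sBw⊆BwB∪BswB  : ∀ j x b → x ∈ᴳ N → b ∈ᴳ B →
                    B⟨ x ⟩B (s j ∙ b ∙ x) ⊎ B⟨ s j ∙ x ⟩B (s j ∙ b ∙ x)
    sBs⁻¹⊈B       : ∀ j → ¬ ContainsConjugate B B (s j)

module _ {c r} {G : FiniteGroup c r} {rank : ℕ} (T : TitsSystem G rank) where
  open FiniteGroup G
  open TitsSystem T

  ProperParabolic : Pred (Subset order) c
  ProperParabolic P = IsSubgroup P × P ≢ ⊤ × ∃ (ContainsConjugate P B)

  MaximalParabolic : Pred (Subset order) c
  MaximalParabolic P =
    ProperParabolic P × (∀ Q → ProperParabolic Q → P ⊆ Q → P ≡ Q)

  _≟ˢ_ : ∀ {m} (A A′ : Subset m) → Dec (A ≡ A′)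
  _≟ˢ_ = Data.Vec.Properties.≡-dec Data.Bool.Properties._≟_

  properParabolic? : Decidable ProperParabolic
  properParabolic? P = IsSubgroup? P ×-dec (¬? (P ≟ˢ ⊤) ×-dec containsConjugate? P B)

  maximalParabolic? : Decidable MaximalParabolic
  maximalParabolic? P = properParabolic? P ×-dec
    map′ (λ none Q Q-par P⊆Q → decidable-stable (P ≟ˢ Q) (λ P≢Q →
            none (Q , Q-par , (λ {_} → P⊆Q) , P≢Q)))
         (λ h (Q , Q-par , P⊆Q , P≢Q) → P≢Q (h Q Q-par (λ {_} → P⊆Q)))
      (¬? (Sub.anySubset? (λ Q → properParabolic? Q ×-dec ((P Sub.⊆? Q) ×-dec ¬? (P ≟ˢ Q)))))

  maximalParabolics : List (Subset order)
  maximalParabolics = List.filter maximalParabolic? (allSubsets order)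

  -- The vertices of the simplex corresponding to P are its 0-dimensional
  -- faces: the maximal proper parabolic subgroups containing P.
  verticesOf : Subset order → Subset (List.length maximalParabolics)
  verticesOf P = Vec.tabulate λ v → does (P Sub.⊆? List.lookup maximalParabolics v)

  building : SetFamily c
  building = record
    { #Ver     = List.length maximalParabolics
    ; Simplex  = λ σ → ∃ λ P → ProperParabolic P × σ ≡ verticesOf P
    ; Simplex? = λ σ → Sub.anySubset? (λ P → properParabolic? P ×-dec (σ ≟ˢ verticesOf P))
    }

{-# OPTIONS --safe #-}

-- On the chambers (the ℓ-simplices) Δ is an average of the Laplacians δd of
-- full simplices with ℓ + 1 vertices, for which δd + dδ = ℓ + 1.  Hence
-- (ℓ + 1) (f , f) − (Δ f , f) is the sum over the chambers of the squares ∥δf∥²,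
-- so no eigenvalue exceeds ℓ + 1.  This value is attained because the vertices
-- have a type, and the type map is bijective on every chamber: the pullback of
-- a coclosed i-cochain of the full simplex is an eigenvector, and nonzero ones
-- exist for i < ℓ.
--
-- That the simplices over a chamber g B form the lattice of subsets of S, and
-- that types are well defined, both rest on one fact about Tits systems: a
-- subgroup H containing B and g B g⁻¹ contains g, and moreover all the letters
-- of a reduced word for the double coset B g B.

module Submission where

open import Defs
open import Algebra.Bundles using (CommutativeRing; CommutativeSemiring; Group)
import Algebra.Definitions.RawMonoid
import Algebra.Properties.AbelianGroup
import Algebra.Properties.CommutativeSemigroup
import Algebra.Properties.Group
import Algebra.Properties.Ring
open import Data.Bool.Base using (Bool; true; false; not; if_then_else_)
open import Data.Fin.Base as Fin using (Fin; zero; suc; toℕ; punchIn; punchOut)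
import Data.Fin.Properties as Fin
open import Data.Fin.Subset
  using (Subset; inside; outside; ⊤; _∈_; _⊆_; _∩_; _∪_; ∣_∣; ⁅_⁆; Nonempty)
import Data.Fin.Subset.Properties as Sub
open import Data.Integer.Base as ℤ using (+_)
import Data.Integer.Solver as ℤ
open import Data.List.Base as List using (List; []; _∷_; _∷ʳ_; _++_; length)
import Data.List.Membership.Propositional as List
import Data.List.Membership.Propositional.Properties as List
import Data.List.Properties as List
open import Data.List.Relation.Unary.All as All using (All; []; _∷_)
import Data.List.Relation.Unary.AllPairs as AllPairs
open import Data.List.Relation.Unary.Any as Any using (here; there)
import Data.List.Relation.Unary.Any.Properties as Any
import Data.List.Relation.Unary.Unique.Propositional as ListUnique
import Data.List.Relation.Unary.Unique.Propositional.Properties as ListUnique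
open import Data.List.Reverse using (Reverse; []; _∶_∶ʳ_; reverseView)
open import Data.Maybe.Base as Maybe using (Maybe)
open import Data.Nat.Base using (ℕ; suc; _<_)
open import Data.Nat.Base as ℕ using (zero; NonZero; _≤_; s≤s; z≤n)
open import Data.Nat.Induction using (<-rec)
import Data.Nat.Properties as ℕ
open import Data.Parity.Base as ℙ using (Parity; 0ℙ; 1ℙ)
import Data.Parity.Properties as ℙ
open import Data.Product.Base using (Σ)
open import Data.Product.Base using (∃; _×_; _,_; proj₁; proj₂)
open import Data.Rational.Base as ℚ using (ℚ; 0ℚ; 1ℚ; ½)
import Data.Rational.Properties as ℚ
import Data.Rational.Solver as ℚ
open import Data.Rational.Unnormalised.Base as ℚᵘ using (mkℚᵘ; *≡*)
import Data.Rational.Unnormalised.Properties as ℚᵘ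
open import Data.Sum.Base as Sum using (_⊎_; inj₁; inj₂; [_,_]′)
open import Data.Vec.Base as Vec using (Vec; []; _∷_)
import Data.Vec.Properties as Vec
open import Data.Vec.Relation.Unary.All as VecAll using ([]; _∷_)
import Data.Vec.Relation.Unary.All.Properties as VecAll
open import Data.Vec.Relation.Unary.AllPairs as VecAllPairs using ([]; _∷_)
open import Data.Vec.Relation.Unary.Unique.Propositional using (Unique)
import Data.Vec.Relation.Unary.Unique.Propositional.Properties as Unique
open import Function.Base using (_∘_; id)
open import Function.Bundles using (Inverse; mk⇔)
open import Level using (0ℓ; _⊔_)
open import Relation.Binary.Definitions using (_Respects_; tri<; tri≈; tri>)
open import Relation.Binary.PropositionalEquality as ≡ using (_≡_; _≢_)
import Relation.Binary.Reasoning.Setoid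
import Relation.Binary.Reflection as Reflection
open import Relation.Nullary.Decidable
  using (Dec; yes; no; does; map′; ¬?; _×-dec_; _→-dec_; dec⇒maybe; dec-true; dec-false; does-⇔;
         decidable-stable; toSum; ¬¬-excluded-middle)
open import Relation.Nullary.Negation using (¬_; contradiction)
open import Relation.Unary using (Pred; Decidable)

-- Cochains are extended by 0 to all tuples of vertices: no orientation has to be chosen, every sum
-- runs over a product, and each simplex is counted once per ordering on both sides of every
-- identity. Chambers enter because the weights count them. After multiplication by w(s), the
-- weighted sum over cones on s is a sum over pairs of a chamber σ containing s and a vertex of σ
-- outside s. The vertices of s can then be let in as well, since df vanishes there, and the
-- constant ℓ + 1 = |σ| appears.
--
-- The real numbers shape the upper bound. Their order is undecidable and an eigenvalue may be any
-- real, so a Rayleigh quotient is avoided: the assumption ν > ℓ + 1 is refuted instead, and this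
-- suffices because `_≤ℝ_` is stable under double negation. For the lower bound, the Vandermonde
-- determinant supplies an alternating function with rational values, so that nonvanishing becomes a
-- statement about a single rational number.

-- Groups

-- Group words are normalised to freely reduced lists of signed variables.
module GroupSolver {c ℓ} (G : Group c ℓ) where
  open Group G
  open Algebra.Properties.Group G
  open Relation.Binary.Reasoning.Setoid setoid

  infixl 7 _⊙_
  infix  8 _⁻

  data Expr (n : ℕ) : Set where
    var : Fin n → Expr n
    e   : Expr n
    _⊙_ : Expr n → Expr n → Expr n
    _⁻  : Expr n → Expr n

  Env : ℕ → Set c
  Env n = Vec Carrier n

  ⟦_⟧ₑ : ∀ {n} → Expr n → Env n → Carrier
  ⟦ var x ⟧ₑ ρ = Vec.lookup ρ x
  ⟦ e ⟧ₑ     ρ = ε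
  ⟦ s ⊙ t ⟧ₑ ρ = ⟦ s ⟧ₑ ρ ∙ ⟦ t ⟧ₑ ρ
  ⟦ s ⁻ ⟧ₑ   ρ = ⟦ s ⟧ₑ ρ ⁻¹

  signed : Bool → Carrier → Carrier
  signed b x = if b then x else x ⁻¹

  ⟦_⟧ᶠ : ∀ {n} → List (Bool × Fin n) → Env n → Carrier
  ⟦ [] ⟧ᶠ          ρ = ε
  ⟦ (b , x) ∷ w ⟧ᶠ ρ = signed b (Vec.lookup ρ x) ∙ ⟦ w ⟧ᶠ ρ

  cons : ∀ {n} → Bool → Fin n → List (Bool × Fin n) → List (Bool × Fin n)
  cons b x [] = (b , x) ∷ []
  cons b x ((b′ , y) ∷ w) with x Fin.≟ y
  cons true  x ((true  , y) ∷ w) | _     = (true , x) ∷ (true , y) ∷ w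
  cons false x ((false , y) ∷ w) | _     = (false , x) ∷ (false , y) ∷ w
  cons true  x ((false , y) ∷ w) | yes _ = w
  cons false x ((true  , y) ∷ w) | yes _ = w
  cons b     x ((b′    , y) ∷ w) | no _  = (b , x) ∷ (b′ , y) ∷ w

  cons-correct : ∀ {n} b x w (ρ : Env n) →
                 ⟦ cons b x w ⟧ᶠ ρ ≈ signed b (Vec.lookup ρ x) ∙ ⟦ w ⟧ᶠ ρ
  cons-correct b x [] ρ = refl
  cons-correct b x ((b′ , y) ∷ w) ρ with x Fin.≟ y
  cons-correct true  x ((true  , y) ∷ w) ρ | yes _    = refl
  cons-correct true  x ((true  , y) ∷ w) ρ | no _     = refl
  cons-correct false x ((false , y) ∷ w) ρ | yes _    = refl
  cons-correct false x ((false , y) ∷ w) ρ | no _     = refl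
  cons-correct true  x ((false , y) ∷ w) ρ | yes ≡.refl = sym
      (\\-leftDividesˡ (Vec.lookup ρ x) (⟦ w ⟧ᶠ ρ))
  cons-correct false x ((true  , y) ∷ w) ρ | yes ≡.refl = sym
      (\\-leftDividesʳ (Vec.lookup ρ x) (⟦ w ⟧ᶠ ρ))
  cons-correct true  x ((false , y) ∷ w) ρ | no _     = refl
  cons-correct false x ((true  , y) ∷ w) ρ | no _     = refl

  -- The Boolean is the sign with which the expression is read and the last argument is an
  -- accumulator: inverses are pushed down to the variables, and cancellation happens at the head of
  -- the word built so far.
  prepend : ∀ {n} → Bool → Expr n → List (Bool × Fin n) → List (Bool × Fin n)
  prepend b     (var x) w = cons b x w
  prepend b     e       w = w
  prepend true  (s ⊙ t) w = prepend true s (prepend true t w)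
  prepend false (s ⊙ t) w = prepend false t (prepend false s w)
  prepend b     (s ⁻)   w = prepend (not b) s w

  prepend-correct : ∀ {n} b s w (ρ : Env n) →
                    ⟦ prepend b s w ⟧ᶠ ρ ≈ signed b (⟦ s ⟧ₑ ρ) ∙ ⟦ w ⟧ᶠ ρ
  prepend-correct b     (var x) w ρ = cons-correct b x w ρ
  prepend-correct true  e       w ρ = sym (identityˡ _)
  prepend-correct false e       w ρ = sym (trans (∙-congʳ ε⁻¹≈ε) (identityˡ _))
  prepend-correct true  (s ⊙ t) w ρ = begin
    ⟦ prepend true s (prepend true t w) ⟧ᶠ ρ     ≈⟨ prepend-correct true s _ ρ ⟩
    ⟦ s ⟧ₑ ρ ∙ ⟦ prepend true t w ⟧ᶠ ρ           ≈⟨ ∙-congˡ (prepend-correct true t w ρ) ⟩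
    ⟦ s ⟧ₑ ρ ∙ (⟦ t ⟧ₑ ρ ∙ ⟦ w ⟧ᶠ ρ)             ≈⟨ assoc _ _ _ ⟨
    ⟦ s ⟧ₑ ρ ∙ ⟦ t ⟧ₑ ρ ∙ ⟦ w ⟧ᶠ ρ               ∎
  prepend-correct false (s ⊙ t) w ρ = begin
    ⟦ prepend false t (prepend false s w) ⟧ᶠ ρ   ≈⟨ prepend-correct false t _ ρ ⟩
    ⟦ t ⟧ₑ ρ ⁻¹ ∙ ⟦ prepend false s w ⟧ᶠ ρ       ≈⟨ ∙-congˡ (prepend-correct false s w ρ) ⟩
    ⟦ t ⟧ₑ ρ ⁻¹ ∙ (⟦ s ⟧ₑ ρ ⁻¹ ∙ ⟦ w ⟧ᶠ ρ)       ≈⟨ assoc _ _ _ ⟨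
    ⟦ t ⟧ₑ ρ ⁻¹ ∙ ⟦ s ⟧ₑ ρ ⁻¹ ∙ ⟦ w ⟧ᶠ ρ         ≈⟨ ∙-congʳ (⁻¹-anti-homo-∙ _ _) ⟨
    (⟦ s ⟧ₑ ρ ∙ ⟦ t ⟧ₑ ρ) ⁻¹ ∙ ⟦ w ⟧ᶠ ρ          ∎
  prepend-correct true  (s ⁻)   w ρ = prepend-correct false s w ρ
  prepend-correct false (s ⁻)   w ρ =
    trans (prepend-correct true s w ρ) (∙-congʳ (sym (⁻¹-involutive _)))

  ⟦_⇓⟧ : ∀ {n} → Expr n → Env n → Carrier
  ⟦ s ⇓⟧ = ⟦ prepend true s [] ⟧ᶠ

  correct : ∀ {n} (s : Expr n) ρ → ⟦ s ⇓⟧ ρ ≈ ⟦ s ⟧ₑ ρ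
  correct s ρ = trans (prepend-correct true s [] ρ) (identityʳ _)

  open Reflection setoid var ⟦_⟧ₑ ⟦_⇓⟧ correct public using (solve; _⊜_)

-- Finite sums

allVecs : ∀ {a} {A : Set a} → List A → ∀ m → List (Vec A m)
allVecs xs zero    = [] ∷ []
allVecs xs (suc m) = List.cartesianProductWith _∷_ xs (allVecs xs m)

module FiniteSums {c ℓ} (R : CommutativeSemiring c ℓ) where
  open CommutativeSemiring R hiding (zero)
  open Algebra.Definitions.RawMonoid +-rawMonoid using () renaming (_×_ to _·_) public
  open Algebra.Properties.CommutativeSemigroup +-commutativeSemigroup
    using () renaming (interchange to +-interchange)
  open Relation.Binary.Reasoning.Setoid setoid

  ⨁ : ∀ {a} {A : Set a} → List A → (A → Carrier) → Carrier
  ⨁ xs f = List.foldr _+_ 0# (List.map f xs)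

  module _ {a} {A : Set a} where

    ⨁-cong : ∀ (xs : List A) {f g : A → Carrier} → (∀ x → f x ≈ g x) → ⨁ xs f ≈ ⨁ xs g
    ⨁-cong []       f≈g = refl
    ⨁-cong (x ∷ xs) f≈g = +-cong (f≈g x) (⨁-cong xs f≈g)

    ⨁-zero : ∀ (xs : List A) → ⨁ xs (λ _ → 0#) ≈ 0#
    ⨁-zero []       = refl
    ⨁-zero (x ∷ xs) = trans (+-identityˡ _) (⨁-zero xs)

    ⨁-+ : ∀ (xs : List A) (f g : A → Carrier) → ⨁ xs (λ x → f x + g x) ≈ ⨁ xs f + ⨁ xs g
    ⨁-+ []       f g = sym (+-identityˡ 0#)
    ⨁-+ (x ∷ xs) f g = trans (+-congˡ (⨁-+ xs f g)) (+-interchange (f x) (g x) _ _)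

    *-⨁ : ∀ y (xs : List A) (f : A → Carrier) → y * ⨁ xs f ≈ ⨁ xs (λ x → y * f x)
    *-⨁ y []       f = zeroʳ y
    *-⨁ y (x ∷ xs) f = trans (distribˡ y _ _) (+-congˡ (*-⨁ y xs f))

    ⨁-* : ∀ (xs : List A) (f : A → Carrier) y → ⨁ xs f * y ≈ ⨁ xs (λ x → f x * y)
    ⨁-* xs f y = trans (*-comm _ y) (trans (*-⨁ y xs f) (⨁-cong xs (λ x → *-comm y (f x))))

    ⨁-++ : ∀ (xs ys : List A) (f : A → Carrier) → ⨁ (xs ++ ys) f ≈ ⨁ xs f + ⨁ ys f
    ⨁-++ []       ys f = sym (+-identityˡ _)
    ⨁-++ (x ∷ xs) ys f = trans (+-congˡ (⨁-++ xs ys f)) (sym (+-assoc _ _ _))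

    ⨁-const : ∀ (xs : List A) y → ⨁ xs (λ _ → y) ≈ length xs · y
    ⨁-const []       y = refl
    ⨁-const (x ∷ xs) y = +-congˡ (⨁-const xs y)

  ⨁-map : ∀ {a b} {A : Set a} {B : Set b} (h : A → B) xs (f : B → Carrier) →
          ⨁ (List.map h xs) f ≡ ⨁ xs (f ∘ h)
  ⨁-map h xs f = ≡.cong (List.foldr _+_ 0#) (≡.sym (List.map-∘ xs))

  ⨁-comm : ∀ {a b} {A : Set a} {B : Set b} xs ys (f : A → B → Carrier) →
           ⨁ xs (λ x → ⨁ ys (f x)) ≈ ⨁ ys (λ y → ⨁ xs (λ x → f x y))
  ⨁-comm []       ys f = sym (⨁-zero ys)
  ⨁-comm (x ∷ xs) ys f = trans (+-congˡ (⨁-comm xs ys f)) (sym (⨁-+ ys (f x) _))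

  𝟙 : ∀ {p} {P : Set p} → Dec P → Carrier
  𝟙 P? = if does P? then 1# else 0#

  𝟙-⇔ : ∀ {p q} {P : Set p} {Q : Set q} (P? : Dec P) (Q? : Dec Q) →
        (P → Q) → (Q → P) → 𝟙 P? ≈ 𝟙 Q?
  𝟙-⇔ P? Q? f g = reflexive (≡.cong (if_then 1# else 0#) (does-⇔ (mk⇔ f g) P? Q?))

  𝟙-× : ∀ {p q} {P : Set p} {Q : Set q} (P? : Dec P) (Q? : Dec Q) →
        𝟙 (P? ×-dec Q?) ≈ 𝟙 P? * 𝟙 Q?
  𝟙-× P? Q? with does P?
  ... | true  = sym (*-identityˡ _)
  ... | false = sym (zeroˡ _)

  𝟙-congˡ : ∀ {p} {P : Set p} (P? : Dec P) {x y} → (P → x ≈ y) → 𝟙 P? * x ≈ 𝟙 P? * y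
  𝟙-congˡ (yes p) x≈y = *-congˡ (x≈y p)
  𝟙-congˡ (no _)  _   = trans (zeroˡ _) (sym (zeroˡ _))

  ⨁-filter : ∀ {a p} {A : Set a} {P : Pred A p} (P? : Decidable P) xs (f : A → Carrier) →
             ⨁ (List.filter P? xs) f ≈ ⨁ xs (λ x → 𝟙 (P? x) * f x)
  ⨁-filter P? []       f = refl
  ⨁-filter P? (x ∷ xs) f with does (P? x)
  ... | true  = +-cong (sym (*-identityˡ (f x))) (⨁-filter P? xs f)
  ... | false = trans (⨁-filter P? xs f) (sym (trans (+-congʳ (zeroˡ (f x))) (+-identityˡ _)))

  -- The list has the shape of `cones`. Since `g` does not depend on the proof of `P x`, it makes
  -- sense for every `x`, and the proof can be traded for the factor `𝟙 (P? x)`.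
  ⨁-mapMaybe : ∀ {a b p} {A : Set a} {B : Set b} {P : Pred A p} (P? : Decidable P)
               (h : ∀ x → P x → B) (xs : List A) (f : B → Carrier) (g : A → Carrier) →
               (∀ x p → f (h x p) ≈ g x) →
               ⨁ (List.mapMaybe (λ x → Maybe.map (h x) (dec⇒maybe (P? x))) xs) f
               ≈ ⨁ xs (λ x → 𝟙 (P? x) * g x)
  ⨁-mapMaybe P? h []       f g f≈g = refl
  ⨁-mapMaybe P? h (x ∷ xs) f g f≈g with P? x
  ... | yes p = +-cong (trans (f≈g x p) (sym (*-identityˡ _))) (⨁-mapMaybe P? h xs f g f≈g)
  ... | no _  = trans (⨁-mapMaybe P? h xs f g f≈g)
                      (sym (trans (+-congʳ (zeroˡ (g x))) (+-identityˡ _)))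

  ⨁-allFin-suc : ∀ n (f : Fin (suc n) → Carrier) →
                 ⨁ (List.allFin (suc n)) f ≡ f zero + ⨁ (List.allFin n) (f ∘ suc)
  ⨁-allFin-suc n f = ≡.cong (λ x → f zero + x) (≡.trans
    (≡.cong (λ xs → ⨁ xs f) (≡.sym (List.map-tabulate id suc)))
    (⨁-map suc (List.allFin n) f))

  ⨁-δ : ∀ {n} (y : Fin n) (f : Fin n → Carrier) →
        ⨁ (List.allFin n) (λ x → 𝟙 (x Fin.≟ y) * f x) ≈ f y
  ⨁-δ {suc n} zero f = begin
    ⨁ (List.allFin (suc n)) (λ x → 𝟙 (x Fin.≟ zero) * f x)
      ≡⟨ ⨁-allFin-suc n _ ⟩
    1# * f zero + ⨁ (List.allFin n) (λ x → 0# * f (suc x))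
      ≈⟨ +-cong (*-identityˡ _)
           (trans (⨁-cong (List.allFin n) (λ x → zeroˡ (f (suc x)))) (⨁-zero (List.allFin n))) ⟩
    f zero + 0#
      ≈⟨ +-identityʳ _ ⟩
    f zero ∎
  ⨁-δ {suc n} (suc y) f = begin
    ⨁ (List.allFin (suc n)) (λ x → 𝟙 (x Fin.≟ suc y) * f x)
      ≡⟨ ⨁-allFin-suc n _ ⟩
    0# * f zero + ⨁ (List.allFin n) (λ x → 𝟙 (suc x Fin.≟ suc y) * f (suc x))
      ≈⟨ +-cong (zeroˡ _) (⨁-cong (List.allFin n) λ x → *-congʳ
           (𝟙-⇔ (suc x Fin.≟ suc y) (x Fin.≟ y) Fin.suc-injective (≡.cong suc))) ⟩
    0# + ⨁ (List.allFin n) (λ x → 𝟙 (x Fin.≟ y) * f (suc x))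
      ≈⟨ trans (+-identityˡ _) (⨁-δ y (f ∘ suc)) ⟩
    f (suc y) ∎

  ⨁-∣∣ : ∀ {n} (σ : Subset n) → ⨁ (List.allFin n) (λ v → 𝟙 (v Sub.∈? σ)) ≈ ∣ σ ∣ · 1#
  ⨁-∣∣ [] = refl
  ⨁-∣∣ {suc n} (outside ∷ σ) = begin
    ⨁ (List.allFin (suc n)) (λ v → 𝟙 (v Sub.∈? (outside ∷ σ)))
      ≡⟨ ⨁-allFin-suc n _ ⟩
    0# + ⨁ (List.allFin n) (λ v → 𝟙 (v Sub.∈? σ))
      ≈⟨ trans (+-identityˡ _) (⨁-∣∣ σ) ⟩
    ∣ σ ∣ · 1# ∎
  ⨁-∣∣ {suc n} (inside ∷ σ) = begin
    ⨁ (List.allFin (suc n)) (λ v → 𝟙 (v Sub.∈? (inside ∷ σ)))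
      ≡⟨ ⨁-allFin-suc n _ ⟩
    1# + ⨁ (List.allFin n) (λ v → 𝟙 (v Sub.∈? σ))
      ≈⟨ +-congˡ (⨁-∣∣ σ) ⟩
    1# + ∣ σ ∣ · 1# ∎

  -- Each `f (col v)` is expanded as a sum over all colours; once the sums are exchanged, a colour
  -- `t` meets exactly one `v`, its preimage in `P`.
  ⨁-bijection : ∀ {k m p} {P : Pred (Fin k) p} (P? : Decidable P) (col : Fin k → Fin m) →
                (∀ t → ∃ λ v → P v × col v ≡ t) →
                (∀ {v v′} → P v → P v′ → col v ≡ col v′ → v ≡ v′) → ∀ f →
                ⨁ (List.allFin k) (λ v → 𝟙 (P? v) * f (col v)) ≈ ⨁ (List.allFin m) f
  ⨁-bijection {k} {m} P? col onto injective f = begin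
    ⨁ vs (λ v → 𝟙 (P? v) * f (col v))
      ≈⟨ ⨁-cong vs (λ v → *-congˡ (⨁-δ (col v) f)) ⟨
    ⨁ vs (λ v → 𝟙 (P? v) * ⨁ ts (λ t → 𝟙 (t Fin.≟ col v) * f t))
      ≈⟨ ⨁-cong vs (λ v → *-⨁ (𝟙 (P? v)) ts _) ⟩
    ⨁ vs (λ v → ⨁ ts (λ t → 𝟙 (P? v) * (𝟙 (t Fin.≟ col v) * f t)))
      ≈⟨ ⨁-comm vs ts _ ⟩
    ⨁ ts (λ t → ⨁ vs (λ v → 𝟙 (P? v) * (𝟙 (t Fin.≟ col v) * f t)))
      ≈⟨ ⨁-cong ts (λ t → ⨁-cong vs (λ v → single t v)) ⟩
    ⨁ ts (λ t → ⨁ vs (λ v → 𝟙 (v Fin.≟ proj₁ (onto t)) * f t))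
      ≈⟨ ⨁-cong ts (λ t → ⨁-δ (proj₁ (onto t)) (λ _ → f t)) ⟩
    ⨁ ts f ∎
    where
    vs = List.allFin k
    ts = List.allFin m
    single : ∀ t v → 𝟙 (P? v) * (𝟙 (t Fin.≟ col v) * f t) ≈ 𝟙 (v Fin.≟ proj₁ (onto t)) * f t
    single t v with onto t
    ... | u , Pu , ≡.refl = begin
      𝟙 (P? v) * (𝟙 (col u Fin.≟ col v) * f (col u))   ≈⟨ *-assoc _ _ _ ⟨
      𝟙 (P? v) * 𝟙 (col u Fin.≟ col v) * f (col u)     ≈⟨ *-congʳ (𝟙-× (P? v) (col u Fin.≟ col v)) ⟨
      𝟙 (P? v ×-dec (col u Fin.≟ col v)) * f (col u)
        ≈⟨ *-congʳ (𝟙-⇔ (P? v ×-dec (col u Fin.≟ col v)) (v Fin.≟ u)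
             (λ (Pv , eq) → injective Pv Pu (≡.sym eq)) (λ { ≡.refl → Pu , ≡.refl })) ⟩
      𝟙 (v Fin.≟ u) * f (col u)                        ∎

  ⨁-allVecs-suc : ∀ {a} {A : Set a} (xs : List A) m f →
                  ⨁ (allVecs xs (suc m)) f ≈ ⨁ xs (λ x → ⨁ (allVecs xs m) (λ v → f (x ∷ v)))
  ⨁-allVecs-suc xs m f = go xs
    where
    go : ∀ ys → ⨁ (List.cartesianProductWith _∷_ ys (allVecs xs m)) f
                ≈ ⨁ ys (λ x → ⨁ (allVecs xs m) (λ v → f (x ∷ v)))
    go []       = refl
    go (y ∷ ys) = trans (⨁-++ (List.map (y ∷_) (allVecs xs m)) _ f)
      (+-cong (reflexive (⨁-map (y ∷_) (allVecs xs m) f)) (go ys))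

  -- A tuple amounts to its entry in position `j` together with the remaining ones. This is what
  -- lets a face of a tuple become a summation variable of its own.
  ⨁-allVecs-removeAt : ∀ {a} {A : Set a} (xs : List A) m (j : Fin (suc m))
      (f : A → Vec A m → Carrier) →
    ⨁ (allVecs xs (suc m)) (λ v → f (Vec.lookup v j) (Vec.removeAt v j))
    ≈ ⨁ xs (λ x → ⨁ (allVecs xs m) (f x))
  ⨁-allVecs-removeAt xs m zero f = ⨁-allVecs-suc xs m _
  ⨁-allVecs-removeAt xs (suc m) (suc j) f = begin
    ⨁ (allVecs xs (suc (suc m))) (λ v → f (Vec.lookup v (suc j)) (Vec.removeAt v (suc j)))
      ≈⟨ ⨁-allVecs-suc xs (suc m) _ ⟩
    ⨁ xs (λ y → ⨁ (allVecs xs (suc m)) (λ v → f (Vec.lookup v j) (Vec.removeAt (y ∷ v) (suc j))))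
      -- `Vec.removeAt (y ∷ v) (suc j)` computes only when `v` is visibly a cons.
      ≈⟨ ⨁-cong xs (λ y → ⨁-cong (allVecs xs (suc m)) (λ { (_ ∷ _) → refl })) ⟩
    ⨁ xs (λ y → ⨁ (allVecs xs (suc m)) (λ v → f (Vec.lookup v j) (y ∷ Vec.removeAt v j)))
      ≈⟨ ⨁-cong xs (λ y → ⨁-allVecs-removeAt xs m j (λ x v → f x (y ∷ v))) ⟩
    ⨁ xs (λ y → ⨁ xs (λ x → ⨁ (allVecs xs m) (λ v → f x (y ∷ v))))
      ≈⟨ ⨁-comm xs xs _ ⟩
    ⨁ xs (λ x → ⨁ xs (λ y → ⨁ (allVecs xs m) (λ v → f x (y ∷ v))))
      ≈⟨ ⨁-cong xs (λ x → ⨁-allVecs-suc xs m (f x)) ⟨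
    ⨁ xs (λ x → ⨁ (allVecs xs (suc m)) (f x)) ∎

-- Cochains on a simplex

parity : ∀ {m} → Fin m → Parity
parity zero    = 0ℙ
parity (suc j) = parity j ℙ.+ 1ℙ

module _ {a} {A : Set a} where

  ~-sym : ∀ {m p} {xs ys : Vec A m} → xs ~[ p ] ys → ys ~[ p ] xs
  ~-sym ~refl        = ~refl
  ~-sym (~swap x y)  = ~swap y x
  ~-sym (~prep x r)  = ~prep x (~-sym r)
  ~-sym (~trans {p = p} {q} r s) = ≡.subst (_ ~[_] _) (ℙ.+-comm q p) (~trans (~-sym s) (~-sym r))

  All-~ : ∀ {q} {P : Pred A q} {m p} {xs ys : Vec A m} → xs ~[ p ] ys →
         VecAll.All P xs → VecAll.All P ys
  All-~ ~refl        pxs             = pxs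
  All-~ (~swap x y)  (px ∷ py ∷ pxs) = py ∷ px ∷ pxs
  All-~ (~prep x r)  (px ∷ pxs)      = px ∷ All-~ r pxs
  All-~ (~trans r s) pxs             = All-~ s (All-~ r pxs)

  Unique-~ : ∀ {m p} {xs ys : Vec A m} → xs ~[ p ] ys → Unique xs → Unique ys
  Unique-~ ~refl        xs!                              = xs!
  Unique-~ (~swap x y)  ((x≢y ∷ x∉) ∷ y∉ ∷ xs!)          = ((x≢y ∘ ≡.sym) ∷ y∉) ∷ x∉ ∷ xs!
  Unique-~ (~prep x r)  (x∉ ∷ xs!)                       = All-~ r x∉ ∷ Unique-~ r xs!
  Unique-~ (~trans r s) xs!                              = Unique-~ s (Unique-~ r xs!)

  move-to-front : ∀ {m} (xs : Vec A (suc m)) j →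
                  xs ~[ parity j ] Vec.lookup xs j ∷ Vec.removeAt xs j
  move-to-front (x ∷ xs)         zero    = ~refl
  move-to-front (x ∷ xs@(_ ∷ _)) (suc j) =
    ~trans (~prep x (move-to-front xs j)) (~swap x (Vec.lookup xs j))

module _ {k : ℕ} where

  ⟦⟧-~ : ∀ {m p} {xs ys : Vec (Fin k) m} → xs ~[ p ] ys → ⟦ xs ⟧ ≡ ⟦ ys ⟧
  ⟦⟧-~ ~refl = ≡.refl
  ⟦⟧-~ (~swap x y {xs}) = ≡.trans (≡.sym (Sub.∪-assoc ⁅ x ⁆ ⁅ y ⁆ ⟦ xs ⟧))
    (≡.trans (≡.cong (_∪ ⟦ xs ⟧) (Sub.∪-comm ⁅ x ⁆ ⁅ y ⁆)) (Sub.∪-assoc ⁅ y ⁆ ⁅ x ⁆ ⟦ xs ⟧))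
  ⟦⟧-~ (~prep x r) = ≡.cong (⁅ x ⁆ ∪_) (⟦⟧-~ r)
  ⟦⟧-~ (~trans r s) = ≡.trans (⟦⟧-~ r) (⟦⟧-~ s)

  lookup∈⟦⟧ : ∀ {m} (xs : Vec (Fin k) m) j → Vec.lookup xs j ∈ ⟦ xs ⟧
  lookup∈⟦⟧ (x ∷ xs) zero    = Sub.p⊆p∪q ⟦ xs ⟧ (Sub.x∈⁅x⁆ x)
  lookup∈⟦⟧ (x ∷ xs) (suc j) = Sub.q⊆p∪q ⁅ x ⁆ ⟦ xs ⟧ (lookup∈⟦⟧ xs j)

  ∈⟦⟧⇒lookup : ∀ {m v} (xs : Vec (Fin k) m) → v ∈ ⟦ xs ⟧ → ∃ λ j → v ≡ Vec.lookup xs j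
  ∈⟦⟧⇒lookup []       v∈ = contradiction v∈ Sub.∉⊥
  ∈⟦⟧⇒lookup (x ∷ xs) v∈ with Sub.x∈p∪q⁻ ⁅ x ⁆ ⟦ xs ⟧ v∈
  ... | inj₁ v∈x = zero , Sub.x∈⁅y⁆⇒x≡y x v∈x
  ... | inj₂ v∈xs with ∈⟦⟧⇒lookup xs v∈xs
  ...   | j , v≡ = suc j , v≡

  ⟦⟧⊆⁺ : ∀ {m σ} (xs : Vec (Fin k) m) → (∀ j → Vec.lookup xs j ∈ σ) → ⟦ xs ⟧ ⊆ σ
  ⟦⟧⊆⁺ {σ = σ} xs h v∈ with ∈⟦⟧⇒lookup xs v∈
  ... | j , v≡ = ≡.subst (_∈ σ) (≡.sym v≡) (h j)

  ⟦∷⟧⊆⁺ : ∀ {m σ x} (xs : Vec (Fin k) m) → x ∈ σ → ⟦ xs ⟧ ⊆ σ → ⟦ x ∷ xs ⟧ ⊆ σ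
  ⟦∷⟧⊆⁺ xs x∈ xs⊆ = ⟦⟧⊆⁺ (_ ∷ xs) λ { zero → x∈ ; (suc j) → xs⊆ (lookup∈⟦⟧ xs j) }

module _ {a b} {A : Set a} {B : Set b} (h : A → B) where

  map-~ : ∀ {m p} {xs ys : Vec A m} → xs ~[ p ] ys → Vec.map h xs ~[ p ] Vec.map h ys
  map-~ ~refl        = ~refl
  map-~ (~swap x y)  = ~swap (h x) (h y)
  map-~ (~prep x r)  = ~prep (h x) (map-~ r)
  map-~ (~trans r s) = ~trans (map-~ r) (map-~ s)

  Unique-map⁻ : ∀ {m} {xs : Vec A m} → Unique (Vec.map h xs) → Unique xs
  Unique-map⁻ {xs = []}     _          = []
  Unique-map⁻ {xs = x ∷ xs} (x∉ ∷ xs!) =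
    VecAll.map (λ hx≢hy x≡y → hx≢hy (≡.cong h x≡y)) (VecAll.map⁻ x∉) ∷ Unique-map⁻ xs!

module ChamberAlgebra {c ℓ} (R : CommutativeRing c ℓ) where
  open CommutativeRing R hiding (zero)
  open FiniteSums commutativeSemiring
  open Algebra.Properties.Ring ring using (-‿distribˡ-*; -‿distribʳ-*)
  open Algebra.Properties.AbelianGroup +-abelianGroup
    using (⁻¹-involutive; ε⁻¹≈ε; xyx⁻¹≈y) renaming (⁻¹-∙-comm to -‿+-comm)
  open Algebra.Properties.CommutativeSemigroup *-commutativeSemigroup
    using () renaming (x∙yz≈y∙xz to *-left-comm)
  open Relation.Binary.Reasoning.Setoid setoid

  sgn : ℕ → Carrier
  sgn zero    = 1#
  sgn (suc j) = - sgn j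

  sgnᵖ : Parity → Carrier
  sgnᵖ 0ℙ = 1#
  sgnᵖ 1ℙ = - 1#

  sgnᵖ-suc : ∀ p → sgnᵖ (p ℙ.+ 1ℙ) ≈ - sgnᵖ p
  sgnᵖ-suc 0ℙ = refl
  sgnᵖ-suc 1ℙ = sym (⁻¹-involutive 1#)

  sgnᵖ-parity : ∀ {m} (j : Fin m) → sgnᵖ (parity j) ≈ sgn (toℕ j)
  sgnᵖ-parity zero    = refl
  sgnᵖ-parity (suc j) = trans (sgnᵖ-suc (parity j)) (-‿cong (sgnᵖ-parity j))

  sgn*sgn : ∀ j → sgn j * sgn j ≈ 1#
  sgn*sgn zero    = *-identityˡ 1#
  sgn*sgn (suc j) = begin
    - sgn j * - sgn j       ≈⟨ -‿distribˡ-* _ _ ⟨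
    - (sgn j * - sgn j)     ≈⟨ -‿cong (-‿distribʳ-* _ _) ⟨
    - - (sgn j * sgn j)     ≈⟨ ⁻¹-involutive _ ⟩
    sgn j * sgn j           ≈⟨ sgn*sgn j ⟩
    1#                      ∎

  sgn-cancel : ∀ j x → sgn j * (sgn j * x) ≈ x
  sgn-cancel j x = trans (sym (*-assoc _ _ _)) (trans (*-congʳ (sgn*sgn j)) (*-identityˡ x))

  ⨁-neg : ∀ {a} {A : Set a} (xs : List A) f → ⨁ xs (λ x → - f x) ≈ - ⨁ xs f
  ⨁-neg []       f = sym ε⁻¹≈ε
  ⨁-neg (x ∷ xs) f = trans (+-congˡ (⨁-neg xs f)) (-‿+-comm (f x) _)

  -- Cochains as functions of all tuples of vertices, 0 on the tuples that are
  -- not ordered simplices.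
  module _ {k i : ℕ} (F : Vec (Fin k) (suc i) → Carrier)
           (alternating : ∀ {p a b} → a ~[ p ] b → F b ≈ sgnᵖ p * F a)
           (repetition  : ∀ {a} → ¬ Unique a → F a ≈ 0#) where

    private
      V = List.allFin k
      J = List.allFin (suc i)

    coboundary : Vec (Fin k) (suc (suc i)) → Carrier
    coboundary a = ⨁ (List.allFin (suc (suc i))) (λ j → sgn (toℕ j) * F (Vec.removeAt a j))

    -- The codifferential of F restricted to the simplex σ.
    div : Subset k → Vec (Fin k) i → Carrier
    div σ b = ⨁ V (λ v → 𝟙 (v Sub.∈? σ) * F (v ∷ b))

    -- For `i = 0` the faces are the empty tuple, on which `div` is the sum over the vertices of
    -- `σ`. So the complex is augmented, as δd + dδ = |σ| requires in degree 0.
    d-div : Subset k → Vec (Fin k) (suc i) → Carrier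
    d-div σ a = ⨁ J (λ j → sgn (toℕ j) * div σ (Vec.removeAt a j))

    to-front : ∀ a j → F (Vec.lookup a j ∷ Vec.removeAt a j) ≈ sgn (toℕ j) * F a
    to-front a j = trans (alternating (move-to-front a j)) (*-congʳ (sgnᵖ-parity j))

    coboundary-∷ : ∀ v a → coboundary (v ∷ a) ≈
                   F a + - ⨁ J (λ j → sgn (toℕ j) * F (v ∷ Vec.removeAt a j))
    coboundary-∷ v a@(_ ∷ _) = begin
      coboundary (v ∷ a)
        ≡⟨ ⨁-allFin-suc (suc i) _ ⟩
      1# * F a + ⨁ J (λ j → - sgn (toℕ j) * F (v ∷ Vec.removeAt a j))
        ≈⟨ +-cong (*-identityˡ _) (⨁-cong J λ j → sym (-‿distribˡ-* _ _)) ⟩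
      F a + ⨁ J (λ j → - (sgn (toℕ j) * F (v ∷ Vec.removeAt a j)))
        ≈⟨ +-congˡ (⨁-neg J _) ⟩
      F a + - ⨁ J (λ j → sgn (toℕ j) * F (v ∷ Vec.removeAt a j)) ∎

    -- Only two faces of `v ∷ a` have distinct entries, namely those that drop one of the two copies
    -- of `v`. Both carry `F a` up to sign, and the signs cancel.
    coboundary-degenerate : ∀ {v a} → Unique a → v ∈ ⟦ a ⟧ → coboundary (v ∷ a) ≈ 0#
    coboundary-degenerate {v} {a} a! v∈ with ∈⟦⟧⇒lookup a v∈
    ... | l , ≡.refl = begin
      coboundary (u ∷ a)
        ≈⟨ coboundary-∷ u a ⟩
      F a + - ⨁ J (λ j → sgn (toℕ j) * F (u ∷ Vec.removeAt a j))
        ≈⟨ +-congˡ (-‿cong (⨁-cong J term)) ⟩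
      F a + - ⨁ J (λ j → 𝟙 (j Fin.≟ l) * F a)
        ≈⟨ +-congˡ (-‿cong (⨁-δ l (λ _ → F a))) ⟩
      F a + - F a
        ≈⟨ -‿inverseʳ (F a) ⟩
      0# ∎
      where
      u = Vec.lookup a l
      term : ∀ j → sgn (toℕ j) * F (u ∷ Vec.removeAt a j) ≈ 𝟙 (j Fin.≟ l) * F a
      term j with j Fin.≟ l
      ... | yes ≡.refl = trans (*-congˡ (to-front a j))
          (trans (sgn-cancel (toℕ j) (F a)) (sym (*-identityˡ _)))
      ... | no j≢l = trans (*-congˡ (repetition λ { (u∉ ∷ _) →
            VecAll.lookup⁺ u∉ (Fin.punchOut j≢l) (≡.sym (Vec.removeAt-punchOut a j≢l)) }))
          (trans (zeroʳ _) (sym (zeroˡ _)))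

    ⨁-cones : ∀ σ {a} → Unique a →
      ⨁ V (λ v → 𝟙 (v Sub.∈? σ) * (𝟙 (¬? (v Sub.∈? ⟦ a ⟧)) * coboundary (v ∷ a)))
      ≈ (∣ σ ∣ · 1#) * F a + - d-div σ a
    ⨁-cones σ {a} a! = begin
      ⨁ V (λ v → 𝟙 (v Sub.∈? σ) * (𝟙 (¬? (v Sub.∈? ⟦ a ⟧)) * coboundary (v ∷ a)))
        ≈⟨ ⨁-cong V (λ v → *-congˡ (drop-𝟙 v)) ⟩
      ⨁ V (λ v → 𝟙 (v Sub.∈? σ) * coboundary (v ∷ a))
        ≈⟨ ⨁-cong V (λ v → trans (*-congˡ (coboundary-∷ v a)) (trans (distribˡ _ _ _)
             (+-congˡ (sym (-‿distribʳ-* _ _))))) ⟩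
      ⨁ V (λ v → 𝟙 (v Sub.∈? σ) * F a +
                 - (𝟙 (v Sub.∈? σ) * ⨁ J (λ j → sgn (toℕ j) * F (v ∷ Vec.removeAt a j))))
        ≈⟨ trans (⨁-+ V _ _) (+-cong (sym (⨁-* V _ (F a))) (⨁-neg V _)) ⟩
      ⨁ V (λ v → 𝟙 (v Sub.∈? σ)) * F a +
        - ⨁ V (λ v → 𝟙 (v Sub.∈? σ) * ⨁ J (λ j → sgn (toℕ j) * F (v ∷ Vec.removeAt a j)))
        ≈⟨ +-cong (*-congʳ (⨁-∣∣ σ)) (-‿cong (⨁-cong V λ v → trans (*-⨁ _ J _)
             (⨁-cong J λ j → *-left-comm _ _ _))) ⟩
      (∣ σ ∣ · 1#) * F a +
        - ⨁ V (λ v → ⨁ J (λ j → sgn (toℕ j) * (𝟙 (v Sub.∈? σ) * F (v ∷ Vec.removeAt a j))))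
        ≈⟨ +-congˡ (-‿cong (trans (⨁-comm V J _) (⨁-cong J λ j → sym (*-⨁ _ V _)))) ⟩
      (∣ σ ∣ · 1#) * F a + - d-div σ a ∎
      where
      drop-𝟙 : ∀ v → 𝟙 (¬? (v Sub.∈? ⟦ a ⟧)) * coboundary (v ∷ a) ≈ coboundary (v ∷ a)
      drop-𝟙 v with v Sub.∈? ⟦ a ⟧
      ... | yes v∈ = trans (zeroˡ _) (sym (coboundary-degenerate a! v∈))
      ... | no _   = *-identityˡ _

    -- Adjointness of d and δ inside `σ`. For fixed `j`, moving entry `j` to the front absorbs the
    -- sign and splits the tuple into a vertex and a face, both free in `σ`. Every `j` contributes
    -- the same amount, which leaves the constant sum over `J`.
    ⨁-d-div : ∀ σ → ⨁ (allVecs V (suc i)) (λ a → 𝟙 (⟦ a ⟧ Sub.⊆? σ) * (F a * d-div σ a))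
              ≈ ⨁ J (λ _ → ⨁ (allVecs V i) (λ b → 𝟙 (⟦ b ⟧ Sub.⊆? σ) * (div σ b * div σ b)))
    ⨁-d-div σ = begin
      ⨁ (allVecs V (suc i)) (λ a → 𝟙 (⟦ a ⟧ Sub.⊆? σ) * (F a * d-div σ a))
        ≈⟨ ⨁-cong (allVecs V (suc i)) (λ a → trans (*-congˡ (*-⨁ (F a) J _)) (*-⨁ _ J _)) ⟩
      ⨁ (allVecs V (suc i)) (λ a → ⨁ J (λ j →
        𝟙 (⟦ a ⟧ Sub.⊆? σ) * (F a * (sgn (toℕ j) * div σ (Vec.removeAt a j)))))
        ≈⟨ ⨁-comm (allVecs V (suc i)) J _ ⟩
      ⨁ J (λ j → ⨁ (allVecs V (suc i)) (λ a →
        𝟙 (⟦ a ⟧ Sub.⊆? σ) * (F a * (sgn (toℕ j) * div σ (Vec.removeAt a j)))))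
        ≈⟨ ⨁-cong J (λ j → ⨁-cong (allVecs V (suc i)) (λ a → split j a)) ⟩
      ⨁ J (λ j → ⨁ (allVecs V (suc i)) (λ a → term (Vec.lookup a j) (Vec.removeAt a j)))
        ≈⟨ ⨁-cong J (λ j → ⨁-allVecs-removeAt V i j term) ⟩
      ⨁ J (λ _ → ⨁ V (λ v → ⨁ (allVecs V i) (term v)))
        ≈⟨ ⨁-cong J (λ _ → trans (⨁-comm V (allVecs V i) _) (⨁-cong (allVecs V i) collect)) ⟩
      ⨁ J (λ _ → ⨁ (allVecs V i) (λ b → 𝟙 (⟦ b ⟧ Sub.⊆? σ) * (div σ b * div σ b))) ∎
      where
      term : Fin k → Vec (Fin k) i → Carrier
      term v b = 𝟙 (⟦ b ⟧ Sub.⊆? σ) * ((𝟙 (v Sub.∈? σ) * F (v ∷ b)) * div σ b)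

      split : ∀ j a → 𝟙 (⟦ a ⟧ Sub.⊆? σ) * (F a * (sgn (toℕ j) * div σ (Vec.removeAt a j)))
              ≈ term (Vec.lookup a j) (Vec.removeAt a j)
      split j a = begin
        𝟙 (⟦ a ⟧ Sub.⊆? σ) * (F a * (sgn (toℕ j) * D))
          ≈⟨ *-cong
               (trans (𝟙-⇔ (⟦ a ⟧ Sub.⊆? σ) ((⟦ b ⟧ Sub.⊆? σ) ×-dec (u Sub.∈? σ)) to from)
                      (𝟙-× (⟦ b ⟧ Sub.⊆? σ) (u Sub.∈? σ)))
               (trans (*-left-comm _ _ _)
                 (trans (sym (*-assoc _ _ _)) (*-congʳ (sym (to-front a j))))) ⟩
        𝟙 (⟦ b ⟧ Sub.⊆? σ) * 𝟙 (u Sub.∈? σ) * (F (u ∷ b) * D)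
          ≈⟨ trans (*-assoc _ _ _) (*-congˡ (sym (*-assoc _ _ _))) ⟩
        term u b ∎
        where
        u = Vec.lookup a j
        b = Vec.removeAt a j
        D = div σ b
        a≡ : ⟦ a ⟧ ≡ ⟦ u ∷ b ⟧
        a≡ = ⟦⟧-~ (move-to-front a j)
        to : ⟦ a ⟧ ⊆ σ → ⟦ b ⟧ ⊆ σ × u ∈ σ
        to a⊆ = (λ {x} x∈ → a⊆ (⟦removeAt⟧⊆ a j x∈)) , a⊆ (lookup∈⟦⟧ a j)
        from : ⟦ b ⟧ ⊆ σ × u ∈ σ → ⟦ a ⟧ ⊆ σ
        from (b⊆ , u∈) {x} x∈ = ⟦∷⟧⊆⁺ b u∈ b⊆ (≡.subst (x ∈_) a≡ x∈)

      collect : ∀ b → ⨁ V (λ v → term v b) ≈ 𝟙 (⟦ b ⟧ Sub.⊆? σ) * (div σ b * div σ b)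
      collect b = trans (sym (*-⨁ _ V _)) (*-congˡ (sym (⨁-* V _ (div σ b))))

  -- The letters stand for a weight, an eigenvalue, the number of vertices of a chamber, a value of
  -- the cochain and its accumulated `dδ` term. Multiplying by `x` turns the equation into one about
  -- squares.
  rearrange-eigen : ∀ {w v N x d} → w * (v * x) + d ≈ w * (N * x) →
                    (N + - v) * (w * (x * x)) ≈ x * d
  rearrange-eigen {w} {v} {N} {x} {d} eq = begin
    (N + - v) * (w * (x * x))
      ≈⟨ trans (distribʳ _ _ _)
           (+-cong (move N) (trans (sym (-‿distribˡ-* _ _)) (-‿cong (move v)))) ⟩
    x * (w * (N * x)) + - (x * (w * (v * x)))
      ≈⟨ trans (+-congˡ (-‿distribʳ-* _ _)) (sym (distribˡ _ _ _)) ⟩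
    x * (w * (N * x) + - (w * (v * x)))
      ≈⟨ *-congˡ (trans (+-congʳ (sym eq)) (xyx⁻¹≈y _ d)) ⟩
    x * d ∎
    where
    move : ∀ a → a * (w * (x * x)) ≈ x * (w * (a * x))
    move a = trans (*-congˡ (*-left-comm w x x)) (trans (*-left-comm a x _)
        (*-congˡ (*-left-comm a w x)))

-- Tits systems

least : ∀ {p} {P : Pred ℕ p} → Decidable P → ∀ n → P n → ∃ λ m → P m × (∀ k → P k → m ≤ k)
least {P = P} P? = <-rec _ λ n rec Pn → case-below n rec Pn (ℕ.anyUpTo? P? n)
  where
  case-below : ∀ n → (∀ {m} → m < n → P m → ∃ λ m → P m × (∀ k → P k → m ≤ k)) → P n →
               Dec (∃ λ m → m < n × P m) → ∃ λ m → P m × (∀ k → P k → m ≤ k)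
  case-below n rec Pn (yes (m , m<n , Pm)) = rec m<n Pm
  case-below n rec Pn (no none) = n , Pn , λ k Pk → ℕ.≮⇒≥ λ k<n → none (k , k<n , Pk)

module TitsProperties {c r} {G : FiniteGroup c r} {rank : ℕ} (T : TitsSystem G rank) where
  open FiniteGroup G
  open TitsSystem T
  open GroupSolver group using (solve; _⊜_; _⊙_; _⁻; e)

  ≈refl : ∀ {x} → x ≈ x
  ≈refl = Group.refl group

  ≈sym : ∀ {x y} → x ≈ y → y ≈ x
  ≈sym = Group.sym group

  ≈trans : ∀ {x y z} → x ≈ y → y ≈ z → x ≈ z
  ≈trans = Group.trans group

  -- Subgroups as predicates, to cover generated subgroups, which do not come as a `Subset`.
  record Subgroup {a} (H : Pred Carrier a) : Set (c ⊔ r ⊔ a) where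
    field
      closed-≈  : H Respects _≈_
      closed-ε  : H ε
      closed-∙  : ∀ {x y} → H x → H y → H (x ∙ y)
      closed-⁻¹ : ∀ {x} → H x → H (x ⁻¹)

  subset-subgroup : ∀ {H} → IsSubgroup H → Subgroup (_∈ᴳ H)
  subset-subgroup {H} h = record
    { closed-≈ = ∈-resp H ; closed-ε = IsSubgroup.ε∈ h
    ; closed-∙ = IsSubgroup.∙∈ h _ _ ; closed-⁻¹ = IsSubgroup.⁻¹∈ h _ }

  ⟨⟩-subgroup : ∀ {a} (A : Pred Carrier a) → Subgroup ⟨ A ⟩
  ⟨⟩-subgroup A = record { closed-≈ = resp ; closed-ε = ε∈ ; closed-∙ = ∙∈ ; closed-⁻¹ = ⁻¹∈ }

  ⟨⟩-minimal : ∀ {a h} {A : Pred Carrier a} {H : Pred Carrier h} → Subgroup H →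
               (∀ {x} → A x → H x) → ∀ {x} → ⟨ A ⟩ x → H x
  ⟨⟩-minimal H-sub A⊆H = go
    where
    open Subgroup H-sub
    go : ∀ {x} → ⟨ _ ⟩ x → _
    go (gen a)      = A⊆H a
    go ε∈           = closed-ε
    go (∙∈ p q)     = closed-∙ (go p) (go q)
    go (⁻¹∈ p)      = closed-⁻¹ (go p)
    go (resp x≈y p) = closed-≈ x≈y (go p)

  -- The actions of `x` and of `x ⁻¹` are carried together, so that the case of a formal inverse
  -- only exchanges them. `Z` will be a union of double cosets, which need not be closed under
  -- products.
  ⟨⟩-act : ∀ {a z} {A : Pred Carrier a} {Z : Pred Carrier z} → Z Respects _≈_ →
           (∀ {x y} → A x → Z y → Z (x ∙ y) × Z (x ⁻¹ ∙ y)) →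
           ∀ {x y} → ⟨ A ⟩ x → Z y → Z (x ∙ y) × Z (x ⁻¹ ∙ y)
  ⟨⟩-act {Z = Z} Z-resp act = go
    where
    go : ∀ {x y} → ⟨ _ ⟩ x → Z y → Z (x ∙ y) × Z (x ⁻¹ ∙ y)
    go (gen a) z = act a z
    go {y = y} ε∈ z = Z-resp (solve 1 (λ y → y ⊜ e ⊙ y) ≈refl y) z
                    , Z-resp (solve 1 (λ y → y ⊜ e ⁻ ⊙ y) ≈refl y) z
    go {y = y} (∙∈ {u} {v} p q) z =
        Z-resp (solve 3 (λ u v y → u ⊙ (v ⊙ y) ⊜ (u ⊙ v) ⊙ y) ≈refl u v y)
          (proj₁ (go p (proj₁ (go q z))))
      , Z-resp (solve 3 (λ u v y → v ⁻ ⊙ (u ⁻ ⊙ y) ⊜ (u ⊙ v) ⁻ ⊙ y) ≈refl u v y)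
          (proj₂ (go q (proj₂ (go p z))))
    go {y = y} (⁻¹∈ {u} p) z =
        proj₂ (go p z)
      , Z-resp (solve 2 (λ u y → u ⊙ y ⊜ (u ⁻) ⁻ ⊙ y) ≈refl u y) (proj₁ (go p z))
    go (resp x≈x′ p) z = Z-resp (∙-congʳ x≈x′) (proj₁ (go p z))
                       , Z-resp (∙-congʳ (⁻¹-cong x≈x′)) (proj₂ (go p z))

  module 𝐁 = Subgroup (subset-subgroup B-subgroup)
  module 𝐍 = Subgroup (subset-subgroup N-subgroup)

  T⇒B : ∀ {x} → x ∈ᴳ B ∩ N → x ∈ᴳ B
  T⇒B = proj₁ ∘ Sub.x∈p∩q⁻ B N

  B∧N⇒T : ∀ {x} → x ∈ᴳ B → x ∈ᴳ N → x ∈ᴳ B ∩ N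
  B∧N⇒T b n = Sub.x∈p∩q⁺ (b , n)

  T-subgroup : Subgroup (_∈ᴳ B ∩ N)
  T-subgroup = record
    { closed-≈  = ∈-resp (B ∩ N)
    ; closed-ε  = B∧N⇒T 𝐁.closed-ε 𝐍.closed-ε
    ; closed-∙  = λ p q → let (pb , pn) = Sub.x∈p∩q⁻ B N p ; (qb , qn) = Sub.x∈p∩q⁻ B N q
                     in B∧N⇒T (𝐁.closed-∙ pb qb) (𝐍.closed-∙ pn qn)
    ; closed-⁻¹ = λ p → let (pb , pn) = Sub.x∈p∩q⁻ B N p in B∧N⇒T (𝐁.closed-⁻¹ pb) (𝐍.closed-⁻¹ pn)
    }
  module 𝐓 = Subgroup T-subgroup

  ss∈B : ∀ j → s j ∙ s j ∈ᴳ B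
  ss∈B j = T⇒B (s-involutive j)

  s∉B : ∀ j → ¬ (s j ∈ᴳ B)
  s∉B j b = s-nontrivial j (B∧N⇒T b (s∈N j))

  D-refl : ∀ {x} → B⟨ x ⟩B x
  D-refl {x} = ε , ε , 𝐁.closed-ε , 𝐁.closed-ε , solve 1 (λ x → x ⊜ e ⊙ x ⊙ e) ≈refl x

  D-sym : ∀ {x y} → B⟨ x ⟩B y → B⟨ y ⟩B x
  D-sym {x} (b , b′ , b∈ , b′∈ , y≈) = b ⁻¹ , b′ ⁻¹ , 𝐁.closed-⁻¹ b∈ , 𝐁.closed-⁻¹ b′∈ ,
    ≈trans (solve 3 (λ x b b′ → x ⊜ b ⁻ ⊙ (b ⊙ x ⊙ b′) ⊙ b′ ⁻) ≈refl x b b′)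
           (∙-congʳ (∙-congˡ (≈sym y≈)))

  D-trans : ∀ {x y z} → B⟨ x ⟩B y → B⟨ y ⟩B z → B⟨ x ⟩B z
  D-trans {x} (b , b′ , b∈ , b′∈ , y≈) (d , d′ , d∈ , d′∈ , z≈) =
    d ∙ b , b′ ∙ d′ , 𝐁.closed-∙ d∈ b∈ , 𝐁.closed-∙ b′∈ d′∈ ,
    ≈trans z≈ (≈trans (∙-congʳ (∙-congˡ y≈))
      (solve 5 (λ x b b′ d d′ → d ⊙ (b ⊙ x ⊙ b′) ⊙ d′ ⊜ (d ⊙ b) ⊙ x ⊙ (b′ ⊙ d′)) ≈refl x b b′ d d′))

  D-resp : ∀ {x y z} → y ≈ z → B⟨ x ⟩B y → B⟨ x ⟩B z
  D-resp y≈z (b , b′ , b∈ , b′∈ , y≈) = b , b′ , b∈ , b′∈ , ≈trans (≈sym y≈z) y≈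

  D-respˡ : ∀ {x y z} → x ≈ y → B⟨ x ⟩B z → B⟨ y ⟩B z
  D-respˡ x≈y d = D-trans (D-resp (≈sym x≈y) D-refl) d

  D-left : ∀ {x y b} → b ∈ᴳ B → B⟨ x ⟩B y → B⟨ x ⟩B (b ∙ y)
  D-left {y = y} {b} b∈ d = D-trans d
    (b , ε , b∈ , 𝐁.closed-ε , solve 2 (λ b y → b ⊙ y ⊜ b ⊙ y ⊙ e) ≈refl b y)

  D-right : ∀ {x y b} → b ∈ᴳ B → B⟨ x ⟩B y → B⟨ x ⟩B (y ∙ b)
  D-right {y = y} {b} b∈ d = D-trans d
    (ε , b , 𝐁.closed-ε , b∈ , solve 2 (λ b y → y ⊙ b ⊜ e ⊙ y ⊙ b) ≈refl b y)

  D-inv : ∀ {x y} → B⟨ x ⟩B y → B⟨ x ⁻¹ ⟩B (y ⁻¹)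
  D-inv {x} (b , b′ , b∈ , b′∈ , y≈) = b′ ⁻¹ , b ⁻¹ , 𝐁.closed-⁻¹ b′∈ , 𝐁.closed-⁻¹ b∈ ,
    ≈trans (⁻¹-cong y≈)
      (solve 3 (λ x b b′ → (b ⊙ x ⊙ b′) ⁻ ⊜ b′ ⁻ ⊙ x ⁻ ⊙ b ⁻) ≈refl x b b′)

  Dε⇒B : ∀ {x} → B⟨ ε ⟩B x → x ∈ᴳ B
  Dε⇒B (b , b′ , b∈ , b′∈ , x≈) = 𝐁.closed-≈ (≈sym x≈) (𝐁.closed-∙ (𝐁.closed-∙ b∈ 𝐁.closed-ε) b′∈)

  B⇒Dε : ∀ {x} → x ∈ᴳ B → B⟨ ε ⟩B x
  B⇒Dε {x} x∈ = D-resp (solve 1 (λ x → x ⊙ e ⊜ x) ≈refl x) (D-left x∈ D-refl)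

  D-in : ∀ {a} {H : Pred Carrier a} → Subgroup H → (∀ {b} → b ∈ᴳ B → H b) →
         ∀ {x y} → B⟨ x ⟩B y → H x → H y
  D-in H B⊆H (b , b′ , b∈ , b′∈ , y≈) x∈ =
    Subgroup.closed-≈ H (≈sym y≈) (Subgroup.closed-∙ H (Subgroup.closed-∙ H (B⊆H b∈) x∈) (B⊆H b′∈))

  step : ∀ j {x y} → x ∈ᴳ N → B⟨ x ⟩B y → B⟨ x ⟩B (s j ∙ y) ⊎ B⟨ s j ∙ x ⟩B (s j ∙ y)
  step j {x} {y} x∈N (b , b′ , b∈ , b′∈ , y≈) =
    Sum.map adjust adjust (sBw⊆BwB∪BswB j x b x∈N b∈)
    where
    adjust : ∀ {z} → B⟨ z ⟩B (s j ∙ b ∙ x) → B⟨ z ⟩B (s j ∙ y)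
    adjust d = D-resp (≈trans
      (solve 4 (λ s b x b′ → (s ⊙ b ⊙ x) ⊙ b′ ⊜ s ⊙ (b ⊙ x ⊙ b′)) ≈refl (s j) b x b′)
      (∙-congˡ (≈sym y≈))) (D-right b′∈ d)

  -- The axiom concerns left multiplication; inversion yields the right-handed version. The factor
  -- is `s j ⁻¹` because `s j` is an involution only modulo `B ∩ N`.
  stepʳ : ∀ j {x y} → x ∈ᴳ N → B⟨ x ⟩B y →
          B⟨ x ⟩B (y ∙ s j ⁻¹) ⊎ B⟨ x ∙ s j ⁻¹ ⟩B (y ∙ s j ⁻¹)
  stepʳ j {x} {y} x∈N d = Sum.map
    (λ d′ → D-respˡ (solve 1 (λ x → (x ⁻) ⁻ ⊜ x) ≈refl x) (D-resp (flip y) (D-inv d′)))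
    (λ d′ → D-respˡ (flip x) (D-resp (flip y) (D-inv d′)))
    (step j (𝐍.closed-⁻¹ x∈N) (D-inv d))
    where
    flip : ∀ z → (s j ∙ z ⁻¹) ⁻¹ ≈ z ∙ s j ⁻¹
    flip = solve 2 (λ s z → (s ⊙ z ⁻) ⁻ ⊜ z ⊙ s ⁻) ≈refl (s j)

  -- Equality of the images in W.
  infix 4 _≋_
  _≋_ : Carrier → Carrier → Set
  x ≋ y = x ⁻¹ ∙ y ∈ᴳ B ∩ N

  ≈⇒≋ : ∀ {x y} → x ≈ y → x ≋ y
  ≈⇒≋ {x} x≈y =
    𝐓.closed-≈ (≈trans (solve 1 (λ x → e ⊜ x ⁻ ⊙ x) ≈refl x) (∙-congˡ x≈y)) 𝐓.closed-ε

  ≋-sym : ∀ {x y} → x ≋ y → y ≋ x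
  ≋-sym {x} {y} p = 𝐓.closed-≈ (solve 2 (λ x y → (x ⁻ ⊙ y) ⁻ ⊜ y ⁻ ⊙ x) ≈refl x y) (𝐓.closed-⁻¹ p)

  ≋-trans : ∀ {x y z} → x ≋ y → y ≋ z → x ≋ z
  ≋-trans {x} {y} {z} p q =
    𝐓.closed-≈ (solve 3 (λ x y z → (x ⁻ ⊙ y) ⊙ (y ⁻ ⊙ z) ⊜ x ⁻ ⊙ z) ≈refl x y z) (𝐓.closed-∙ p q)

  ≋-congˡ : ∀ x {y z} → y ≋ z → x ∙ y ≋ x ∙ z
  ≋-congˡ x {y} {z} p =
    𝐓.closed-≈ (solve 3 (λ x y z → y ⁻ ⊙ z ⊜ (x ⊙ y) ⁻ ⊙ (x ⊙ z)) ≈refl x y z) p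

  ≋-congʳ : ∀ {x y z} → z ∈ᴳ N → x ≋ y → x ∙ z ≋ y ∙ z
  ≋-congʳ {x} {y} {z} z∈N p =
    𝐓.closed-≈ (solve 3 (λ x y z → z ⁻ ⊙ (x ⁻ ⊙ y) ⊙ (z ⁻) ⁻ ⊜ (x ⊙ z) ⁻ ⊙ (y ⊙ z)) ≈refl x y z)
      (normal (z ⁻¹) (x ⁻¹ ∙ y) (𝐍.closed-⁻¹ z∈N) p)

  s∙s∙x≋x : ∀ j {x} → x ∈ᴳ N → s j ∙ (s j ∙ x) ≋ x
  s∙s∙x≋x j {x} x∈N = 𝐓.closed-≈
    (solve 2 (λ s x → x ⁻ ⊙ (s ⊙ s) ⁻ ⊙ (x ⁻) ⁻ ⊜ (s ⊙ (s ⊙ x)) ⁻ ⊙ x) ≈refl (s j) x)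
    (normal (x ⁻¹) ((s j ∙ s j) ⁻¹) (𝐍.closed-⁻¹ x∈N) (𝐓.closed-⁻¹ (s-involutive j)))

  ≋⇒D : ∀ {x y} → x ≋ y → B⟨ x ⟩B y
  ≋⇒D {x} {y} p =
    D-resp (solve 2 (λ x y → x ⊙ (x ⁻ ⊙ y) ⊜ y) ≈refl x y) (D-right (T⇒B p) D-refl)

  _≋?_ : ∀ x y → Dec (x ≋ y)
  x ≋? y = (x ⁻¹ ∙ y) ∈ᴳ? (B ∩ N)

  -- `letter` selects the generators that words may use: all of them, or all but one. Lengths and
  -- reduced words are always relative to this selection.
  module Words {m} (letter : Fin m → Fin rank) where

    σ : Fin m → Carrier
    σ k = s (letter k)

    Word : Set
    Word = List (Fin m)

    π : Word → Carrier
    π []       = ε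
    π (k ∷ xs) = σ k ∙ π xs

    π∈N : ∀ xs → π xs ∈ᴳ N
    π∈N []       = 𝐍.closed-ε
    π∈N (k ∷ xs) = 𝐍.closed-∙ (s∈N (letter k)) (π∈N xs)

    π-∷ʳ : ∀ xs t → π (xs ∷ʳ t) ≈ π xs ∙ σ t
    π-∷ʳ []       t = solve 1 (λ t → t ⊙ e ⊜ e ⊙ t) ≈refl (σ t)
    π-∷ʳ (k ∷ xs) t = ≈trans (∙-congˡ (π-∷ʳ xs t))
      (solve 3 (λ k x t → k ⊙ (x ⊙ t) ⊜ k ⊙ x ⊙ t) ≈refl (σ k) (π xs) (σ t))

    π-in : ∀ {a} {H : Pred Carrier a} → Subgroup H → ∀ {xs} → All (H ∘ σ) xs → H (π xs)
    π-in H []       = Subgroup.closed-ε H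
    π-in H (p ∷ ps) = Subgroup.closed-∙ H p (π-in H ps)

    -- A lower bound takes the place of a length function, since `y` need not be known to be the
    -- value of any word in the chosen letters.
    ≥-length : ℕ → Pred Carrier _
    ≥-length n y = ∀ zs → π zs ≋ y → n ≤ length zs

    Reduced : Pred Word _
    Reduced xs = ≥-length (length xs) (π xs)

    -- Uniqueness in the Bruhat decomposition, asymmetric so that the induction goes through: `y`
    -- must be at least as long as `xs`. Multiplication by the first letter puts `π xs` into the
    -- double coset of `y` or of `σ k ∙ y`; in the first case `y` would be the value of the shorter
    -- word `xs`.
    double-coset-unique : ∀ xs {y} → y ∈ᴳ N → ≥-length (length xs) y →
                          B⟨ π xs ⟩B y → π xs ≋ y
    double-coset-unique [] y∈N _ d = 𝐓.closed-≈ (≈sym (solve 1 (λ y → e ⁻ ⊙ y ⊜ y) ≈refl _))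
        (B∧N⇒T (Dε⇒B d) y∈N)
    double-coset-unique (k ∷ xs) {y} y∈N short d =
      [ (λ d₁ → contradiction
            (short xs (double-coset-unique xs y∈N (λ zs p → ℕ.<⇒≤ (short zs p)) (drop-ss d₁)))
            (ℕ.n≮n _))
      , (λ d₂ → ≋-trans (≋-congˡ (σ k) (double-coset-unique xs (𝐍.closed-∙ (s∈N j) y∈N)
            (λ zs p → ℕ.s≤s⁻¹ (short (k ∷ zs) (≋-trans (≋-congˡ (σ k) p) (s∙s∙x≋x j y∈N))))
            (drop-ss d₂)))
          (s∙s∙x≋x j y∈N))
      ]′ (step j y∈N (D-sym d))
      where
      j = letter k
      drop-ss : ∀ {z} → B⟨ z ⟩B (σ k ∙ (σ k ∙ π xs)) → B⟨ π xs ⟩B z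
      drop-ss d = D-sym (D-resp
        (solve 2 (λ s x → (s ⊙ s) ⁻ ⊙ (s ⊙ (s ⊙ x)) ⊜ x) ≈refl (σ k) (π xs))
        (D-left (𝐁.closed-⁻¹ (ss∈B j)) d))

    reduced-tail : ∀ k xs → Reduced (k ∷ xs) → Reduced xs
    reduced-tail k xs red zs p = ℕ.s≤s⁻¹ (red (k ∷ zs) (≋-congˡ (σ k) p))

    length-∷ʳ : ∀ (xs : Word) t → length (xs ∷ʳ t) ≡ suc (length xs)
    length-∷ʳ xs t = ≡.trans (List.length-++ xs) (ℕ.+-comm (length xs) 1)

    reduced-init : ∀ xs t → Reduced (xs ∷ʳ t) → Reduced xs
    reduced-init xs t red zs p = ℕ.s≤s⁻¹ (≡.subst₂ _≤_ (length-∷ʳ xs t) (length-∷ʳ zs t)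
      (red (zs ∷ʳ t) (≋-trans (≈⇒≋ (π-∷ʳ zs t))
        (≋-trans (≋-congʳ (s∈N (letter t)) p) (≈⇒≋ (≈sym (π-∷ʳ xs t)))))))

    -- σ k B x ⊆ B σ k x B if the length of σ k x exceeds that of x.
    reduced-exchange : ∀ k xs {b} → Reduced (k ∷ xs) → b ∈ᴳ B →
                       ¬ B⟨ π xs ⟩B (σ k ∙ b ∙ π xs)
    reduced-exchange k xs red b∈ = go (reverseView xs) red
      where
      go : ∀ {xs} → Reverse xs → Reduced (k ∷ xs) → ¬ B⟨ π xs ⟩B (σ k ∙ _ ∙ π xs)
      go [] red d = s∉B (letter k) (𝐁.closed-≈
        (solve 2 (λ s b → (s ⊙ b ⊙ e) ⊙ b ⁻ ⊜ s) ≈refl (σ k) _)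
        (𝐁.closed-∙ (Dε⇒B d) (𝐁.closed-⁻¹ b∈)))
      -- The last letter is stripped: after right multiplication by `σ t ⁻¹`, either the assumption
      -- descends to `ys`, or the product falls into the double coset of `ys ∷ʳ t`.
      go (ys ∶ rs ∶ʳ t) red d =
        [ longer
        , (λ d₂ → go rs red-ys (D-respˡ (≈trans (∙-congʳ (π-∷ʳ ys t)) (tt⁻¹ (π ys)))
            (D-resp (tt⁻¹ _) d₂)))
        ]′ (stepʳ (letter t) (π∈N (ys ∷ʳ t)) (D-resp
             (≈trans (∙-congˡ (π-∷ʳ ys t)) (≈sym (assoc _ _ _))) d))
        where
        red-ys : Reduced (k ∷ ys)
        red-ys = reduced-init (k ∷ ys) t red
        tt⁻¹ : ∀ z → z ∙ σ t ∙ σ t ⁻¹ ≈ z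
        tt⁻¹ z = solve 2 (λ z t → z ⊙ t ⊙ t ⁻ ⊜ z) ≈refl z (σ t)
        -- Here the axiom leaves the double coset of `ys`, excluded by induction, or that of
        -- `σ k ∙ π ys`. In the latter case uniqueness gives `π (ys ∷ʳ t) ≋ σ k ∙ π ys`, and the
        -- reduced word `k ∷ ys ∷ʳ t` would have the value of `ys`, two letters shorter.
        longer : ¬ B⟨ π (ys ∷ʳ t) ⟩B (σ k ∙ _ ∙ π ys ∙ σ t ∙ σ t ⁻¹)
        longer d₁ =
          [ go rs red-ys
          , (λ d₃ → ℕ.m+1+n≰m (length ys) {1} (≡.subst (_≤ length ys)
               (≡.trans (≡.cong suc (length-∷ʳ ys t)) (ℕ.+-comm 2 _))
               (red ys (≋-sym (≋-trans (≋-congˡ (σ k)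
                 (double-coset-unique (ys ∷ʳ t) (𝐍.closed-∙ (s∈N (letter k)) (π∈N ys))
                   (λ zs p → ≡.subst (_≤ length zs) (≡.sym (length-∷ʳ ys t)) (red-ys zs p))
                   (D-trans (D-resp (tt⁻¹ _) d₁) (D-sym d₃))))
                 (s∙s∙x≋x (letter k) (π∈N ys)))))))
          ]′ (sBw⊆BwB∪BswB (letter k) (π ys) _ (π∈N ys) b∈)

    hasLength? : ∀ n y → Dec (∃ λ zs → length zs ≡ n × π zs ≋ y)
    hasLength? zero y = map′ (λ p → [] , ≡.refl , p) (λ { ([] , _ , p) → p }) (ε ≋? y)
    hasLength? (suc n) y = map′
      (λ (k , zs , len , p) → k ∷ zs , ≡.cong suc len ,
         ≋-trans (≋-congˡ (σ k) p)
           (≈⇒≋ (solve 2 (λ s y → s ⊙ (s ⁻ ⊙ y) ⊜ y) ≈refl (σ k) y)))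
      (λ { (k ∷ zs , len , p) → k , zs , ℕ.suc-injective len ,
         ≋-trans (≈⇒≋ (solve 2 (λ s z → z ⊜ s ⁻ ⊙ (s ⊙ z)) ≈refl (σ k) (π zs)))
           (≋-congˡ (σ k ⁻¹) p) })
      (Fin.any? λ k → hasLength? n (σ k ⁻¹ ∙ y))

    reduce : ∀ xs → ∃ λ zs → Reduced zs × π zs ≋ π xs
    reduce xs with least (λ n → hasLength? n (π xs)) (length xs) (xs , ≡.refl , ≈⇒≋ ≈refl)
    ... | m , (zs , ≡.refl , p) , minimal =
      zs , (λ us q → minimal (length us) (us , ≡.refl , ≋-trans q p)) , p

    -- If x is the value of a reduced word k ∷ xs, then σ k lies in B x B x⁻¹ B:
    -- since σ k B σ k meets B σ k B, the set σ k B x meets B x B.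
    letters-in : ∀ {a} {H : Pred Carrier a} → Subgroup H → (∀ {b} → b ∈ᴳ B → H b) →
                 ∀ xs → Reduced xs → (∀ {b} → b ∈ᴳ B → H (π xs ∙ b ∙ π xs ⁻¹)) →
                 All (H ∘ σ) xs
    letters-in H-sub B⊆H [] _ _ = []
    letters-in {H = H} H-sub B⊆H (k ∷ xs) red conj =
      σk∈H ∷ letters-in H-sub B⊆H xs (reduced-tail k xs red) (λ {b} b∈ → 𝐇.closed-≈
        (solve 3 (λ s x b → s ⁻ ⊙ (s ⊙ x ⊙ b ⊙ (s ⊙ x) ⁻) ⊙ s ⊜ x ⊙ b ⊙ x ⁻) ≈refl (σ k) (π xs) b)
        (𝐇.closed-∙ (𝐇.closed-∙ (𝐇.closed-⁻¹ σk∈H) (conj b∈)) σk∈H))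
      where
      module 𝐇 = Subgroup H-sub
      j = letter k

      -- The axiom merely denies an inclusion; a search through the finite group extracts a witness.
      outside-B : ∃ λ b → b ∈ᴳ B × ¬ (s j ∙ b ∙ s j ⁻¹ ∈ᴳ B)
      outside-B with Fin.any? (λ i → from i ∈ᴳ? B ×-dec ¬? ((s j ∙ from i ∙ s j ⁻¹) ∈ᴳ? B))
      ... | yes (i , p) = from i , p
      ... | no none = contradiction
        (λ b b∈ → 𝐁.closed-≈ (∙-congʳ (∙-congˡ (strictlyInverseʳ b)))
          (decidable-stable (_ ∈ᴳ? B) λ ∉ →
            none (to b , 𝐁.closed-≈ (≈sym (strictlyInverseʳ b)) b∈ , ∉)))
        (sBs⁻¹⊈B j)

      b₀ = proj₁ outside-B
      b₀∈ = proj₁ (proj₂ outside-B)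

      sbs : B⟨ s j ⟩B (s j ∙ b₀ ∙ s j)
      sbs = [ id
            , (λ d → contradiction
                (𝐁.closed-≈ (solve 2 (λ s b → (s ⊙ b ⊙ s) ⊙ (s ⊙ s) ⁻ ⊜ s ⊙ b ⊙ s ⁻) ≈refl (s j) b₀)
                  (𝐁.closed-∙ (D-in (subset-subgroup B-subgroup) id d (ss∈B j))
                    (𝐁.closed-⁻¹ (ss∈B j))))
                (proj₂ (proj₂ outside-B)))
            ]′ (sBw⊆BwB∪BswB j (s j) b₀ (s∈N j) b₀∈)

      sbx : B⟨ π (k ∷ xs) ⟩B (σ k ∙ b₀ ∙ π (k ∷ xs))
      sbx with sbs
      ... | b₁ , b₂ , b₁∈ , b₂∈ , eq =
        [ (λ d → contradiction d (reduced-exchange k xs red b₂∈))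
        , (λ d → D-resp (≈trans
              (solve 4 (λ b s b′ x → b ⊙ (s ⊙ b′ ⊙ x) ⊜ (b ⊙ s ⊙ b′) ⊙ x) ≈refl b₁ (σ k) b₂ (π xs))
              (≈trans (∙-congʳ (≈sym eq))
                (solve 3 (λ s b x → s ⊙ b ⊙ s ⊙ x ⊜ s ⊙ b ⊙ (s ⊙ x)) ≈refl (σ k) b₀ (π xs))))
            (D-left b₁∈ d))
        ]′ (sBw⊆BwB∪BswB j (π xs) b₂ (π∈N xs) b₂∈)

      σk∈H : H (σ k)
      -- The equation `σ k ∙ b₀ ∙ x ≈ c₁ ∙ x ∙ c₂`, with `x` the value of the word, is solved for
      -- the letter: it is `c₁`, times the conjugate of `c₂` by `x`, times `b₀ ⁻¹`.
      σk∈H = let (c₁ , c₂ , c₁∈ , c₂∈ , eq) = sbx in 𝐇.closed-≈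
        (≈trans (solve 4 (λ b x b′ b₀ → b ⊙ (x ⊙ b′ ⊙ x ⁻) ⊙ b₀ ⁻ ⊜ (b ⊙ x ⊙ b′) ⊙ x ⁻ ⊙ b₀ ⁻)
                  ≈refl c₁ (π (k ∷ xs)) c₂ b₀)
          (≈trans (∙-congʳ (∙-congʳ (≈sym eq)))
            (solve 3 (λ s b x → (s ⊙ b ⊙ x) ⊙ x ⁻ ⊙ b ⁻ ⊜ s) ≈refl (σ k) b₀ (π (k ∷ xs)))))
        (𝐇.closed-∙ (𝐇.closed-∙ (B⊆H c₁∈) (conj c₂∈)) (𝐇.closed-⁻¹ (B⊆H b₀∈)))

    Generator : Pred Carrier _
    Generator y = (∃ λ k → y ≈ σ k) ⊎ y ∈ᴳ B

    -- The union of the double cosets of words contains `ε` and is stable under the generators and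
    -- their inverses; `σ k ⁻¹` is handled as `σ k` times an element of `B`.
    bruhat : ∀ {x} → ⟨ Generator ⟩ x → ∃ λ xs → B⟨ π xs ⟩B x
    bruhat {x} p = Z-resp (identityʳ x) (proj₁ (⟨⟩-act Z-resp act p ([] , D-refl)))
      where
      Z : Pred Carrier _
      Z y = ∃ λ xs → B⟨ π xs ⟩B y
      Z-resp : Z Respects _≈_
      Z-resp y≈ (xs , d) = xs , D-resp y≈ d
      Z-B : ∀ {b y} → b ∈ᴳ B → Z y → Z (b ∙ y)
      Z-B b∈ (xs , d) = xs , D-left b∈ d
      Z-σ : ∀ k {y} → Z y → Z (σ k ∙ y)
      Z-σ k (xs , d) = [ (xs ,_) , (k ∷ xs ,_) ]′ (step (letter k) (π∈N xs) d)
      act : ∀ {x y} → Generator x → Z y → Z (x ∙ y) × Z (x ⁻¹ ∙ y)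
      act (inj₂ b∈) z = Z-B b∈ z , Z-B (𝐁.closed-⁻¹ b∈) z
      act {x} {y} (inj₁ (k , x≈)) z =
          Z-resp (∙-congʳ (≈sym x≈)) (Z-σ k z)
        , Z-resp (≈trans (solve 2 (λ s y → s ⊙ ((s ⊙ s) ⁻ ⊙ y) ⊜ s ⁻ ⊙ y) ≈refl (σ k) y)
                         (∙-congʳ (⁻¹-cong (≈sym x≈))))
            (Z-σ k (Z-B (𝐁.closed-⁻¹ (ss∈B (letter k))) z))

    reduced-bruhat : ∀ {x} → ⟨ Generator ⟩ x → ∃ λ xs → Reduced xs × B⟨ π xs ⟩B x
    reduced-bruhat p with bruhat p
    ... | xs , d with reduce xs
    ...   | zs , red , zs≋xs = zs , red , D-trans (≋⇒D zs≋xs) d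

-- The building

¬¬-∀ : ∀ {n p} {P : Pred (Fin n) p} → (∀ i → ¬ ¬ P i) → ¬ ¬ (∀ i → P i)
¬¬-∀ {zero}  h k = k λ ()
¬¬-∀ {suc n} h k = h zero λ p₀ → ¬¬-∀ (h ∘ suc) λ ps → k λ { zero → p₀ ; (suc i) → ps i }

module _ {n p} {P : Pred (Fin n) p} (P? : Decidable P) where

  ∈-tabulate⁺ : ∀ {i} → P i → i ∈ Vec.tabulate (does ∘ P?)
  ∈-tabulate⁺ {i} Pi = Vec.lookup⇒[]= i _ (≡.trans (Vec.lookup∘tabulate _ i) (dec-true (P? i) Pi))

  ∈-tabulate⁻ : ∀ {i} → i ∈ Vec.tabulate (does ∘ P?) → P i
  ∈-tabulate⁻ {i} i∈ = decidable-stable (P? i) λ ¬Pi → contradiction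
    (≡.trans (≡.sym (Vec.[]=⇒lookup i∈)) (≡.trans (Vec.lookup∘tabulate _ i) (dec-false (P? i) ¬Pi)))
    λ ()

lookup-injective : ∀ {a} {A : Set a} {xs : List A} → ListUnique.Unique xs →
                   ∀ {i j} → List.lookup xs i ≡ List.lookup xs j → i ≡ j
lookup-injective (_ AllPairs.∷ _)   {zero}  {zero}  _  = ≡.refl
lookup-injective (x∉ AllPairs.∷ _)  {zero}  {suc j} eq = contradiction eq
    (All.lookup x∉ (List.∈-lookup j))
lookup-injective (x∉ AllPairs.∷ _)  {suc i} {zero}  eq = contradiction (≡.sym eq)
    (All.lookup x∉ (List.∈-lookup i))
lookup-injective (_ AllPairs.∷ xs!) {suc i} {suc j} eq = ≡.cong suc (lookup-injective xs! eq)

allSubsets-unique : ∀ n → ListUnique.Unique (allSubsets n)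
allSubsets-unique zero    = [] AllPairs.∷ AllPairs.[]
allSubsets-unique (suc n) = ListUnique.++⁺
  (ListUnique.map⁺ Vec.∷-injectiveʳ (allSubsets-unique n))
  (ListUnique.map⁺ Vec.∷-injectiveʳ (allSubsets-unique n))
  λ (p , q) → disjoint (List.∈-map⁻ (inside ∷_) p) (List.∈-map⁻ (outside ∷_) q)
  where
  disjoint : ∀ {v} → (∃ λ σ → σ List.∈ allSubsets n × v ≡ inside ∷ σ) →
             ¬ (∃ λ σ → σ List.∈ allSubsets n × v ≡ outside ∷ σ)
  disjoint (_ , _ , ≡.refl) (_ , _ , ())

⊆∧∣≡∣⇒≡ : ∀ {n} {p q : Subset n} → p ⊆ q → ∣ p ∣ ≡ ∣ q ∣ → p ≡ q
⊆∧∣≡∣⇒≡ {p = p} {q} p⊆q ∣p∣≡∣q∣ = Sub.⊆-antisym p⊆q λ {x} x∈q →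
  decidable-stable (x Sub.∈? p) λ x∉p →
    ℕ.<-irrefl ∣p∣≡∣q∣ (Sub.p⊂q⇒∣p∣<∣q∣ (p⊆q , x , x∈q , x∉p))

∣∣-bijection : ∀ {k m} (σ : Subset k) (col : Fin k → Fin m) →
               (∀ t → ∃ λ v → v ∈ σ × col v ≡ t) →
               (∀ {v v′} → v ∈ σ → v′ ∈ σ → col v ≡ col v′ → v ≡ v′) → ∣ σ ∣ ≡ m
∣∣-bijection {k} {m} σ col onto injective = begin
  ∣ σ ∣
    ≡⟨ ·-one ∣ σ ∣ ⟨
  ∣ σ ∣ · 1
    ≡⟨ ⨁-∣∣ σ ⟨
  ⨁ (List.allFin k) (λ v → 𝟙 (v Sub.∈? σ))
    ≡⟨ ⨁-cong (List.allFin k) (λ v → ≡.sym (ℕ.*-identityʳ _)) ⟩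
  ⨁ (List.allFin k) (λ v → 𝟙 (v Sub.∈? σ) ℕ.* 1)
    ≡⟨ ⨁-bijection (Sub._∈? σ) col onto injective (λ _ → 1) ⟩
  ⨁ (List.allFin m) (λ _ → 1)
    ≡⟨ ⨁-const (List.allFin m) 1 ⟩
  length (List.allFin m) · 1
    ≡⟨ ·-one (length (List.allFin m)) ⟩
  length (List.allFin m)
    ≡⟨ List.length-tabulate id ⟩
  m ∎
  where
  open ≡.≡-Reasoning
  open FiniteSums ℕ.+-*-commutativeSemiring
  ·-one : ∀ n → n · 1 ≡ n
  ·-one zero    = ≡.refl
  ·-one (suc n) = ≡.cong suc (·-one n)

-- A type function; pure complexes that carry one are known as balanced or numbered. The
-- construction of the eigenvector uses nothing else about buildings.
record Colouring {p} (n : ℕ) (K : SetFamily p) : Set p where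
  open SetFamily K
  field
    colour    : Fin #Ver → Fin (suc n)
    onto      : ∀ {τ} → IsSimplex n τ → ∀ t → ∃ λ v → v ∈ τ × colour v ≡ t
    injective : ∀ {τ} → IsSimplex n τ → ∀ {v v′} → v ∈ τ → v′ ∈ τ → colour v ≡ colour v′ → v ≡ v′

module BuildingProperties {c r} {G : FiniteGroup c r} {ℓ : ℕ} (T : TitsSystem G (suc ℓ)) where
  open FiniteGroup G
  open TitsSystem T
  open TitsProperties T
  open GroupSolver group using (solve; _⊜_; _⊙_; _⁻; e)
  module AllWords = Words id

  generated-by-s : ∀ x → ⟨ AllWords.Generator ⟩ x
  generated-by-s x = ⟨⟩-minimal G-sub (λ {y} y∈ → [ gen ∘ inj₂ , N-gen ]′ (Sub.x∈p∪q⁻ B N y∈))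
      (generated x)
    where
    G-sub = ⟨⟩-subgroup AllWords.Generator
    N-gen : ∀ {y} → y ∈ᴳ N → ⟨ AllWords.Generator ⟩ y
    N-gen {y} y∈N = ⟨⟩-minimal G-sub [ gen ∘ inj₁ , gen ∘ inj₂ ∘ T⇒B ]′ (S-generates y y∈N)

  Conjugates : ∀ {a} → Pred Carrier a → Carrier → Set _
  Conjugates H g = ∀ {b} → b ∈ᴳ B → H (g ∙ b ∙ g ⁻¹)

  module _ {a} {H : Pred Carrier a} (H-sub : Subgroup H) (B⊆H : ∀ {b} → b ∈ᴳ B → H b) where
    private module 𝐇 = Subgroup H-sub

    -- As `H` contains `B`, the hypothesis on `x` passes to every representative of its double
    -- coset, in particular to the value of a reduced word.
    overgroup-word : ∀ {x} → Conjugates H x →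
                     ∃ λ xs → All (H ∘ s) xs × B⟨ AllWords.π xs ⟩B x
    overgroup-word {x} conj =
      let (xs , red , d) = AllWords.reduced-bruhat (generated-by-s x)
      in xs , AllWords.letters-in H-sub B⊆H xs red (conj′ d) , d
      where
      conj′ : ∀ {w} → B⟨ w ⟩B x → Conjugates H w
      conj′ {w} (b₁ , b₂ , b₁∈ , b₂∈ , x≈) {b} b∈ = 𝐇.closed-≈
        (≈trans (∙-congʳ (∙-congˡ (∙-cong (∙-congʳ x≈) (⁻¹-cong x≈))))
          (solve 4 (λ b₁ w b₂ b →
              b₁ ⁻ ⊙ (b₁ ⊙ w ⊙ b₂ ⊙ (b₂ ⁻ ⊙ b ⊙ b₂) ⊙ (b₁ ⊙ w ⊙ b₂) ⁻) ⊙ b₁ ⊜ w ⊙ b ⊙ w ⁻)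
            ≈refl b₁ w b₂ b))
        (𝐇.closed-∙ (𝐇.closed-∙ (B⊆H (𝐁.closed-⁻¹ b₁∈))
          (conj (𝐁.closed-∙ (𝐁.closed-∙ (𝐁.closed-⁻¹ b₂∈) b∈) b₂∈))) (B⊆H b₁∈))

    conjugator-in : ∀ {x} → Conjugates H x → H x
    conjugator-in conj =
      let (xs , letters , d) = overgroup-word conj
      in D-in H-sub B⊆H d (AllWords.π-in H-sub letters)

    -- Every element of `H` lies in the double coset of a word whose letters are in `H`; so an
    -- overgroup of `B` is determined by the generators in it.
    overgroup-⊆ : ∀ {b} {K : Pred Carrier b} → Subgroup K → (∀ {b} → b ∈ᴳ B → K b) →
                  (∀ j → H (s j) → K (s j)) → ∀ {x} → H x → K x
    overgroup-⊆ K-sub B⊆K letters⊆ {x} x∈H =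
      let (xs , letters , d) =
            overgroup-word (λ b∈ → 𝐇.closed-∙ (𝐇.closed-∙ x∈H (B⊆H b∈)) (𝐇.closed-⁻¹ x∈H))
      in D-in K-sub B⊆K d (AllWords.π-in K-sub (All.map (letters⊆ _) letters))

  s-injective-mod-B : ∀ {j k} → B⟨ s j ⟩B (s k) → j ≡ k
  s-injective-mod-B {j} {k} d = decidable-stable (j Fin.≟ k) λ j≢k → s-distinct j≢k
    (≋-trans (≈⇒≋ (≈sym (identityʳ (s j))))
      (AllWords.double-coset-unique (j ∷ []) (s∈N k) long (D-respˡ (≈sym (identityʳ (s j))) d)))
    where
    long : AllWords.≥-length 1 (s k)
    long []      p = contradiction (𝐓.closed-≈ (solve 1 (λ x → e ⁻ ⊙ x ⊜ x) ≈refl (s k)) p)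
        (s-nontrivial k)
    long (_ ∷ _) p = s≤s z≤n

  -- Subgroups that omit one generator

  module OmittingWords (j : Fin (suc ℓ)) = Words (punchIn j)

  -- Otherwise `s j` lies in the double coset of a word reduced with respect to the other
  -- generators. The letters of that word belong to the subgroup generated by `B` and `s j`; but
  -- this is `B` together with the double coset of `s j`, which contains no other generator.
  s∉⟨others⟩ : ∀ j → ¬ ⟨ OmittingWords.Generator j ⟩ (s j)
  s∉⟨others⟩ j p = let (xs , red , d) = OmittingWords.reduced-bruhat j p in go xs red d
    where
    H-sub = ⟨⟩-subgroup (λ y → (y ≈ s j) ⊎ y ∈ᴳ B)

    Z : Pred Carrier _
    Z y = B⟨ ε ⟩B y ⊎ B⟨ s j ⟩B y
    Z-resp : Z Respects _≈_
    Z-resp y≈ = Sum.map (D-resp y≈) (D-resp y≈)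
    Z-B : ∀ {b y} → b ∈ᴳ B → Z y → Z (b ∙ y)
    Z-B b∈ = Sum.map (D-left b∈) (D-left b∈)
    Z-s : ∀ {y} → Z y → Z (s j ∙ y)
    Z-s (inj₁ d) = Sum.map₂ (D-respˡ (identityʳ (s j))) (step j 𝐍.closed-ε d)
    Z-s (inj₂ d) = [ inj₂ , inj₁ ∘ D-trans (B⇒Dε (ss∈B j)) ]′ (step j (s∈N j) d)

    act : ∀ {x y} → (x ≈ s j) ⊎ x ∈ᴳ B → Z y → Z (x ∙ y) × Z (x ⁻¹ ∙ y)
    act (inj₂ b∈) z = Z-B b∈ z , Z-B (𝐁.closed-⁻¹ b∈) z
    act {x} {y} (inj₁ x≈) z =
        Z-resp (∙-congʳ (≈sym x≈)) (Z-s z)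
      , Z-resp (≈trans (solve 2 (λ s y → s ⊙ ((s ⊙ s) ⁻ ⊙ y) ⊜ s ⁻ ⊙ y) ≈refl (s j) y)
                       (∙-congʳ (⁻¹-cong (≈sym x≈))))
          (Z-s (Z-B (𝐁.closed-⁻¹ (ss∈B j)) z))

    generated⇒Z : ∀ {x} → ⟨ (λ y → (y ≈ s j) ⊎ y ∈ᴳ B) ⟩ x → Z x
    generated⇒Z {x} p = Z-resp (identityʳ x) (proj₁ (⟨⟩-act Z-resp act p (inj₁ D-refl)))

    go : ∀ xs → OmittingWords.Reduced j xs → ¬ B⟨ OmittingWords.π j xs ⟩B (s j)
    go []       _   d = s∉B j (Dε⇒B d)
    go (k ∷ xs) red d =
      [ s∉B (punchIn j k) ∘ Dε⇒B , Fin.punchInᵢ≢i j k ∘ ≡.sym ∘ s-injective-mod-B ]′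
        (generated⇒Z (All.head (OmittingWords.letters-in j H-sub (gen ∘ inj₂) (k ∷ xs) red
          (λ b∈ → ∙∈ (∙∈ x∈H (gen (inj₂ b∈))) (⁻¹∈ x∈H)))))
      where
      x∈H = D-in H-sub (gen ∘ inj₂) (D-sym d) (gen (inj₁ ≈refl))

  Omits : Fin (suc ℓ) → Pred (Subset order) c
  Omits j P = IsSubgroup P × B ⊆ P × (∀ k → s (punchIn j k) ∈ᴳ P) × ¬ (s j ∈ᴳ P)

  -- ⟨ B , s k (k ≠ j) ⟩ is only given as a predicate, whose decidability is
  -- not known; but existence of a subset with a decidable property is stable.
  abstract
    omitting : ∀ j → ∃ (Omits j)
    omitting j = decidable-stable
      (Sub.anySubset? λ P → IsSubgroup? P ×-dec ((B Sub.⊆? P) ×-dec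
        (Fin.all? (λ k → s (punchIn j k) ∈ᴳ? P) ×-dec ¬? (s j ∈ᴳ? P))))
      (λ none → ¬¬-∀ (λ _ → ¬¬-excluded-middle) (none ∘ from-dec))
      where
      Q : Pred Carrier (c ⊔ r)
      Q = ⟨ OmittingWords.Generator j ⟩
      from-dec : Decidable (Q ∘ from) → ∃ (Omits j)
      from-dec Q? = P
        , record
          { ε∈  = in⁺ ε∈
          ; ∙∈  = λ x y p q → in⁺ (∙∈ (in⁻ p) (in⁻ q))
          ; ⁻¹∈ = λ x p → in⁺ (⁻¹∈ (in⁻ p))
          }
        , (λ {i} i∈ → ∈-tabulate⁺ Q? (gen (inj₂ (≡.subst (_∈ B) (≡.sym (strictlyInverseˡ i)) i∈))))
        , (λ k → in⁺ (gen (inj₁ (k , ≈refl))))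
        , (λ s∈ → s∉⟨others⟩ j (in⁻ s∈))
        where
        open Inverse enumeration using (strictlyInverseˡ)
        P : Subset order
        P = Vec.tabulate (does ∘ Q?)
        in⁺ : ∀ {x} → Q x → x ∈ᴳ P
        in⁺ {x} q = ∈-tabulate⁺ Q? (resp (≈sym (strictlyInverseʳ x)) q)
        in⁻ : ∀ {x} → x ∈ᴳ P → Q x
        in⁻ {x} x∈ = resp (strictlyInverseʳ x) (∈-tabulate⁻ Q? x∈)

  conjugate : Carrier → Subset order → Subset order
  conjugate g P = Vec.tabulate λ i → does ((g ⁻¹ ∙ from i ∙ g) ∈ᴳ? P)

  module _ {g : Carrier} {P : Subset order} where

    ∈-conjugate⁺ : ∀ {x} → g ⁻¹ ∙ x ∙ g ∈ᴳ P → x ∈ᴳ conjugate g P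
    ∈-conjugate⁺ {x} p = ∈-tabulate⁺ (λ i → (g ⁻¹ ∙ from i ∙ g) ∈ᴳ? P)
      (∈-resp P (∙-congʳ (∙-congˡ (≈sym (strictlyInverseʳ x)))) p)

    ∈-conjugate⁻ : ∀ {x} → x ∈ᴳ conjugate g P → g ⁻¹ ∙ x ∙ g ∈ᴳ P
    ∈-conjugate⁻ {x} x∈ = ∈-resp P (∙-congʳ (∙-congˡ (strictlyInverseʳ x)))
      (∈-tabulate⁻ (λ i → (g ⁻¹ ∙ from i ∙ g) ∈ᴳ? P) x∈)

    conj∈-conjugate⁺ : ∀ {x} → x ∈ᴳ P → g ∙ x ∙ g ⁻¹ ∈ᴳ conjugate g P
    conj∈-conjugate⁺ {x} x∈ = ∈-conjugate⁺
      (∈-resp P (solve 2 (λ g x → x ⊜ g ⁻ ⊙ (g ⊙ x ⊙ g ⁻) ⊙ g) ≈refl g x) x∈)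

    conj∈-conjugate⁻ : ∀ {x} → g ∙ x ∙ g ⁻¹ ∈ᴳ conjugate g P → x ∈ᴳ P
    conj∈-conjugate⁻ {x} x∈ =
      ∈-resp P (solve 2 (λ g x → g ⁻ ⊙ (g ⊙ x ⊙ g ⁻) ⊙ g ⊜ x) ≈refl g x) (∈-conjugate⁻ x∈)

    conjugate-subgroup : IsSubgroup P → IsSubgroup (conjugate g P)
    conjugate-subgroup P-sub = record
      { ε∈  = ∈-conjugate⁺ (𝐏.closed-≈ (solve 1 (λ g → e ⊜ g ⁻ ⊙ e ⊙ g) ≈refl g) 𝐏.closed-ε)
      ; ∙∈  = λ x y p q → ∈-conjugate⁺ (𝐏.closed-≈
                (solve 3 (λ g x y → (g ⁻ ⊙ x ⊙ g) ⊙ (g ⁻ ⊙ y ⊙ g) ⊜ g ⁻ ⊙ (x ⊙ y) ⊙ g) ≈refl g x y)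
                (𝐏.closed-∙ (∈-conjugate⁻ p) (∈-conjugate⁻ q)))
      ; ⁻¹∈ = λ x p → ∈-conjugate⁺ (𝐏.closed-≈
                (solve 2 (λ g x → (g ⁻ ⊙ x ⊙ g) ⁻ ⊜ g ⁻ ⊙ x ⁻ ⊙ g) ≈refl g x)
                (𝐏.closed-⁻¹ (∈-conjugate⁻ p)))
      }
      where module 𝐏 = Subgroup (subset-subgroup P-sub)

  conjugated-subgroup : ∀ {P} → IsSubgroup P → ∀ g → Subgroup (λ x → g ∙ x ∙ g ⁻¹ ∈ᴳ P)
  conjugated-subgroup P-sub g = record
    { closed-≈  = λ x≈y → 𝐏.closed-≈ (∙-congʳ (∙-congˡ x≈y))
    ; closed-ε  = 𝐏.closed-≈ (solve 1 (λ g → e ⊜ g ⊙ e ⊙ g ⁻) ≈refl g) 𝐏.closed-ε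
    ; closed-∙  = λ {x} {y} p q → 𝐏.closed-≈
        (solve 3 (λ g x y → (g ⊙ x ⊙ g ⁻) ⊙ (g ⊙ y ⊙ g ⁻) ⊜ g ⊙ (x ⊙ y) ⊙ g ⁻) ≈refl g x y)
        (𝐏.closed-∙ p q)
    ; closed-⁻¹ = λ {x} p → 𝐏.closed-≈
        (solve 2 (λ g x → (g ⊙ x ⊙ g ⁻) ⁻ ⊜ g ⊙ x ⁻ ⊙ g ⁻) ≈refl g x) (𝐏.closed-⁻¹ p)
    }
    where module 𝐏 = Subgroup (subset-subgroup P-sub)

  -- j belongs to the type of P, seen from the chamber g B g⁻¹.
  HasLetter : Carrier → Subset order → Fin (suc ℓ) → Set
  HasLetter g P j = g ∙ s j ∙ g ⁻¹ ∈ᴳ P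

  hasLetter? : ∀ g P j → Dec (HasLetter g P j)
  hasLetter? g P j = (g ∙ s j ∙ g ⁻¹) ∈ᴳ? P

  ⊆ᴳ⇒⊆ : ∀ {P Q : Subset order} → (∀ {x} → x ∈ᴳ P → x ∈ᴳ Q) → P ⊆ Q
  ⊆ᴳ⇒⊆ {P} {Q} f {i} i∈ = ≡.subst (_∈ Q) (strictlyInverseˡ i)
    (f (≡.subst (_∈ P) (≡.sym (strictlyInverseˡ i)) i∈))
    where open Inverse enumeration using (strictlyInverseˡ)

  parabolic-⊆ : ∀ {g P Q} → IsSubgroup P → IsSubgroup Q →
                ContainsConjugate P B g → ContainsConjugate Q B g →
                (∀ j → HasLetter g P j → HasLetter g Q j) → P ⊆ Q
  parabolic-⊆ {g} {P} {Q} P-sub Q-sub gP gQ letters = ⊆ᴳ⇒⊆ λ {x} x∈ →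
    ∈-resp Q (solve 2 (λ g x → g ⊙ (g ⁻ ⊙ x ⊙ g) ⊙ g ⁻ ⊜ x) ≈refl g x)
      (overgroup-⊆ (conjugated-subgroup P-sub g) (gP _) (conjugated-subgroup Q-sub g) (gQ _) letters
        (∈-resp P (solve 2 (λ g x → x ⊜ g ⊙ (g ⁻ ⊙ x ⊙ g) ⊙ g ⁻) ≈refl g x) x∈))

  ⊤-subgroup : IsSubgroup ⊤
  ⊤-subgroup = record { ε∈ = Sub.∈⊤ ; ∙∈ = λ _ _ _ _ → Sub.∈⊤ ; ⁻¹∈ = λ _ _ → Sub.∈⊤ }

  all-letters⇒⊤ : ∀ {g P} → IsSubgroup P → ContainsConjugate P B g → (∀ j → HasLetter g P j) → P ≡ ⊤
  all-letters⇒⊤ P-sub gP letters = Sub.⊆-antisym (λ _ → Sub.∈⊤)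
    (parabolic-⊆ ⊤-subgroup P-sub (λ _ _ → Sub.∈⊤) gP (λ j _ → letters j))

  missing-letter : ∀ {g P} → IsSubgroup P → ContainsConjugate P B g → P ≢ ⊤ →
                   ∃ λ j → ¬ HasLetter g P j
  missing-letter {g} {P} P-sub gP P≢⊤ = Fin.¬∀⟶∃¬ (suc ℓ) (HasLetter g P) (hasLetter? g P)
    (P≢⊤ ∘ all-letters⇒⊤ P-sub gP)

  -- Two conjugates of `B` inside `P` are conjugate by an element of `P`: `conjugator-in`, viewed
  -- from `g`, places `h ∙ g ⁻¹` in `P`, and conjugation by it carries the generators at `g` to
  -- those at `h`.
  letter-independent : ∀ {g h P} → IsSubgroup P →
                       ContainsConjugate P B g → ContainsConjugate P B h →
                       ∀ j → HasLetter g P j → HasLetter h P j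
  letter-independent {g} {h} {P} P-sub gP hP j p = 𝐏.closed-≈
    (solve 3 (λ g h s →
        (g ⊙ (g ⁻ ⊙ h) ⊙ g ⁻) ⊙ (g ⊙ s ⊙ g ⁻) ⊙ (g ⊙ (g ⁻ ⊙ h) ⊙ g ⁻) ⁻ ⊜ h ⊙ s ⊙ h ⁻)
      ≈refl g h (s j))
    (𝐏.closed-∙ (𝐏.closed-∙ q p) (𝐏.closed-⁻¹ q))
    where
    module 𝐏 = Subgroup (subset-subgroup P-sub)
    q : g ∙ (g ⁻¹ ∙ h) ∙ g ⁻¹ ∈ᴳ P
    q = conjugator-in (conjugated-subgroup P-sub g) (gP _) λ {b} b∈ → 𝐏.closed-≈
      (solve 3 (λ g h b → h ⊙ b ⊙ h ⁻ ⊜ g ⊙ ((g ⁻ ⊙ h) ⊙ b ⊙ (g ⁻ ⊙ h) ⁻) ⊙ g ⁻) ≈refl g h b)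
          (hP b b∈)

  conjugate-contains : ∀ {P} → B ⊆ P → ∀ g → ContainsConjugate (conjugate g P) B g
  conjugate-contains B⊆P g b b∈ = conj∈-conjugate⁺ (B⊆P b∈)

  -- The vertex of type `j` of the chamber of `g`: the parabolic over that chamber that lacks the
  -- single letter `j`.
  ℳ : Carrier → Fin (suc ℓ) → Subset order
  ℳ g j = conjugate g (proj₁ (omitting j))

  module _ (g : Carrier) (j : Fin (suc ℓ)) where
    private
      omits = proj₂ (omitting j)

    ℳ-subgroup : IsSubgroup (ℳ g j)
    ℳ-subgroup = conjugate-subgroup (proj₁ omits)

    ℳ-contains : ContainsConjugate (ℳ g j) B g
    ℳ-contains = conjugate-contains (proj₁ (proj₂ omits)) g

    ℳ-letter⁺ : ∀ {k} → k ≢ j → HasLetter g (ℳ g j) k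
    ℳ-letter⁺ {k} k≢j = conj∈-conjugate⁺ (≡.subst (λ k → s k ∈ᴳ proj₁ (omitting j))
      (Fin.punchIn-punchOut (k≢j ∘ ≡.sym)) (proj₁ (proj₂ (proj₂ omits)) (punchOut (k≢j ∘ ≡.sym))))

    ℳ-letter⁻ : ¬ HasLetter g (ℳ g j) j
    ℳ-letter⁻ p = proj₂ (proj₂ (proj₂ omits)) (conj∈-conjugate⁻ p)

    ℳ-proper : ProperParabolic T (ℳ g j)
    ℳ-proper = ℳ-subgroup
      , (λ eq → ℳ-letter⁻ (≡.subst (to (g ∙ s j ∙ g ⁻¹) ∈_) (≡.sym eq) Sub.∈⊤))
      , g , ℳ-contains

    ⊆ℳ : ∀ {P} → IsSubgroup P → ContainsConjugate P B g → ¬ HasLetter g P j → P ⊆ ℳ g j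
    ⊆ℳ P-sub gP j∉ = parabolic-⊆ P-sub ℳ-subgroup gP ℳ-contains
      λ k k∈ → ℳ-letter⁺ λ { ≡.refl → j∉ k∈ }

    ℳ-maximal : MaximalParabolic T (ℳ g j)
    ℳ-maximal = ℳ-proper , λ Q (Q-sub , Q≢⊤ , _) ℳ⊆Q →
      let gQ : ContainsConjugate Q B g
          gQ = λ b b∈ → ℳ⊆Q (ℳ-contains b b∈)
      -- A proper `Q` cannot gain the letter `j`, since it would then have all letters.
      in Sub.⊆-antisym ℳ⊆Q (⊆ℳ Q-sub gQ λ j∈ → Q≢⊤ (all-letters⇒⊤ Q-sub gQ λ k →
           [ (λ { ≡.refl → j∈ }) , (λ k≢j → ℳ⊆Q (ℳ-letter⁺ k≢j)) ]′ (toSum (k Fin.≟ j))))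

  -- Vertices of the building and their types

  open SetFamily (building T)

  parabolic : Fin #Ver → Subset order
  parabolic = List.lookup (maximalParabolics T)

  parabolic-maximal : ∀ v → MaximalParabolic T (parabolic v)
  parabolic-maximal v = proj₂ (List.∈-filter⁻ (maximalParabolic? T) {xs = allSubsets order}
      (List.∈-lookup v))

  parabolic-subgroup : ∀ v → IsSubgroup (parabolic v)
  parabolic-subgroup v = proj₁ (proj₁ (parabolic-maximal v))

  parabolic-injective : ∀ {u v} → parabolic u ≡ parabolic v → u ≡ v
  parabolic-injective = lookup-injective (ListUnique.filter⁺ (maximalParabolic? T)
      (allSubsets-unique order))

  abstract
    vertex-of : ∀ {M} → MaximalParabolic T M → ∃ λ v → parabolic v ≡ M
    vertex-of {M} M-max = Any.index M∈ , ≡.sym (Any.lookup-index M∈)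
      where
      M∈ : M List.∈ maximalParabolics T
      M∈ = List.∈-filter⁺ (maximalParabolic? T) (∈-allSubsets M) M-max

  ∈-verticesOf⁺ : ∀ P {v} → P ⊆ parabolic v → v ∈ verticesOf T P
  ∈-verticesOf⁺ P P⊆ = ∈-tabulate⁺ (λ v → P Sub.⊆? parabolic v) λ {_} → P⊆

  ∈-verticesOf⁻ : ∀ P {v} → v ∈ verticesOf T P → P ⊆ parabolic v
  ∈-verticesOf⁻ P v∈ = ∈-tabulate⁻ (λ v → P Sub.⊆? parabolic v) v∈

  conjugator : ∀ v → ∃ (ContainsConjugate (parabolic v) B)
  conjugator v = proj₂ (proj₂ (proj₁ (parabolic-maximal v)))

  abstract
    missing-colour : ∀ v → ∃ λ j → ¬ HasLetter (proj₁ (conjugator v)) (parabolic v) j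
    missing-colour v = missing-letter (parabolic-subgroup v) (proj₂ (conjugator v))
      (proj₁ (proj₂ (proj₁ (parabolic-maximal v))))

  -- The type of a vertex is a letter that its parabolic lacks. It is read at one chosen conjugate
  -- of `B`; by `letter-independent` the letter is lacking at all others too.
  colour : Fin #Ver → Fin (suc ℓ)
  colour v = proj₁ (missing-colour v)

  -- Lacking its colour, the parabolic is contained in the corresponding `ℳ`, and it is maximal.
  -- Hence a vertex of a chamber is determined by its colour.
  parabolic≡ℳ : ∀ {g v} → ContainsConjugate (parabolic v) B g → parabolic v ≡ ℳ g (colour v)
  parabolic≡ℳ {g} {v} gM = proj₂ (parabolic-maximal v) (ℳ g (colour v)) (ℳ-proper g (colour v))
    (⊆ℳ g (colour v) (parabolic-subgroup v) gM λ c∈ →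
      proj₂ (missing-colour v) (letter-independent (parabolic-subgroup v) gM
        (proj₂ (conjugator v)) (colour v) c∈))

  vertex : Carrier → Fin (suc ℓ) → Fin #Ver
  vertex g j = proj₁ (vertex-of (ℳ-maximal g j))

  parabolic-vertex : ∀ g j → parabolic (vertex g j) ≡ ℳ g j
  parabolic-vertex g j = proj₂ (vertex-of (ℳ-maximal g j))

  module Chamber {g P} (P-sub : IsSubgroup P) (gP : ContainsConjugate P B g) where

    vertex-contains : ∀ {v} → v ∈ verticesOf T P → ContainsConjugate (parabolic v) B g
    vertex-contains v∈ b b∈ = ∈-verticesOf⁻ P v∈ (gP b b∈)

    vertex∈ : ∀ {j} → ¬ HasLetter g P j → vertex g j ∈ verticesOf T P
    vertex∈ {j} j∉ = ∈-verticesOf⁺ P (≡.subst (P ⊆_) (≡.sym (parabolic-vertex g j))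
        (⊆ℳ g j P-sub gP j∉))

    letter∉ : ∀ {v} → v ∈ verticesOf T P → ¬ HasLetter g P (colour v)
    letter∉ {v} v∈ p = ℳ-letter⁻ g (colour v)
      (≡.subst (λ M → HasLetter g M (colour v)) (parabolic≡ℳ (vertex-contains v∈))
          (∈-verticesOf⁻ P v∈ p))

    colour-injective : ∀ {u v} → u ∈ verticesOf T P → v ∈ verticesOf T P →
                       colour u ≡ colour v → u ≡ v
    colour-injective u∈ v∈ eq = parabolic-injective (≡.trans (parabolic≡ℳ (vertex-contains u∈))
      (≡.trans (≡.cong (ℳ g) eq) (≡.sym (parabolic≡ℳ (vertex-contains v∈)))))

  colour-vertex : ∀ g j → colour (vertex g j) ≡ j
  colour-vertex g j = decidable-stable (colour v Fin.≟ j) λ c≢j →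
    ℳ-letter⁻ g (colour v) (≡.subst (λ M → HasLetter g M (colour v))
      (≡.trans (≡.sym (parabolic-vertex g j)) (parabolic≡ℳ {g} {v} gv)) (ℳ-letter⁺ g j c≢j))
    where
    v : Fin #Ver
    v = vertex g j
    gv : ContainsConjugate (parabolic v) B g
    gv = ≡.subst (λ M → ContainsConjugate M B g) (≡.sym (parabolic-vertex g j)) (ℳ-contains g j)

  B-proper : ∀ g → ProperParabolic T (conjugate g B)
  B-proper g = conjugate-subgroup B-subgroup
    , (λ eq → s∉B zero (conj∈-conjugate⁻ {g} {B}
        (≡.subst (to (g ∙ s zero ∙ g ⁻¹) ∈_) (≡.sym eq) Sub.∈⊤)))
    , g , conjugate-contains (λ {_} → id) g

  module _ (g : Carrier) where
    private
      module B = Chamber {g} (conjugate-subgroup {g} B-subgroup) (conjugate-contains (λ {_} → id) g)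

    chamber-onto : ∀ j → ∃ λ v → v ∈ verticesOf T (conjugate g B) × colour v ≡ j
    chamber-onto j = vertex g j , B.vertex∈ (s∉B j ∘ conj∈-conjugate⁻ {g} {B}) , colour-vertex g j

    ∣chamber∣ : ∣ verticesOf T (conjugate g B) ∣ ≡ suc ℓ
    ∣chamber∣ = ∣∣-bijection (verticesOf T (conjugate g B)) colour chamber-onto B.colour-injective

  conjugateB⊆ : ∀ {g P} → ContainsConjugate P B g → conjugate g B ⊆ P
  conjugateB⊆ {g} {P} gP = ⊆ᴳ⇒⊆ λ {x} x∈ →
    ∈-resp P (solve 2 (λ g x → g ⊙ (g ⁻ ⊙ x ⊙ g) ⊙ g ⁻ ⊜ x) ≈refl g x) (gP _ (∈-conjugate⁻ x∈))

  verticesOf⊆chamber : ∀ {g P} → ContainsConjugate P B g →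
                       verticesOf T P ⊆ verticesOf T (conjugate g B)
  verticesOf⊆chamber {g} {P} gP v∈ = ∈-verticesOf⁺ (conjugate g B)
      (∈-verticesOf⁻ P v∈ ∘ conjugateB⊆ {g} {P} gP)

  building-colouring : Colouring ℓ (building T)
  building-colouring = record
    { colour    = colour
    ; onto      = λ { ((P , (_ , _ , g , gP) , ≡.refl) , size) t →
        ≡.subst (λ τ → ∃ λ v → v ∈ τ × colour v ≡ t)
          -- A simplex with `suc ℓ` vertices fills the chamber that contains it.
          (≡.sym (⊆∧∣≡∣⇒≡ (verticesOf⊆chamber gP) (≡.trans size (≡.sym (∣chamber∣ g)))))
          (chamber-onto g t) }
    ; injective = λ { ((P , (P-sub , _ , g , gP) , ≡.refl) , _) →
        Chamber.colour-injective P-sub gP }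
    }

  -- Simplices as intersections of maximal parabolics

  intersection : Subset #Ver → Subset order
  intersection τ = Vec.tabulate λ i → does (Fin.all? λ v → v Sub.∈? τ →-dec i Sub.∈? parabolic v)

  module _ {τ : Subset #Ver} where
    private
      in? : Decidable (λ i → ∀ v → v ∈ τ → i ∈ parabolic v)
      in? i = Fin.all? λ v → v Sub.∈? τ →-dec i Sub.∈? parabolic v

    ∈-intersection⁺ : ∀ {i} → (∀ v → v ∈ τ → i ∈ parabolic v) → i ∈ intersection τ
    ∈-intersection⁺ = ∈-tabulate⁺ in?

    ∈-intersection⁻ : ∀ {i} → i ∈ intersection τ → ∀ v → v ∈ τ → i ∈ parabolic v
    ∈-intersection⁻ = ∈-tabulate⁻ in?

    intersection-subgroup : IsSubgroup (intersection τ)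
    intersection-subgroup = record
      { ε∈  = ∈-intersection⁺ λ v _ → IsSubgroup.ε∈ (parabolic-subgroup v)
      ; ∙∈  = λ x y p q → ∈-intersection⁺ λ v v∈ → IsSubgroup.∙∈ (parabolic-subgroup v) x y
                (∈-intersection⁻ p v v∈) (∈-intersection⁻ q v v∈)
      ; ⁻¹∈ = λ x p → ∈-intersection⁺ λ v v∈ → IsSubgroup.⁻¹∈ (parabolic-subgroup v) x
          (∈-intersection⁻ p v v∈)
      }

    -- The intersection of the parabolics in `τ` is the group sought. The point is that it acquires
    -- no vertex outside `τ`, which holds because over the chamber of `g` colours tell vertices
    -- apart.
    intersection-simplex : ∀ {g} → Nonempty τ →
                           (∀ {v} → v ∈ τ → ContainsConjugate (parabolic v) B g) → Simplex τ
    intersection-simplex {g} (u , u∈) gτ = intersection τ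
      , (intersection-subgroup , (λ eq → proj₁ (proj₂ (proj₁ (parabolic-maximal u)))
            (Sub.⊆-antisym (λ _ → Sub.∈⊤) λ {i} _ → ∈-intersection⁻
                (≡.subst (i ∈_) (≡.sym eq) Sub.∈⊤) u u∈))
          , g , gQ)
      , Sub.⊆-antisym (λ {v} v∈ → ∈-verticesOf⁺ (intersection τ) λ i∈ → ∈-intersection⁻ i∈ v v∈) ⊇
      where
      gQ : ContainsConjugate (intersection τ) B g
      gQ b b∈ = ∈-intersection⁺ λ v v∈ → gτ v∈ b b∈
      module Q = Chamber {g} intersection-subgroup gQ
      ⊇ : verticesOf T (intersection τ) ⊆ τ
      ⊇ {v} v∈ = ≡.subst (_∈ τ) (Q.colour-injective
          (∈-verticesOf⁺ (intersection τ) λ i∈ → ∈-intersection⁻ i∈ x x∈τ) v∈ colour≡) x∈τ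
        where
        -- Some member of `τ` lacks the letter `colour v`, as otherwise the intersection would have
        -- it; and a maximal parabolic over `g` lacks only the letter that is its own colour.
        witness : ∃ λ u → ¬ (u ∈ τ → HasLetter g (parabolic u) (colour v))
        witness = Fin.¬∀⟶∃¬ #Ver (λ u → u ∈ τ → HasLetter g (parabolic u) (colour v))
                      (λ u → u Sub.∈? τ →-dec hasLetter? g (parabolic u) (colour v))
                      (λ all → Q.letter∉ v∈ (∈-intersection⁺ all))
        x : Fin #Ver
        x = proj₁ witness
        x∈τ : x ∈ τ
        x∈τ = decidable-stable (x Sub.∈? τ) λ u∉ → proj₂ witness λ u∈ → contradiction u∈ u∉
        colour≡ : colour x ≡ colour v
        colour≡ = decidable-stable (colour x Fin.≟ colour v) λ ≢ → proj₂ witness λ _ →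
          ≡.subst (λ M → HasLetter g M (colour v)) (≡.sym (parabolic≡ℳ (gτ x∈τ)))
              (ℳ-letter⁺ g (colour x) (≢ ∘ ≡.sym))

  building-pure : IsPureComplex ℓ (building T)
  building-pure = record
    { nonempty  = λ { (P , (P-sub , P≢⊤ , g , gP) , ≡.refl) →
        let (j , j∉) = missing-letter P-sub gP P≢⊤ in vertex g j , Chamber.vertex∈ P-sub gP j∉ }
    ; vertex    = λ v → let (_ , _ , g , gM) = proj₁ (parabolic-maximal v) in
        intersection-simplex (v , Sub.x∈⁅x⁆ v)
          λ u∈ → ≡.subst (λ u → ContainsConjugate (parabolic u) B g) (≡.sym (Sub.x∈⁅y⁆⇒x≡y v u∈)) gM
    ; face      = λ { (P , (P-sub , _ , g , gP) , ≡.refl) τ≢∅ τ⊆ →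
        intersection-simplex τ≢∅ λ v∈ → Chamber.vertex-contains P-sub gP (τ⊆ v∈) }
    ; inhabited = _ , conjugate ε B , B-proper ε , ≡.refl
    ; pure      = λ { (P , (_ , _ , g , gP) , ≡.refl) →
        verticesOf T (conjugate g B) , ((conjugate g B , B-proper g , ≡.refl) , ∣chamber∣ g)
        , verticesOf⊆chamber gP }
    }

-- Rational numbers

open ℚ.+-*-Solver using (solve; _:+_; _:*_; _:-_; :-_; _:=_; con)

0≤1 : 0ℚ ℚ.≤ 1ℚ
0≤1 = ℚ.nonNegative⁻¹ 1ℚ

0<1 : 0ℚ ℚ.< 1ℚ
0<1 = ℚ.positive⁻¹ 1ℚ

fraction : ∀ i d → ℚ.toℚᵘ (i ℚ./ suc d) ℚᵘ.≃ mkℚᵘ i d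
fraction i d = ℚ.toℚᵘ-fromℚᵘ (mkℚᵘ i d)

suc/1 : ∀ n → + suc n ℚ./ 1 ≡ 1ℚ ℚ.+ + n ℚ./ 1
suc/1 n = ℚ.toℚᵘ-injective (ℚᵘ.≃-trans (fraction (+ suc n) 0) (ℚᵘ.≃-sym (ℚᵘ.≃-trans
  (ℚ.toℚᵘ-homo-+ 1ℚ (+ n ℚ./ 1)) (ℚᵘ.≃-trans (ℚᵘ.+-congʳ (mkℚᵘ (+ 1) 0) (fraction (+ n) 0))
  (*≡* (ℤ.+-*-Solver.solve 1 (λ n → (one :*ᶻ one :+ᶻ n :*ᶻ one) :*ᶻ one :=ᶻ (one :+ᶻ n) :*ᶻ
      (one :*ᶻ one)) ≡.refl (+ n)))))))
  where
  open ℤ.+-*-Solver using () renaming (_:*_ to _:*ᶻ_; _:+_ to _:+ᶻ_; _:=_ to _:=ᶻ_; con to conᶻ)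
  one : ∀ {n} → ℤ.+-*-Solver.Polynomial n
  one = conᶻ (+ 1)

m*k/m : ∀ m k .{{_ : NonZero m}} → (+ m ℚ./ 1) ℚ.* (+ k ℚ./ m) ≡ + k ℚ./ 1
m*k/m (suc m) k = ℚ.toℚᵘ-injective (ℚᵘ.≃-trans (ℚ.toℚᵘ-homo-* (+ suc m ℚ./ 1) (+ k ℚ./ suc m))
  (ℚᵘ.≃-trans (ℚᵘ.*-cong (fraction (+ suc m) 0) (fraction (+ k) m))
  (ℚᵘ.≃-trans (*≡* (ℤ.+-*-Solver.solve 2 (λ m k → (m :*ᶻ k) :*ᶻ conᶻ (+ 1) :=ᶻ k :*ᶻ
      (conᶻ (+ 1) :*ᶻ m)) ≡.refl (+ suc m) (+ k)))
    (ℚᵘ.≃-sym (fraction (+ k) 0)))))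
  where open ℤ.+-*-Solver using () renaming (_:*_ to _:*ᶻ_; _:=_ to _:=ᶻ_; con to conᶻ)

0≤p⇒q≤q+p : ∀ {p q} → 0ℚ ℚ.≤ p → q ℚ.≤ q ℚ.+ p
0≤p⇒q≤q+p {p} {q} 0≤p = ≡.subst (ℚ._≤ q ℚ.+ p) (ℚ.+-identityʳ q) (ℚ.+-monoʳ-≤ q 0≤p)

0≤q-p⇒p≤q : ∀ {p q} → 0ℚ ℚ.≤ q ℚ.- p → p ℚ.≤ q
0≤q-p⇒p≤q {p} {q} h = ≡.subst (p ℚ.≤_) (solve 2 (λ p q → p :+ (q :- p) := q) ≡.refl p q)
    (0≤p⇒q≤q+p h)

p≤q⇒0≤q-p : ∀ {p q} → p ℚ.≤ q → 0ℚ ℚ.≤ q ℚ.- p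
p≤q⇒0≤q-p {p} {q} h = ≡.subst (ℚ._≤ q ℚ.- p) (ℚ.+-inverseʳ p) (ℚ.+-monoˡ-≤ (ℚ.- p) h)

+-nonNeg : ∀ {p q} → 0ℚ ℚ.≤ p → 0ℚ ℚ.≤ q → 0ℚ ℚ.≤ p ℚ.+ q
+-nonNeg = ℚ.+-mono-≤

*-nonNeg : ∀ {p q} → 0ℚ ℚ.≤ p → 0ℚ ℚ.≤ q → 0ℚ ℚ.≤ p ℚ.* q
*-nonNeg {p} {q} 0≤p 0≤q =
  ℚ.nonNegative⁻¹ _ {{ℚ.nonNeg*nonNeg⇒nonNeg p {{ℚ.nonNegative 0≤p}} q {{ℚ.nonNegative 0≤q}}}}

*-pos : ∀ {p q} → 0ℚ ℚ.< p → 0ℚ ℚ.< q → 0ℚ ℚ.< p ℚ.* q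
*-pos {p} {q} 0<p 0<q =
  ℚ.positive⁻¹ _ {{ℚ.pos*pos⇒pos p {{ℚ.positive 0<p}} q {{ℚ.positive 0<q}}}}

p≤∣p∣ : ∀ p → p ℚ.≤ ℚ.∣ p ∣
p≤∣p∣ p with ℚ.∣p∣≡p∨∣p∣≡-p p
... | inj₁ eq = ℚ.≤-reflexive (≡.sym eq)
... | inj₂ eq = 0≤q-p⇒p≤q (≡.subst (0ℚ ℚ.≤_)
  (≡.cong (ℚ.∣ p ∣ ℚ.+_) eq) (+-nonNeg (ℚ.0≤∣p∣ p) (ℚ.0≤∣p∣ p)))

-p≤∣p∣ : ∀ p → ℚ.- p ℚ.≤ ℚ.∣ p ∣
-p≤∣p∣ p = ≡.subst (ℚ.- p ℚ.≤_) (ℚ.∣-p∣≡∣p∣ p) (p≤∣p∣ (ℚ.- p))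

∣p∣²≡p² : ∀ p → ℚ.∣ p ∣ ℚ.* ℚ.∣ p ∣ ≡ p ℚ.* p
∣p∣²≡p² p with ℚ.∣p∣≡p∨∣p∣≡-p p
... | inj₁ eq = ≡.cong₂ ℚ._*_ eq eq
... | inj₂ eq = ≡.trans (≡.cong₂ ℚ._*_ eq eq) (solve 1 (λ p → (:- p) :* (:- p) := p :* p) ≡.refl p)

0≤p² : ∀ p → 0ℚ ℚ.≤ p ℚ.* p
0≤p² p = ≡.subst (0ℚ ℚ.≤_) (∣p∣²≡p² p) (*-nonNeg (ℚ.0≤∣p∣ p) (ℚ.0≤∣p∣ p))

p²<ε²⇒∣p∣<ε : ∀ {p ε} → 0ℚ ℚ.< ε → p ℚ.* p ℚ.< ε ℚ.* ε → ℚ.∣ p ∣ ℚ.< ε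
p²<ε²⇒∣p∣<ε {p} {ε} 0<ε p²<ε² = ℚ.≰⇒> λ ε≤∣p∣ → ℚ.<-irrefl ≡.refl
    (ℚ.<-≤-trans p²<ε² (≡.subst (ε ℚ.* ε ℚ.≤_) (∣p∣²≡p² p)
  (ℚ.≤-trans (ℚ.*-monoˡ-≤-nonNeg ε {{ℚ.nonNegative (ℚ.<⇒≤ 0<ε)}} ε≤∣p∣)
             (ℚ.*-monoʳ-≤-nonNeg ℚ.∣ p ∣ {{ℚ.nonNegative (ℚ.0≤∣p∣ p)}} ε≤∣p∣))))

0≤n/1 : ∀ n → 0ℚ ℚ.≤ + n ℚ./ 1
0≤n/1 n = ℚ.nonNegative⁻¹ (+ n ℚ./ 1) {{ℚ.normalize-nonNeg n 1}}

1≤n/1 : ∀ n .{{_ : NonZero n}} → 1ℚ ℚ.≤ + n ℚ./ 1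
1≤n/1 (suc n) = ≡.subst (1ℚ ℚ.≤_) (≡.sym (suc/1 n)) (0≤p⇒q≤q+p (0≤n/1 n))

-- The cochain δ h on the full simplex with vertices 0, …, m − 1, where h is
-- the Vandermonde determinant; being coclosed, it is an eigenvector there.
module Vandermonde (m : ℕ) where
  open FiniteSums (CommutativeRing.commutativeSemiring ℚ.+-*-commutativeRing)
  open ChamberAlgebra ℚ.+-*-commutativeRing using (sgnᵖ; ⨁-neg)
  open ≡.≡-Reasoning

  T : List (Fin m)
  T = List.allFin m

  node : Fin m → ℚ
  node t = toℕ t · 1ℚ

  differences : ∀ {k} → Fin m → Vec (Fin m) k → ℚ
  differences x []       = 1ℚ
  differences x (y ∷ ys) = (node x ℚ.- node y) ℚ.* differences x ys

  vandermonde : ∀ {k} → Vec (Fin m) k → ℚ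
  vandermonde []       = 1ℚ
  vandermonde (x ∷ xs) = differences x xs ℚ.* vandermonde xs

  sgnᵖ-+ : ∀ p q → sgnᵖ (p ℙ.+ q) ≡ sgnᵖ q ℚ.* sgnᵖ p
  sgnᵖ-+ 0ℙ 0ℙ = ≡.refl
  sgnᵖ-+ 0ℙ 1ℙ = ≡.refl
  sgnᵖ-+ 1ℙ 0ℙ = ≡.refl
  sgnᵖ-+ 1ℙ 1ℙ = ≡.refl

  differences-~ : ∀ {k p} {ys zs : Vec (Fin m) k} x → ys ~[ p ] zs →
                  differences x zs ≡ differences x ys
  differences-~ x ~refl = ≡.refl
  differences-~ x (~swap y z {ys}) = solve 4 (λ x y z d →
      (x :- z) :* ((x :- y) :* d) := (x :- y) :* ((x :- z) :* d))
    ≡.refl (node x) (node y) (node z) (differences x ys)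
  differences-~ x (~prep y r)  = ≡.cong ((node x ℚ.- node y) ℚ.*_) (differences-~ x r)
  differences-~ x (~trans r s) = ≡.trans (differences-~ x s) (differences-~ x r)

  vandermonde-~ : ∀ {k p} {xs ys : Vec (Fin m) k} → xs ~[ p ] ys →
                  vandermonde ys ≡ sgnᵖ p ℚ.* vandermonde xs
  vandermonde-~ ~refl = ≡.sym (ℚ.*-identityˡ _)
  vandermonde-~ (~swap x y {xs}) = solve 5 (λ x y c d v →
      ((y :- x) :* d) :* (c :* v) := con (ℚ.- 1ℚ) :* (((x :- y) :* c) :* (d :* v)))
    ≡.refl (node x) (node y) (differences x xs) (differences y xs) (vandermonde xs)
  vandermonde-~ (~prep x {p} {xs} {ys} r) = begin
    differences x ys ℚ.* vandermonde ys
        ≡⟨ ≡.cong₂ ℚ._*_ (differences-~ x r) (vandermonde-~ r) ⟩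
    differences x xs ℚ.* (sgnᵖ p ℚ.* vandermonde xs)
        ≡⟨ solve 3 (λ d s v → d :* (s :* v) := s :* (d :* v)) ≡.refl (differences x xs) (sgnᵖ p)
            (vandermonde xs) ⟩
    sgnᵖ p ℚ.* (differences x xs ℚ.* vandermonde xs) ∎
  vandermonde-~ (~trans {p = p} {q} {xs} {ys} {zs} r s) = begin
    vandermonde zs                          ≡⟨ vandermonde-~ s ⟩
    sgnᵖ q ℚ.* vandermonde ys               ≡⟨ ≡.cong (sgnᵖ q ℚ.*_) (vandermonde-~ r) ⟩
    sgnᵖ q ℚ.* (sgnᵖ p ℚ.* vandermonde xs)  ≡⟨ ℚ.*-assoc (sgnᵖ q) (sgnᵖ p) _ ⟨
    sgnᵖ q ℚ.* sgnᵖ p ℚ.* vandermonde xs    ≡⟨ ≡.cong (ℚ._* vandermonde xs) (sgnᵖ-+ p q) ⟨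
    sgnᵖ (p ℙ.+ q) ℚ.* vandermonde xs       ∎

  differences-zero : ∀ {k} (ys : Vec (Fin m) k) j → differences (Vec.lookup ys j) ys ≡ 0ℚ
  differences-zero (y ∷ ys) zero    = ≡.trans (≡.cong (ℚ._* differences y ys)
      (ℚ.+-inverseʳ (node y))) (ℚ.*-zeroˡ (differences y ys))
  differences-zero (y ∷ ys) (suc j) = ≡.trans
    (≡.cong ((node (Vec.lookup ys j) ℚ.- node y) ℚ.*_) (differences-zero ys j))
        (ℚ.*-zeroʳ (node (Vec.lookup ys j) ℚ.- node y))

  vandermonde-repetition : ∀ {k} {xs : Vec (Fin m) k} → ¬ Unique xs → vandermonde xs ≡ 0ℚ
  vandermonde-repetition {xs = []} ¬xs! = contradiction [] ¬xs!
  vandermonde-repetition {xs = x ∷ xs} ¬xs! with Fin.any? (λ j → x Fin.≟ Vec.lookup xs j)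
  ... | yes (j , ≡.refl) = ≡.trans (≡.cong (ℚ._* vandermonde xs) (differences-zero xs j))
      (ℚ.*-zeroˡ (vandermonde xs))
  ... | no none = ≡.trans (≡.cong (differences x xs ℚ.*_)
        (vandermonde-repetition λ xs! → ¬xs! (VecAll.lookup⁻ (λ j eq → none (j , eq)) ∷ xs!)))
      (ℚ.*-zeroʳ (differences x xs))

  coclosed : ∀ {k} → Vec (Fin m) k → ℚ
  coclosed xs = ⨁ T (λ t → vandermonde (t ∷ xs))

  coclosed-~ : ∀ {k p} {xs ys : Vec (Fin m) k} → xs ~[ p ] ys → coclosed ys ≡ sgnᵖ p ℚ.* coclosed xs
  coclosed-~ {p = p} r = ≡.trans (⨁-cong T (λ t → vandermonde-~ (~prep t r)))
      (≡.sym (*-⨁ (sgnᵖ p) T _))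

  coclosed-repetition : ∀ {k} {xs : Vec (Fin m) k} → ¬ Unique xs → coclosed xs ≡ 0ℚ
  coclosed-repetition {xs = xs} ¬xs! = ≡.trans (⨁-cong T
      (λ t → vandermonde-repetition {xs = t ∷ xs} λ { (_ ∷ xs!) → ¬xs! xs! })) (⨁-zero T)

  -- This is δδ = 0: exchanging the two summation variables changes the sign of the determinant.
  div-coclosed : ∀ {k} (xs : Vec (Fin m) k) → ⨁ T (λ t → coclosed (t ∷ xs)) ≡ 0ℚ
  div-coclosed xs = begin
    S                  ≡⟨ solve 1 (λ s → s := con ½ :* (s :+ s)) ≡.refl S ⟩
    ½ ℚ.* (S ℚ.+ S)    ≡⟨ ≡.cong (λ t → ½ ℚ.* (S ℚ.+ t)) S≡-S ⟩
    ½ ℚ.* (S ℚ.- S)    ≡⟨ ≡.cong (½ ℚ.*_) (ℚ.+-inverseʳ S) ⟩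
    ½ ℚ.* 0ℚ           ≡⟨⟩
    0ℚ                 ∎
    where
    S = ⨁ T (λ t → ⨁ T (λ u → vandermonde (u ∷ t ∷ xs)))
    S≡-S : S ≡ ℚ.- S
    S≡-S = begin
      S
        ≡⟨ ⨁-cong T (λ t → ⨁-cong T (λ u → ≡.trans (vandermonde-~ (~swap t u {xs}))
             (solve 1 (λ v → con (ℚ.- 1ℚ) :* v := :- v) ≡.refl _))) ⟩
      ⨁ T (λ t → ⨁ T (λ u → ℚ.- vandermonde (t ∷ u ∷ xs)))
        ≡⟨ ≡.trans (⨁-cong T (λ t → ⨁-neg T _)) (⨁-neg T _) ⟩
      ℚ.- ⨁ T (λ t → ⨁ T (λ u → vandermonde (t ∷ u ∷ xs)))
        ≡⟨ ≡.cong ℚ.-_ (⨁-comm T T _) ⟩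
      ℚ.- S ∎

  ·1-nonNeg : ∀ n → 0ℚ ℚ.≤ n · 1ℚ
  ·1-nonNeg zero    = ℚ.≤-refl
  ·1-nonNeg (suc n) = +-nonNeg 0≤1 (·1-nonNeg n)

  ·1-mono-< : ∀ {j k} → j ℕ.< k → j · 1ℚ ℚ.< k · 1ℚ
  ·1-mono-< {zero}  {suc k} _           = ℚ.+-mono-<-≤ 0<1 (·1-nonNeg k)
  ·1-mono-< {suc j} {suc k} (ℕ.s≤s j<k) = ℚ.+-monoʳ-< 1ℚ (·1-mono-< j<k)

  node-<⇒0<- : ∀ {x y} → toℕ y ℕ.< toℕ x → 0ℚ ℚ.< node x ℚ.- node y
  node-<⇒0<- {x} {y} y<x = ≡.subst (ℚ._< node x ℚ.- node y) (ℚ.+-inverseʳ (node y))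
    (ℚ.+-monoˡ-< (ℚ.- node y) (·1-mono-< y<x))

  differences-pos : ∀ {k x} (ys : Vec (Fin m) k) →
                    (∀ j → toℕ (Vec.lookup ys j) ℕ.< toℕ x) → 0ℚ ℚ.< differences x ys
  differences-pos         []       _   = 0<1
  differences-pos {x = x} (y ∷ ys) ys< = *-pos (node-<⇒0<- {x} {y} (ys< zero))
      (differences-pos ys (ys< ∘ suc))

  ≢0*≢0 : ∀ {p q} → p ≢ 0ℚ → q ≢ 0ℚ → p ℚ.* q ≢ 0ℚ
  ≢0*≢0 {p} {q} p≢0 q≢0 pq≡0 = q≢0 (begin
    q                      ≡⟨ ℚ.*-identityˡ q ⟨
    1ℚ ℚ.* q               ≡⟨ ≡.cong (ℚ._* q) (ℚ.*-inverseˡ p {{ℚ.≢-nonZero p≢0}}) ⟨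
    p⁻¹ ℚ.* p ℚ.* q        ≡⟨ ℚ.*-assoc p⁻¹ p q ⟩
    p⁻¹ ℚ.* (p ℚ.* q)      ≡⟨ ≡.cong (p⁻¹ ℚ.*_) pq≡0 ⟩
    p⁻¹ ℚ.* 0ℚ             ≡⟨ ℚ.*-zeroʳ p⁻¹ ⟩
    0ℚ                     ∎)
    where p⁻¹ = (ℚ.1/ p) {{ℚ.≢-nonZero p≢0}}

  differences-≢0 : ∀ {k x} {ys : Vec (Fin m) k} → VecAll.All (x ≢_) ys → differences x ys ≢ 0ℚ
  differences-≢0 [] ()
  differences-≢0 {x = x} {y ∷ ys} (x≢y ∷ x∉) = ≢0*≢0 node≢ (differences-≢0 x∉)
    where
    node≢ : node x ℚ.- node y ≢ 0ℚ
    node≢ eq with ℕ.<-cmp (toℕ x) (toℕ y)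
    ... | tri< x<y _ _ = ℚ.<⇒≢ (node-<⇒0<- {y} {x} x<y)
      (≡.sym (≡.trans (solve 2 (λ x y → y :- x := :- (x :- y)) ≡.refl (node x) (node y))
          (≡.cong ℚ.-_ eq)))
    ... | tri≈ _ x≡y _ = x≢y (Fin.toℕ-injective x≡y)
    ... | tri> _ _ y<x = ℚ.<⇒≢ (node-<⇒0<- {x} {y} y<x) (≡.sym eq)

  vandermonde-≢0 : ∀ {k} {xs : Vec (Fin m) k} → Unique xs → vandermonde xs ≢ 0ℚ
  vandermonde-≢0 [] ()
  vandermonde-≢0 (x∉ ∷ xs!) = ≢0*≢0 (differences-≢0 x∉) (vandermonde-≢0 xs!)

  nonNeg-⨁ : ∀ {a} {A : Set a} {f : A → ℚ} → (∀ x → 0ℚ ℚ.≤ f x) → ∀ xs → 0ℚ ℚ.≤ ⨁ xs f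
  nonNeg-⨁ 0≤f []       = ℚ.≤-refl
  nonNeg-⨁ 0≤f (x ∷ xs) = +-nonNeg (0≤f x) (nonNeg-⨁ 0≤f xs)

  pos-⨁ : ∀ {a} {A : Set a} {f : A → ℚ} {x xs} → (∀ x → 0ℚ ℚ.≤ f x) →
          x List.∈ xs → 0ℚ ℚ.< f x → 0ℚ ℚ.< ⨁ xs f
  pos-⨁ {xs = _ ∷ xs} 0≤f (here ≡.refl) 0<fx = ℚ.+-mono-<-≤ 0<fx (nonNeg-⨁ 0≤f xs)
  pos-⨁ {xs = x ∷ _}  0≤f (there x∈)    0<fx = ℚ.+-mono-≤-< (0≤f x) (pos-⨁ 0≤f x∈ 0<fx)

  module _ {k : ℕ} (k<m : k ℕ.< m) where

    -- The tuple (0, ..., k - 1). The strict inequality `k < m` leaves a further node `t = k`, at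
    -- which the sum defining `coclosed` has a nonzero term.
    initial : Vec (Fin m) k
    initial = Vec.tabulate (λ j → Fin.inject≤ j (ℕ.<⇒≤ k<m))

    lookup-initial : ∀ j → Vec.lookup initial j ≡ Fin.inject≤ j (ℕ.<⇒≤ k<m)
    lookup-initial = Vec.lookup∘tabulate _

    differences-initial-pos : ∀ x → k ℕ.≤ toℕ x → 0ℚ ℚ.< differences x initial
    differences-initial-pos x k≤x = differences-pos initial λ j → ≡.subst (ℕ._< toℕ x)
      (≡.sym (≡.trans (≡.cong toℕ (lookup-initial j)) (Fin.toℕ-inject≤ j _)))
          (ℕ.<-≤-trans (Fin.toℕ<n j) k≤x)

    differences-initial-nonNeg : ∀ x → 0ℚ ℚ.≤ differences x initial
    differences-initial-nonNeg x with toℕ x ℕ.<? k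
    ... | no x≮k  = ℚ.<⇒≤ (differences-initial-pos x (ℕ.≮⇒≥ x≮k))
    ... | yes x<k = ℚ.≤-reflexive (≡.sym (≡.subst (λ x → differences x initial ≡ 0ℚ)
            (≡.trans (lookup-initial (Fin.fromℕ< x<k)) (Fin.toℕ-injective
              (≡.trans (Fin.toℕ-inject≤ _ _) (Fin.toℕ-fromℕ< x<k))))
            (differences-zero initial (Fin.fromℕ< x<k))))

    initial-unique : Unique initial
    initial-unique = Unique.tabulate⁺ (Fin.inject≤-injective _ _ _ _)

    -- The terms of ∑ₜ ∏ⱼ (t − j) are nonnegative, and positive for t = k.
    coclosed-initial-≢0 : coclosed initial ≢ 0ℚ
    -- The factor `vandermonde initial` is common to all `t` and comes out of the sum.
    coclosed-initial-≢0 eq = ≢0*≢0 (ℚ.<⇒≢ 0<∑ ∘ ≡.sym) (vandermonde-≢0 initial-unique)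
      (≡.trans (⨁-* T (λ t → differences t initial) (vandermonde initial)) eq)
      where
      0<∑ : 0ℚ ℚ.< ⨁ T (λ t → differences t initial)
      0<∑ = pos-⨁ differences-initial-nonNeg (List.∈-allFin (Fin.fromℕ< k<m))
        (differences-initial-pos (Fin.fromℕ< k<m) (ℕ.≤-reflexive (≡.sym (Fin.toℕ-fromℕ< k<m))))

-- Real numbers

-- _≈ℝ_ unfolds to a function type, from which the two reals cannot be inferred.
infix 4 _≃_
record _≃_ (x y : ℝ) : Set where
  constructor ⟪_⟫
  field ≃⇒≈ℝ : x ≈ℝ y
open _≃_ public

≗⇒≃ : ∀ x y → (∀ n → seq x n ≡ seq y n) → x ≃ y
≗⇒≃ x y x≗y = ⟪ (λ ε 0<ε → 0 , λ n _ →
  ≡.subst (ℚ._< ε) (≡.sym (≡.trans (≡.cong (λ t → ℚ.∣ t ℚ.- seq y n ∣) (x≗y n))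
                                   (≡.cong ℚ.∣_∣ (ℚ.+-inverseʳ (seq y n))))) 0<ε) ⟫

≃-sym : ∀ {x y} → x ≃ y → y ≃ x
≃-sym {x} {y} ⟪ p ⟫ = ⟪ (λ ε 0<ε → let (N , h) = p ε 0<ε in N , λ n N≤n →
  ≡.subst (ℚ._< ε) (≡.trans (≡.sym (ℚ.∣-p∣≡∣p∣ (seq x n ℚ.- seq y n)))
    (≡.cong ℚ.∣_∣ (solve 2 (λ a b → :- (a :- b) := b :- a) ≡.refl (seq x n) (seq y n))))
    (h n N≤n)) ⟫

≃-trans : ∀ {x y z} → x ≃ y → y ≃ z → x ≃ z
≃-trans {x} {y} {z} ⟪ p ⟫ ⟪ q ⟫ = ⟪ (λ ε 0<ε →
  let (N₁ , h₁) = p (½ ℚ.* ε) (half-pos 0<ε)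
      (N₂ , h₂) = q (½ ℚ.* ε) (half-pos 0<ε)
  in N₁ ℕ.⊔ N₂ , λ n N≤n → ≡.subst (λ t → ℚ.∣ t ∣ ℚ.< ε)
       (solve 3 (λ a b c → (a :- b) :+ (b :- c) := a :- c) ≡.refl (seq x n) (seq y n) (seq z n))
       (sum-< (h₁ n (ℕ.m⊔n≤o⇒m≤o N₁ N₂ N≤n)) (h₂ n (ℕ.m⊔n≤o⇒n≤o N₁ N₂ N≤n)))) ⟫

-- The operations are opaque, since comparing two reals by unfolding them
-- would compare the proofs that their sequences are Cauchy.
opaque
  infixl 6 _⊕_
  infixl 7 _⊗_
  infix  8 ⊝_

  rat : ℚ → ℝ
  rat = fromℚ

  _⊕_ _⊗_ : ℝ → ℝ → ℝ
  _⊕_ = _+ℝ_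
  _⊗_ = _*ℝ_

  ⊝_ : ℝ → ℝ
  ⊝_ = -ℝ_

opaque
  unfolding rat

  rat≡ : ∀ q → rat q ≡ fromℚ q
  rat≡ _ = ≡.refl

  ⊕≡ : ∀ x y → x ⊕ y ≡ x +ℝ y
  ⊕≡ _ _ = ≡.refl

  ⊗≡ : ∀ x y → x ⊗ y ≡ x *ℝ y
  ⊗≡ _ _ = ≡.refl

  ⊝≡ : ∀ x → ⊝ x ≡ -ℝ x
  ⊝≡ _ = ≡.refl

  seq-rat : ∀ q n → seq (rat q) n ≡ q
  seq-rat _ _ = ≡.refl

  seq-⊕ : ∀ x y n → seq (x ⊕ y) n ≡ seq x n ℚ.+ seq y n
  seq-⊕ _ _ _ = ≡.refl

  seq-⊗ : ∀ x y n → seq (x ⊗ y) n ≡ seq x n ℚ.* seq y n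
  seq-⊗ _ _ _ = ≡.refl

  seq-⊝ : ∀ x n → seq (⊝ x) n ≡ ℚ.- seq x n
  seq-⊝ _ _ = ≡.refl

  ⊕-cong : ∀ {x x′ y y′} → x ≃ x′ → y ≃ y′ → x ⊕ y ≃ x′ ⊕ y′
  ⊕-cong {x} {x′} {y} {y′} ⟪ p ⟫ ⟪ q ⟫ = ⟪ (λ ε 0<ε →
    let (N₁ , h₁) = p (½ ℚ.* ε) (half-pos 0<ε)
        (N₂ , h₂) = q (½ ℚ.* ε) (half-pos 0<ε)
    in N₁ ℕ.⊔ N₂ , λ n N≤n → ≡.subst (λ t → ℚ.∣ t ∣ ℚ.< ε)
         (solve 4 (λ a a′ b b′ → (a :- a′) :+ (b :- b′) := (a :+ b) :- (a′ :+ b′)) ≡.refl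
           (seq x n) (seq x′ n) (seq y n) (seq y′ n))
         (sum-< (h₁ n (ℕ.m⊔n≤o⇒m≤o N₁ N₂ N≤n)) (h₂ n (ℕ.m⊔n≤o⇒n≤o N₁ N₂ N≤n)))) ⟫

  ⊝-cong : ∀ {x y} → x ≃ y → ⊝ x ≃ ⊝ y
  ⊝-cong {x} {y} ⟪ p ⟫ = ⟪ (λ ε 0<ε → let (N , h) = p ε 0<ε in N , λ n N≤n →
    ≡.subst (ℚ._< ε) (≡.trans (≡.sym (ℚ.∣-p∣≡∣p∣ (seq x n ℚ.- seq y n)))
      (≡.cong ℚ.∣_∣ (solve 2 (λ a b → :- (a :- b) := (:- a) :- (:- b)) ≡.refl (seq x n) (seq y n))))
      (h n N≤n)) ⟫

  ⊗-cong : ∀ {x x′ y y′} → x ≃ x′ → y ≃ y′ → x ⊗ y ≃ x′ ⊗ y′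
  ⊗-cong {x} {x′} {y} {y′} ⟪ p ⟫ ⟪ q ⟫ = ⟪ (λ ε 0<ε →
    let (Mx , Bx , 0<Mx , bx) = bounded (cauchy x)
        (My , By , 0<My , by) = bounded (cauchy y′)
        (ηx , 0<ηx , px)      = product-small 0<Mx (half-pos 0<ε)
        (ηy , 0<ηy , py)      = product-small 0<My (half-pos 0<ε)
        (N₁ , h₁)             = q ηx 0<ηx
        (N₂ , h₂)             = p ηy 0<ηy
    in (Bx ℕ.⊔ By) ℕ.⊔ (N₁ ℕ.⊔ N₂) , λ n N≤n →
       let B≤n = ℕ.m⊔n≤o⇒m≤o (Bx ℕ.⊔ By) (N₁ ℕ.⊔ N₂) N≤n
           H≤n = ℕ.m⊔n≤o⇒n≤o (Bx ℕ.⊔ By) (N₁ ℕ.⊔ N₂) N≤n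
       in ≡.subst (λ t → ℚ.∣ t ∣ ℚ.< ε)
         (solve 4 (λ a a′ b b′ → a :* (b :- b′) :+ b′ :* (a :- a′) := a :* b :- a′ :* b′) ≡.refl
           (seq x n) (seq x′ n) (seq y n) (seq y′ n))
         (sum-< (px (seq x n) (seq y n ℚ.- seq y′ n) (bx n (ℕ.m⊔n≤o⇒m≤o Bx By B≤n))
                    (h₁ n (ℕ.m⊔n≤o⇒m≤o N₁ N₂ H≤n)))
                (py (seq y′ n) (seq x n ℚ.- seq x′ n) (by n (ℕ.m⊔n≤o⇒n≤o Bx By B≤n))
                    (h₂ n (ℕ.m⊔n≤o⇒n≤o N₁ N₂ H≤n))))) ⟫

  ⊕-assoc : ∀ x y z → x ⊕ y ⊕ z ≃ x ⊕ (y ⊕ z)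
  ⊕-assoc x y z = ≗⇒≃ (x ⊕ y ⊕ z) (x ⊕ (y ⊕ z)) λ n → ℚ.+-assoc (seq x n) (seq y n) (seq z n)

  ⊕-identityˡ : ∀ x → rat 0ℚ ⊕ x ≃ x
  ⊕-identityˡ x = ≗⇒≃ (rat 0ℚ ⊕ x) x λ n → ℚ.+-identityˡ (seq x n)

  ⊕-identityʳ : ∀ x → x ⊕ rat 0ℚ ≃ x
  ⊕-identityʳ x = ≗⇒≃ (x ⊕ rat 0ℚ) x λ n → ℚ.+-identityʳ (seq x n)

  ⊕-inverseˡ : ∀ x → ⊝ x ⊕ x ≃ rat 0ℚ
  ⊕-inverseˡ x = ≗⇒≃ (⊝ x ⊕ x) (rat 0ℚ) λ n → ℚ.+-inverseˡ (seq x n)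

  ⊕-inverseʳ : ∀ x → x ⊕ ⊝ x ≃ rat 0ℚ
  ⊕-inverseʳ x = ≗⇒≃ (x ⊕ ⊝ x) (rat 0ℚ) λ n → ℚ.+-inverseʳ (seq x n)

  ⊕-comm : ∀ x y → x ⊕ y ≃ y ⊕ x
  ⊕-comm x y = ≗⇒≃ (x ⊕ y) (y ⊕ x) λ n → ℚ.+-comm (seq x n) (seq y n)

  ⊗-assoc : ∀ x y z → x ⊗ y ⊗ z ≃ x ⊗ (y ⊗ z)
  ⊗-assoc x y z = ≗⇒≃ (x ⊗ y ⊗ z) (x ⊗ (y ⊗ z)) λ n → ℚ.*-assoc (seq x n) (seq y n) (seq z n)

  ⊗-identityˡ : ∀ x → rat 1ℚ ⊗ x ≃ x
  ⊗-identityˡ x = ≗⇒≃ (rat 1ℚ ⊗ x) x λ n → ℚ.*-identityˡ (seq x n)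

  ⊗-identityʳ : ∀ x → x ⊗ rat 1ℚ ≃ x
  ⊗-identityʳ x = ≗⇒≃ (x ⊗ rat 1ℚ) x λ n → ℚ.*-identityʳ (seq x n)

  ⊗-distribˡ-⊕ : ∀ x y z → x ⊗ (y ⊕ z) ≃ x ⊗ y ⊕ x ⊗ z
  ⊗-distribˡ-⊕ x y z = ≗⇒≃ (x ⊗ (y ⊕ z)) (x ⊗ y ⊕ x ⊗ z) λ n → ℚ.*-distribˡ-+ (seq x n) (seq y n)
      (seq z n)

  ⊗-distribʳ-⊕ : ∀ x y z → (y ⊕ z) ⊗ x ≃ y ⊗ x ⊕ z ⊗ x
  ⊗-distribʳ-⊕ x y z = ≗⇒≃ ((y ⊕ z) ⊗ x) (y ⊗ x ⊕ z ⊗ x) λ n → ℚ.*-distribʳ-+ (seq x n) (seq y n)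
      (seq z n)

  ⊗-comm : ∀ x y → x ⊗ y ≃ y ⊗ x
  ⊗-comm x y = ≗⇒≃ (x ⊗ y) (y ⊗ x) λ n → ℚ.*-comm (seq x n) (seq y n)

ℝ-commutativeRing : CommutativeRing 0ℓ 0ℓ
ℝ-commutativeRing = record
  { Carrier = ℝ ; _≈_ = _≃_ ; _+_ = _⊕_ ; _*_ = _⊗_ ; -_ = ⊝_ ; 0# = rat 0ℚ ; 1# = rat 1ℚ
  ; isCommutativeRing = record
    { isRing = record
      { +-isAbelianGroup = record
        { isGroup = record
          { isMonoid = record
            { isSemigroup = record
              { isMagma = record
                { isEquivalence = record
                  { refl = λ {x} → ≗⇒≃ x x λ _ → ≡.refl ; sym = ≃-sym ; trans = ≃-trans }
                ; ∙-cong = ⊕-cong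
                }
              ; assoc = ⊕-assoc
              }
            ; identity = ⊕-identityˡ , ⊕-identityʳ
            }
          ; inverse = ⊕-inverseˡ , ⊕-inverseʳ
          ; ⁻¹-cong = ⊝-cong
          }
        ; comm = ⊕-comm
        }
      ; *-cong = ⊗-cong
      ; *-assoc = ⊗-assoc
      ; *-identity = ⊗-identityˡ , ⊗-identityʳ
      ; distrib = ⊗-distribˡ-⊕ , ⊗-distribʳ-⊕
      }
    ; *-comm = ⊗-comm
    }
  }

-- Stronger than 0ℝ ≤ℝ x, but enough for sums of squares.
TermsNonNeg : ℝ → Set
TermsNonNeg x = ∀ n → 0ℚ ℚ.≤ seq x n

-- The constructive form of z < 0: the terms stay below a negative rational from some index on.
EventuallyNegative : ℝ → Set
EventuallyNegative z = ∃ λ η → 0ℚ ℚ.< η × ∃ λ N → ∀ m → N ℕ.≤ m → seq z m ℚ.≤ ℚ.- η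

-- For a given `ε`, comparing one late term of `y ⊕ ⊝ x` with -ε/2 is a decidable question about
-- rationals: below it the difference is eventually negative, otherwise the inequality up to `ε`
-- holds from there on.
≤ℝ-stable : ∀ x y → ¬ EventuallyNegative (y ⊕ ⊝ x) → x ≤ℝ y
≤ℝ-stable x y ¬neg ε 0<ε = case (seq z N ℚ.<? ℚ.- (½ ℚ.* ε))
  where
  z = y ⊕ ⊝ x
  -- Later terms move by at most ε/4, hence remain below -ε/4 in the one case and above -3ε/4 in the
  -- other.
  δ = ½ ℚ.* (½ ℚ.* ε)
  0<δ = half-pos (half-pos 0<ε)
  N = proj₁ (cauchy z δ 0<δ)
  near : ∀ m → N ℕ.≤ m → ℚ.∣ seq z m ℚ.- seq z N ∣ ℚ.≤ δ
  near m N≤m = ℚ.<⇒≤ (proj₂ (cauchy z δ 0<δ) m N N≤m ℕ.≤-refl)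
  z≡ : ∀ m → seq z m ≡ seq y m ℚ.- seq x m
  z≡ m = ≡.trans (seq-⊕ y (⊝ x) m) (≡.cong (seq y m ℚ.+_) (seq-⊝ x m))
  case : Dec (seq z N ℚ.< ℚ.- (½ ℚ.* ε)) → ∃ λ N → ∀ n → N ℕ.≤ n → seq x n ℚ.≤ seq y n ℚ.+ ε
  case (yes zN<) = contradiction (δ , 0<δ , N , λ m N≤m → 0≤q-p⇒p≤q (≡.subst (0ℚ ℚ.≤_)
    (solve 3 (λ m n e → (con ½ :* (con ½ :* e) :- (m :- n)) :+ (:- (con ½ :* e) :- n)
                        := :- (con ½ :* (con ½ :* e)) :- m) ≡.refl (seq z m) (seq z N) ε)
    (+-nonNeg (p≤q⇒0≤q-p (ℚ.≤-trans (p≤∣p∣ _) (near m N≤m))) (p≤q⇒0≤q-p (ℚ.<⇒≤ zN<))))) ¬neg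
  case (no zN≮) = N , λ m N≤m → 0≤q-p⇒p≤q (≡.subst (0ℚ ℚ.≤_)
    (≡.trans
      (solve 3 (λ m n e →
          ((con ½ :* (con ½ :* e) :- (:- (m :- n))) :+ (n :- :- (con ½ :* e))) :+ con ½ :* (con ½ :* e)
          := m :+ e) ≡.refl (seq z m) (seq z N) ε)
      (≡.trans (≡.cong (ℚ._+ ε) (z≡ m))
        (solve 3 (λ x y e → (y :- x) :+ e := (y :+ e) :- x) ≡.refl (seq x m) (seq y m) ε)))
    (+-nonNeg (+-nonNeg (p≤q⇒0≤q-p (ℚ.≤-trans (-p≤∣p∣ _) (near m N≤m))) (p≤q⇒0≤q-p (ℚ.≮⇒≥ zN≮)))
        (ℚ.<⇒≤ 0<δ)))

-- From z ≤ -η and y, q ≥ 0 follows η y ≤ q - z y, which tends to 0; so `y` tends to 0, and `x` with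
-- it. No division by `y` or `z` is involved.
null-of-bounded-square : ∀ {x y z q} → EventuallyNegative z →
                         (∀ m → seq x m ℚ.* seq x m ℚ.≤ seq y m) →
                         TermsNonNeg q → z ⊗ y ≃ q → x ≃ 0ℝ
null-of-bounded-square {x} {y} {z} {q} (η , 0<η , N₁ , z≤) x²≤y 0≤q ⟪ zy≈q ⟫ = ⟪ small ⟫
  where
  small : x ≈ℝ 0ℝ
  small ε 0<ε = N₁ ℕ.⊔ N₂ , λ m N≤m →
    let z≤m = z≤ m (ℕ.m⊔n≤o⇒m≤o N₁ N₂ N≤m)
        zy<m = h m (ℕ.m⊔n≤o⇒n≤o N₁ N₂ N≤m)
        0≤y = ℚ.≤-trans (0≤p² (seq x m)) (x²≤y m)
        ηy≤ : η ℚ.* seq y m ℚ.≤ ℚ.∣ seq (z ⊗ y) m ℚ.- seq q m ∣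
        ηy≤ = ℚ.≤-trans (0≤q-p⇒p≤q (≡.subst (0ℚ ℚ.≤_)
          (≡.trans (solve 4 (λ e y z q → ((:- e) :- z) :* y :+ q := (:- (z :* y :- q)) :- e :* y)
              ≡.refl η (seq y m) (seq z m) (seq q m))
            (≡.cong (λ t → ℚ.- (t ℚ.- seq q m) ℚ.- η ℚ.* seq y m) (≡.sym (seq-⊗ z y m))))
          (+-nonNeg (*-nonNeg (p≤q⇒0≤q-p z≤m) 0≤y) (0≤q m))))
          (-p≤∣p∣ _)
        y<ε² = ℚ.*-cancelˡ-<-nonNeg η {{ℚ.nonNegative (ℚ.<⇒≤ 0<η)}} (ℚ.≤-<-trans ηy≤ zy<m)
    in ≡.subst (λ t → ℚ.∣ t ∣ ℚ.< ε) (≡.sym (ℚ.+-identityʳ (seq x m)))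
         (p²<ε²⇒∣p∣<ε 0<ε (ℚ.≤-<-trans (x²≤y m) y<ε²))
    where
    -- The tolerance η ε² makes `y` smaller than ε², hence |x| smaller than ε.
    N₂ = proj₁ (zy≈q (η ℚ.* (ε ℚ.* ε)) (*-pos 0<η (*-pos 0<ε 0<ε)))
    h = proj₂ (zy≈q (η ℚ.* (ε ℚ.* ε)) (*-pos 0<η (*-pos 0<ε 0<ε)))

module 𝐑 = CommutativeRing ℝ-commutativeRing
open FiniteSums 𝐑.commutativeSemiring
open ChamberAlgebra ℝ-commutativeRing
open Algebra.Properties.Ring 𝐑.ring using (-1*x≈-x)
open Algebra.Properties.CommutativeSemigroup 𝐑.*-commutativeSemigroup
  using () renaming (x∙yz≈y∙xz to ⊗-left-comm)
open Relation.Binary.Reasoning.Setoid 𝐑.setoid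

⊗-TermsNonNeg : ∀ {x y} → TermsNonNeg x → TermsNonNeg y → TermsNonNeg (x ⊗ y)
⊗-TermsNonNeg {x} {y} hx hy n = ≡.subst (0ℚ ℚ.≤_) (≡.sym (seq-⊗ x y n)) (*-nonNeg (hx n) (hy n))

square-TermsNonNeg : ∀ x → TermsNonNeg (x ⊗ x)
square-TermsNonNeg x n = ≡.subst (0ℚ ℚ.≤_) (≡.sym (seq-⊗ x x n)) (0≤p² (seq x n))

𝟙-TermsNonNeg : ∀ {p} {P : Set p} (P? : Dec P) → TermsNonNeg (𝟙 P?)
𝟙-TermsNonNeg P? n with does P?
... | true  = ≡.subst (0ℚ ℚ.≤_) (≡.sym (seq-rat 1ℚ n)) 0≤1
... | false = ≡.subst (0ℚ ℚ.≤_) (≡.sym (seq-rat 0ℚ n)) ℚ.≤-refl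

module _ {a} {A : Set a} {f : A → ℝ} (f-nonNeg : ∀ x → TermsNonNeg (f x)) where

  ⨁-TermsNonNeg : ∀ xs → TermsNonNeg (⨁ xs f)
  ⨁-TermsNonNeg []       n = ≡.subst (0ℚ ℚ.≤_) (≡.sym (seq-rat 0ℚ n)) ℚ.≤-refl
  ⨁-TermsNonNeg (x ∷ xs) n = ≡.subst (0ℚ ℚ.≤_) (≡.sym (seq-⊕ (f x) (⨁ xs f) n))
    (+-nonNeg (f-nonNeg x n) (⨁-TermsNonNeg xs n))

  term≤⨁ : ∀ {xs x} → x List.∈ xs → ∀ n → seq (f x) n ℚ.≤ seq (⨁ xs f) n
  term≤⨁ {x ∷ xs} (here ≡.refl) n = ≡.subst (seq (f x) n ℚ.≤_) (≡.sym (seq-⊕ (f x) (⨁ xs f) n))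
    (0≤p⇒q≤q+p (⨁-TermsNonNeg xs n))
  term≤⨁ {y ∷ xs} {x} (there x∈) n = ≡.subst (seq (f x) n ℚ.≤_)
    (≡.trans (ℚ.+-comm (seq (⨁ xs f) n) (seq (f y) n)) (≡.sym (seq-⊕ (f y) (⨁ xs f) n)))
    (ℚ.≤-trans (term≤⨁ x∈ n) (0≤p⇒q≤q+p (f-nonNeg y n)))

rat-+ : ∀ p q → rat (p ℚ.+ q) ≃ rat p ⊕ rat q
rat-+ p q = ≗⇒≃ _ _ λ n → ≡.trans (seq-rat _ n)
  (≡.sym (≡.trans (seq-⊕ (rat p) (rat q) n) (≡.cong₂ ℚ._+_ (seq-rat p n) (seq-rat q n))))

rat-* : ∀ p q → rat (p ℚ.* q) ≃ rat p ⊗ rat q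
rat-* p q = ≗⇒≃ _ _ λ n → ≡.trans (seq-rat _ n)
  (≡.sym (≡.trans (seq-⊗ (rat p) (rat q) n) (≡.cong₂ ℚ._*_ (seq-rat p n) (seq-rat q n))))

rat-neg : ∀ p → rat (ℚ.- p) ≃ ⊝ rat p
rat-neg p = ≗⇒≃ _ _ λ n → ≡.trans (seq-rat _ n)
  (≡.sym (≡.trans (seq-⊝ (rat p) n) (≡.cong ℚ.-_ (seq-rat p n))))

rat-/1 : ∀ n → rat (+ n ℚ./ 1) ≃ n · rat 1ℚ
rat-/1 zero    = 𝐑.refl
rat-/1 (suc n) = 𝐑.trans (𝐑.reflexive (≡.cong rat (suc/1 n)))
  (𝐑.trans (rat-+ 1ℚ (+ n ℚ./ 1)) (𝐑.+-congˡ (rat-/1 n)))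

-- The Laplacian

-- Stated for an arbitrary operation, so that _+ℝ_ is not unfolded.
foldr≃⨁ : ∀ {a} {A : Set a} (_∙_ : ℝ → ℝ → ℝ) {z} → (∀ x y → x ∙ y ≡ x ⊕ y) → z ≡ rat 0ℚ →
          ∀ (xs : List A) {g h : A → ℝ} → (∀ x → g x ≃ h x) →
          List.foldr _∙_ z (List.map g xs) ≃ ⨁ xs h
foldr≃⨁ _∙_ ∙≡ z≡ []       g≃h = 𝐑.reflexive z≡
foldr≃⨁ _∙_ ∙≡ z≡ (x ∷ xs) {g} {h} g≃h =
  𝐑.trans (𝐑.reflexive (∙≡ (g x) _)) (𝐑.+-cong (g≃h x) (foldr≃⨁ _∙_ ∙≡ z≡ xs g≃h))

∑≃⨁ : ∀ {a} {A : Set a} (xs : List A) (g : A → ℝ) {h} → (∀ x → g x ≃ h x) →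
      ∑ (List.map g xs) ≃ ⨁ xs h
∑≃⨁ xs g = foldr≃⨁ _+ℝ_ (λ x y → ≡.sym (⊕≡ x y)) (≡.sym (rat≡ 0ℚ)) xs

seq-±^ : ∀ j x n → seq (±^ j x) n ≡ seq (sgn j ⊗ x) n
seq-±^ zero    x n = ≡.sym (≡.trans (seq-⊗ (rat 1ℚ) x n)
  (≡.trans (≡.cong (ℚ._* seq x n) (seq-rat 1ℚ n)) (ℚ.*-identityˡ (seq x n))))
seq-±^ (suc j) x n = ≡.trans (≡.cong ℚ.-_ (≡.trans (seq-±^ j x n) (seq-⊗ (sgn j) x n)))
  (≡.trans (ℚ.neg-distribˡ-* (seq (sgn j) n) (seq x n))
    (≡.sym (≡.trans (seq-⊗ (⊝ sgn j) x n) (≡.cong (ℚ._* seq x n) (seq-⊝ (sgn j) n)))))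

±^≃ : ∀ j x → ±^ j x ≃ sgn j ⊗ x
±^≃ j x = ≗⇒≃ (±^ j x) (sgn j ⊗ x) (seq-±^ j x)

fromℚ*≃ : ∀ q x → fromℚ q *ℝ x ≃ rat q ⊗ x
fromℚ*≃ q x = 𝐑.reflexive (≡.trans (≡.sym (⊗≡ (fromℚ q) x)) (≡.cong (_⊗ x) (≡.sym (rat≡ q))))

rat-m*k/m : ∀ m k .{{_ : NonZero m}} → rat (+ m ℚ./ 1) ⊗ rat (+ k ℚ./ m) ≃ rat (+ k ℚ./ 1)
rat-m*k/m m k = 𝐑.trans (𝐑.sym (rat-* (+ m ℚ./ 1) (+ k ℚ./ m)))
    (𝐑.reflexive (≡.cong rat (m*k/m m k)))

∈-allVecs : ∀ {k m} (a : Vec (Fin k) m) → a List.∈ allVecs (List.allFin k) m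
∈-allVecs []      = here ≡.refl
∈-allVecs (v ∷ a) = List.∈-cartesianProductWith⁺ _∷_ (List.∈-allFin v) (∈-allVecs a)

module LaplacianProperties {p} {n : ℕ} (X : SetFamily p) (isPure : IsPureComplex n X) where
  open SetFamily X
  open IsPureComplex isPure
  open Laplacian X isPure

  private
    V = List.allFin #Ver
    𝒫 = allSubsets #Ver

  Ordered : ∀ {i} → Pred (Vec (Fin #Ver) (suc i)) p
  Ordered a = Unique a × Simplex ⟦ a ⟧

  ordered? : ∀ {i} → Decidable (Ordered {i})
  ordered? a = VecAllPairs.allPairs? (λ x y → ¬? (x Fin.≟ y)) a ×-dec Simplex? ⟦ a ⟧

  simplex : ∀ {i} (a : Vec (Fin #Ver) (suc i)) → Ordered a → OrderedSimplex i
  simplex a (a! , a∈X) = record { vertices = a ; distinct = a! ; isSimplex = a∈X }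

  weight : Subset #Ver → ℕ
  weight ρ = length (List.filter (over? ρ) 𝒫)

  rat-weight : ∀ ρ → rat (+ weight ρ ℚ./ 1) ≃ ⨁ 𝒫 (λ σ → 𝟙 (over? ρ σ))
  rat-weight ρ = begin
    rat (+ weight ρ ℚ./ 1)                      ≈⟨ rat-/1 (weight ρ) ⟩
    weight ρ · rat 1ℚ                           ≈⟨ ⨁-const (List.filter (over? ρ) 𝒫) (rat 1ℚ) ⟨
    ⨁ (List.filter (over? ρ) 𝒫) (λ _ → rat 1ℚ)  ≈⟨ ⨁-filter (over? ρ) 𝒫 (λ _ → rat 1ℚ) ⟩
    ⨁ 𝒫 (λ σ → 𝟙 (over? ρ σ) ⊗ rat 1ℚ)          ≈⟨ ⨁-cong 𝒫 (λ σ → 𝐑.*-identityʳ _) ⟩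
    ⨁ 𝒫 (λ σ → 𝟙 (over? ρ σ))                   ∎

  d≃ : ∀ {i} (g : OrderedSimplex i → ℝ) s →
       d g s ≃ ⨁ (List.allFin (suc (suc i))) (λ j → sgn (toℕ j) ⊗ g (Laplacian.remove X isPure j s))
  d≃ {i} g s = ∑≃⨁ (List.allFin (suc (suc i)))
    (λ j → ±^ (toℕ j) (g (Laplacian.remove X isPure j s)))
    (λ j → ±^≃ (toℕ j) (g (Laplacian.remove X isPure j s)))

  δ≃ : ∀ {i} (h : OrderedSimplex (suc i) → ℝ) s →
       δ h s ≃ ⨁ (cones s) (λ t → rat ((+ w t ℚ./ w s) {{w-nonZero s}}) ⊗ h t)
  δ≃ h s = ∑≃⨁ (cones s) (λ t → fromℚ ((+ w t ℚ./ w s) {{w-nonZero s}}) *ℝ h t)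
    (λ t → fromℚ*≃ ((+ w t ℚ./ w s) {{w-nonZero s}}) (h t))

  -- Clears the denominators `w s`, so that the remaining weights `w t` can be read as numbers of
  -- chambers.
  w*δ≃ : ∀ {i} (h : OrderedSimplex (suc i) → ℝ) s →
         rat (+ w s ℚ./ 1) ⊗ δ h s ≃ ⨁ (cones s) (λ t → rat (+ w t ℚ./ 1) ⊗ h t)
  w*δ≃ h s = 𝐑.trans (𝐑.*-congˡ (δ≃ h s)) (𝐑.trans (*-⨁ _ (cones s) _) (⨁-cong (cones s) λ t →
    𝐑.trans (𝐑.sym (𝐑.*-assoc _ _ _)) (𝐑.*-congʳ (rat-m*k/m (w s) (w t) {{w-nonZero s}}))))

  module Cochain {i} (f : C i) where

    -- A function of the decision rather than of the tuple, so that proofs can split on the decision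
    -- while `F` stays abstract.
    extend′ : ∀ {a} → Dec (Ordered a) → ℝ
    extend′ (yes o) = at f (simplex _ o)
    extend′ (no _)  = rat 0ℚ

    at-~ : ∀ {q} s t → vertices s ~[ q ] vertices t → at f t ≃ sgnᵖ q ⊗ at f s
    at-~ {0ℙ} s t r = 𝐑.trans ⟪ even f s t r ⟫ (𝐑.sym (𝐑.*-identityˡ _))
    at-~ {1ℙ} s t r = 𝐑.trans ⟪ odd f s t r ⟫
      (𝐑.trans (𝐑.reflexive (≡.sym (⊝≡ (at f s)))) (𝐑.sym (-1*x≈-x (at f s))))

    abstract
      F : Vec (Fin #Ver) (suc i) → ℝ
      F a = extend′ (ordered? a)

      F-vertices : ∀ s → F (vertices s) ≃ at f s
      F-vertices s = go (ordered? (vertices s))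
        where
        go : (o : Dec (Ordered (vertices s))) → extend′ o ≃ at f s
        -- The two ordered simplices may differ in the proofs they carry; evenness under the
        -- identity permutation identifies the values.
        go (yes o) = ⟪ even f s (simplex (vertices s) o) ~refl ⟫
        go (no ¬o) = contradiction (distinct s , isSimplex s) ¬o

      F-degenerate : ∀ {a} → ¬ Ordered a → F a ≃ rat 0ℚ
      F-degenerate {a} ¬o = go (ordered? a)
        where
        go : (o : Dec (Ordered a)) → extend′ o ≃ rat 0ℚ
        go (yes o) = contradiction o ¬o
        go (no _)  = 𝐑.refl

      F-~ : ∀ {q a b} → a ~[ q ] b → F b ≃ sgnᵖ q ⊗ F a
      F-~ {q} {a} {b} r = go (ordered? a) (ordered? b)
        where
        go : (o : Dec (Ordered a)) (o′ : Dec (Ordered b)) → extend′ o′ ≃ sgnᵖ q ⊗ extend′ o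
        go (yes o) (yes o′) = at-~ (simplex a o) (simplex b o′) r
        go (no _)  (no _)   = 𝐑.sym (𝐑.zeroʳ _)
        go (yes (a! , a∈)) (no ¬o) = contradiction (Unique-~ r a! , ≡.subst Simplex (⟦⟧-~ r) a∈) ¬o
        go (no ¬o) (yes (b! , b∈)) = contradiction
          (Unique-~ (~-sym r) b! , ≡.subst Simplex (≡.sym (⟦⟧-~ r)) b∈) ¬o

    F-repetition : ∀ {a} → ¬ Unique a → F a ≃ rat 0ℚ
    F-repetition ¬a! = F-degenerate (¬a! ∘ proj₁)

    divergence : Subset #Ver → Vec (Fin #Ver) i → ℝ
    divergence = div F F-~ F-repetition

    dδ : Subset #Ver → Vec (Fin #Ver) (suc i) → ℝ
    dδ = d-div F F-~ F-repetition

    dF : Vec (Fin #Ver) (suc (suc i)) → ℝ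
    dF = coboundary F F-~ F-repetition

    F-remove : ∀ t j → at f (Laplacian.remove X isPure j t) ≃ F (Vec.removeAt (vertices t) j)
    F-remove t j = 𝐑.sym (F-vertices (Laplacian.remove X isPure j t))

    d≃dF : ∀ t → d (at f) t ≃ dF (vertices t)
    d≃dF t = 𝐑.trans (d≃ (at f) t) (⨁-cong (List.allFin (suc (suc i)))
      {f = λ j → sgn (toℕ j) ⊗ at f (Laplacian.remove X isPure j t)}
      {g = λ j → sgn (toℕ j) ⊗ F (Vec.removeAt (vertices t) j)}
      λ j → 𝐑.*-congˡ {sgn (toℕ j)} (F-remove t j))

    -- That `v` and `s` span a simplex is automatic once both lie in a chamber `σ`. This turns a sum
    -- over cones and the chambers above them into a sum over chambers and their vertices.
    𝟙-flag : ∀ (s : OrderedSimplex i) v σ → 𝟙 (cone? s v) ⊗ 𝟙 (over? ⟦ v ∷ vertices s ⟧ σ)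
             ≃ 𝟙 (over? ⟦ vertices s ⟧ σ) ⊗ (𝟙 (v Sub.∈? σ) ⊗ 𝟙 (¬? (v Sub.∈? ⟦ vertices s ⟧)))
    𝟙-flag s v σ = begin
      𝟙 (cone? s v) ⊗ 𝟙 (over? ⟦ v ∷ a ⟧ σ)
        ≈⟨ 𝟙-× (cone? s v) (over? ⟦ v ∷ a ⟧ σ) ⟨
      𝟙 (cone? s v ×-dec over? ⟦ v ∷ a ⟧ σ)
        ≈⟨ 𝟙-⇔ (cone? s v ×-dec over? ⟦ v ∷ a ⟧ σ)
             (over? ⟦ a ⟧ σ ×-dec (v Sub.∈? σ ×-dec ¬? (v Sub.∈? ⟦ a ⟧)))
             (λ ((v∉ , _) , σ∈ , va⊆) →
               (σ∈ , λ {x} x∈ → va⊆ (Sub.q⊆p∪q ⁅ v ⁆ ⟦ a ⟧ x∈)) , va⊆ (lookup∈⟦⟧ (v ∷ a) zero) , v∉)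
             (λ ((σ∈ , a⊆) , v∈ , v∉) →
               (v∉ , face (proj₁ σ∈) (⟦⟧-nonempty (v ∷ a)) (⟦∷⟧⊆⁺ a v∈ a⊆)) ,
               σ∈ , λ {x} → ⟦∷⟧⊆⁺ a v∈ a⊆ {x}) ⟩
      𝟙 (over? ⟦ a ⟧ σ ×-dec (v Sub.∈? σ ×-dec ¬? (v Sub.∈? ⟦ a ⟧)))
        ≈⟨ 𝐑.trans (𝟙-× (over? ⟦ a ⟧ σ) (v Sub.∈? σ ×-dec ¬? (v Sub.∈? ⟦ a ⟧)))
            (𝐑.*-congˡ (𝟙-× (v Sub.∈? σ) (¬? (v Sub.∈? ⟦ a ⟧)))) ⟩
      𝟙 (over? ⟦ a ⟧ σ) ⊗ (𝟙 (v Sub.∈? σ) ⊗ 𝟙 (¬? (v Sub.∈? ⟦ a ⟧))) ∎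
      where a = vertices s

    -- w (s) ((n + 1) f (s) − Δ f (s)) is the sum of (d δ f) (s) over the
    -- n-simplices containing s, with d and δ taken inside each of them.
    w*Δ≃ : ∀ (s : OrderedSimplex i) → rat (+ w s ℚ./ 1) ⊗ Δ (at f) s ≃
           ⨁ 𝒫 (λ σ → 𝟙 (over? ⟦ vertices s ⟧ σ) ⊗
                      ((suc n · rat 1ℚ) ⊗ F (vertices s) ⊕ ⊝ dδ σ (vertices s)))
    w*Δ≃ s = begin
      rat (+ w s ℚ./ 1) ⊗ Δ (at f) s
        ≈⟨ w*δ≃ (d (at f)) s ⟩
      ⨁ (cones s) (λ t → rat (+ w t ℚ./ 1) ⊗ d (at f) t)
        ≈⟨ ⨁-mapMaybe (cone? s) (cone s) V _ (λ v → ⨁ 𝒫 (λ σ → 𝟙 (over? ⟦ v ∷ a ⟧ σ)) ⊗ dF (v ∷ a))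
             (λ v c → 𝐑.*-cong (rat-weight ⟦ v ∷ a ⟧) (d≃dF (cone s v c))) ⟩
      ⨁ V (λ v → 𝟙 (cone? s v) ⊗ (⨁ 𝒫 (λ σ → 𝟙 (over? ⟦ v ∷ a ⟧ σ)) ⊗ dF (v ∷ a)))
        ≈⟨ ⨁-cong V (λ v → 𝐑.trans (𝐑.*-congˡ (⨁-* 𝒫 _ _))
            (𝐑.trans (*-⨁ _ 𝒫 _) (⨁-cong 𝒫 (regroup v)))) ⟩
      ⨁ V (λ v → ⨁ 𝒫 (λ σ →
        𝟙 (over? ⟦ a ⟧ σ) ⊗ (𝟙 (v Sub.∈? σ) ⊗ (𝟙 (¬? (v Sub.∈? ⟦ a ⟧)) ⊗ dF (v ∷ a)))))
        ≈⟨ 𝐑.trans (⨁-comm V 𝒫 _) (⨁-cong 𝒫 (λ σ → 𝐑.sym (*-⨁ _ V _))) ⟩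
      ⨁ 𝒫 (λ σ → 𝟙 (over? ⟦ a ⟧ σ) ⊗
        ⨁ V (λ v → 𝟙 (v Sub.∈? σ) ⊗ (𝟙 (¬? (v Sub.∈? ⟦ a ⟧)) ⊗ dF (v ∷ a))))
        -- Every chamber has `suc n` vertices, so the factor |σ| is the same for all of them.
        ≈⟨ ⨁-cong 𝒫 (λ σ → 𝟙-congˡ (over? ⟦ a ⟧ σ) λ ((_ , size) , _) →
             𝐑.trans (⨁-cones F F-~ F-repetition σ {a} (distinct s))
               (𝐑.reflexive (≡.cong (λ m → (m · rat 1ℚ) ⊗ F a ⊕ ⊝ dδ σ a) size))) ⟩
      ⨁ 𝒫 (λ σ → 𝟙 (over? ⟦ a ⟧ σ) ⊗ ((suc n · rat 1ℚ) ⊗ F a ⊕ ⊝ dδ σ a)) ∎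
      where
      a = vertices s
      regroup : ∀ v σ → 𝟙 (cone? s v) ⊗ (𝟙 (over? ⟦ v ∷ a ⟧ σ) ⊗ dF (v ∷ a)) ≃
                𝟙 (over? ⟦ a ⟧ σ) ⊗ (𝟙 (v Sub.∈? σ) ⊗ (𝟙 (¬? (v Sub.∈? ⟦ a ⟧)) ⊗ dF (v ∷ a)))
      regroup v σ = 𝐑.trans (𝐑.sym (𝐑.*-assoc _ _ _)) (𝐑.trans (𝐑.*-congʳ (𝟙-flag s v σ))
        (𝐑.trans (𝐑.*-assoc _ _ _) (𝐑.*-congˡ (𝐑.*-assoc _ _ _))))

    w*Δ⊕dδ≃ : ∀ (s : OrderedSimplex i) →
              rat (+ w s ℚ./ 1) ⊗ Δ (at f) s ⊕
                ⨁ 𝒫 (λ σ → 𝟙 (over? ⟦ vertices s ⟧ σ) ⊗ dδ σ (vertices s))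
              ≃ rat (+ w s ℚ./ 1) ⊗ ((suc n · rat 1ℚ) ⊗ F (vertices s))
    w*Δ⊕dδ≃ s = begin
      rat (+ w s ℚ./ 1) ⊗ Δ (at f) s ⊕ ⨁ 𝒫 (λ σ → 𝟙 (over? ⟦ a ⟧ σ) ⊗ dδ σ a)
        ≈⟨ 𝐑.+-congʳ (w*Δ≃ s) ⟩
      ⨁ 𝒫 (λ σ → 𝟙 (over? ⟦ a ⟧ σ) ⊗ (N⊗Fa ⊕ ⊝ dδ σ a)) ⊕ ⨁ 𝒫 (λ σ → 𝟙 (over? ⟦ a ⟧ σ) ⊗ dδ σ a)
        ≈⟨ ⨁-+ 𝒫 _ _ ⟨
      ⨁ 𝒫 (λ σ → 𝟙 (over? ⟦ a ⟧ σ) ⊗ (N⊗Fa ⊕ ⊝ dδ σ a) ⊕ 𝟙 (over? ⟦ a ⟧ σ) ⊗ dδ σ a)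
        ≈⟨ ⨁-cong 𝒫 (λ σ → 𝐑.trans (𝐑.sym (𝐑.distribˡ _ _ _)) (𝐑.*-congˡ (𝐑.trans (𝐑.+-assoc _ _ _)
             (𝐑.trans (𝐑.+-congˡ (𝐑.-‿inverseˡ _)) (𝐑.+-identityʳ _))))) ⟩
      ⨁ 𝒫 (λ σ → 𝟙 (over? ⟦ a ⟧ σ) ⊗ N⊗Fa)
        ≈⟨ ⨁-* 𝒫 _ _ ⟨
      ⨁ 𝒫 (λ σ → 𝟙 (over? ⟦ a ⟧ σ)) ⊗ N⊗Fa
        ≈⟨ 𝐑.*-congʳ (rat-weight ⟦ a ⟧) ⟨
      rat (+ w s ℚ./ 1) ⊗ N⊗Fa ∎
      where
      a = vertices s
      N⊗Fa = (suc n · rat 1ℚ) ⊗ F a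

-- The bound on the eigenvalues

module UpperBound {p} {n : ℕ} (X : SetFamily p) (isPure : IsPureComplex n X) where
  open SetFamily X
  open IsPureComplex isPure
  open Laplacian X isPure
  open LaplacianProperties X isPure

  module _ {i} (f : C i) where
    open Cochain f

    private
      V = List.allFin #Ver
      𝒫 = allSubsets #Ver
      J = List.allFin (suc i)
      A = allVecs V (suc i)

    rat-w : Vec (Fin #Ver) (suc i) → ℝ
    rat-w a = rat (+ weight ⟦ a ⟧ ℚ./ 1)

    -- All orderings of a simplex are counted, so this is (i + 1)! times (f , f).
    ∥F∥² : ℝ
    ∥F∥² = ⨁ A (λ a → rat-w a ⊗ (F a ⊗ F a))

    -- The constant sum over `J` is the factor i + 1, the number of places at which a vertex can be
    -- inserted into `b`; it gives the same normalisation (i + 1)! as in `∥F∥²`.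
    ∥δF∥² : ℝ
    ∥δF∥² = ⨁ 𝒫 (λ σ → 𝟙 (IsSimplex? n σ) ⊗
      ⨁ J (λ _ → ⨁ (allVecs V i) (λ b → 𝟙 (⟦ b ⟧ Sub.⊆? σ) ⊗ (divergence σ b ⊗ divergence σ b))))

    weighted-square-nonNeg : ∀ a → TermsNonNeg (rat-w a ⊗ (F a ⊗ F a))
    weighted-square-nonNeg a = ⊗-TermsNonNeg {rat-w a} {F a ⊗ F a}
      (λ m → ≡.subst (0ℚ ℚ.≤_) (≡.sym (seq-rat _ m)) (0≤n/1 (weight ⟦ a ⟧)))
      (square-TermsNonNeg (F a))

    F²≤∥F∥² : ∀ (s : OrderedSimplex i) m →
              seq (F (vertices s)) m ℚ.* seq (F (vertices s)) m ℚ.≤ seq ∥F∥² m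
    F²≤∥F∥² s m = ℚ.≤-trans bound (term≤⨁ weighted-square-nonNeg (∈-allVecs a) m)
      where
      a = vertices s
      x = seq (F a) m
      bound : x ℚ.* x ℚ.≤ seq (rat-w a ⊗ (F a ⊗ F a)) m
      bound = ≡.subst₂ ℚ._≤_ (ℚ.*-identityˡ (x ℚ.* x))
        (≡.sym (≡.trans (seq-⊗ (rat-w a) (F a ⊗ F a) m)
            (≡.cong₂ ℚ._*_ (seq-rat _ m) (seq-⊗ (F a) (F a) m))))
        (ℚ.*-monoʳ-≤-nonNeg (x ℚ.* x) {{ℚ.nonNegative (0≤p² x)}} (1≤n/1 (w s) {{w-nonZero s}}))

    ∥δF∥²-nonNeg : TermsNonNeg ∥δF∥²
    ∥δF∥²-nonNeg = ⨁-TermsNonNeg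
      (λ σ → ⊗-TermsNonNeg {𝟙 (IsSimplex? n σ)} (𝟙-TermsNonNeg (IsSimplex? n σ))
        (⨁-TermsNonNeg (λ j → ⨁-TermsNonNeg
          (λ b → ⊗-TermsNonNeg {𝟙 (⟦ b ⟧ Sub.⊆? σ)} (𝟙-TermsNonNeg (⟦ b ⟧ Sub.⊆? σ))
              (square-TermsNonNeg (divergence σ b)))
          (allVecs V i)) J))
      𝒫

    module _ {ν c : ℝ} (c≃ : c ≃ suc n · rat 1ℚ) (eigen : ∀ s → Δ (at f) s ≃ ν ⊗ at f s) where

      energy-at : ∀ a → (c ⊕ ⊝ ν) ⊗ (rat-w a ⊗ (F a ⊗ F a))
                        ≃ F a ⊗ ⨁ 𝒫 (λ σ → 𝟙 (over? ⟦ a ⟧ σ) ⊗ dδ σ a)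
      energy-at a = go (ordered? a)
        where
        go : Dec (Ordered a) → _
        go (yes o) = rearrange-eigen (𝐑.trans
          (𝐑.+-congʳ (𝐑.*-congˡ (𝐑.sym (𝐑.trans (eigen (simplex a o))
              (𝐑.*-congˡ (𝐑.sym (F-vertices (simplex a o))))))))
          (𝐑.trans (w*Δ⊕dδ≃ (simplex a o)) (𝐑.*-congˡ (𝐑.*-congʳ (𝐑.sym c≃)))))
        go (no ¬o) = 𝐑.trans
          (𝐑.*-congˡ (𝐑.trans (𝐑.*-congˡ (𝐑.trans (𝐑.*-congˡ (F-degenerate ¬o)) (𝐑.zeroʳ _)))
              (𝐑.zeroʳ _)))
          (𝐑.trans (𝐑.zeroʳ _) (𝐑.sym (𝐑.trans (𝐑.*-congʳ (F-degenerate ¬o)) (𝐑.zeroˡ _))))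

      energy : (c ⊕ ⊝ ν) ⊗ ∥F∥² ≃ ∥δF∥²
      energy = begin
        (c ⊕ ⊝ ν) ⊗ ∥F∥²
          ≈⟨ *-⨁ _ A _ ⟩
        ⨁ A (λ a → (c ⊕ ⊝ ν) ⊗ (rat-w a ⊗ (F a ⊗ F a)))
          ≈⟨ ⨁-cong A (λ a → 𝐑.trans (energy-at a) (𝐑.trans (*-⨁ _ 𝒫 _) (⨁-cong 𝒫 λ σ →
               𝐑.trans (⊗-left-comm _ _ _)
                 (𝐑.trans (𝐑.*-congʳ (𝟙-× (IsSimplex? n σ) (⟦ a ⟧ Sub.⊆? σ))) (𝐑.*-assoc _ _ _))))) ⟩
        ⨁ A (λ a → ⨁ 𝒫 (λ σ → 𝟙 (IsSimplex? n σ) ⊗ (𝟙 (⟦ a ⟧ Sub.⊆? σ) ⊗ (F a ⊗ dδ σ a))))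
          ≈⟨ 𝐑.trans (⨁-comm A 𝒫 _) (⨁-cong 𝒫 (λ σ → 𝐑.sym (*-⨁ _ A _))) ⟩
        ⨁ 𝒫 (λ σ → 𝟙 (IsSimplex? n σ) ⊗ ⨁ A (λ a → 𝟙 (⟦ a ⟧ Sub.⊆? σ) ⊗ (F a ⊗ dδ σ a)))
          ≈⟨ ⨁-cong 𝒫 (λ σ → 𝐑.*-congˡ (⨁-d-div F F-~ F-repetition σ)) ⟩
        ∥δF∥² ∎

      vanishes : EventuallyNegative (c ⊕ ⊝ ν) → ∀ s → at f s ≃ 0ℝ
      vanishes neg s = 𝐑.trans (𝐑.sym (F-vertices s))
        (null-of-bounded-square neg (F²≤∥F∥² s) ∥δF∥²-nonNeg energy)

  -- The assumption that an eigenfunction is nonzero is itself a negation, so it meets the stability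
  -- of `_≤ℝ_` exactly: if ν were larger, every value of `f` would vanish.
  eigenvalue-≤ : ∀ {i} ν → IsEigenvalue i ν → ν ≤ℝ fromℕ (suc n)
  eigenvalue-≤ ν (f , f≢0 , eigen) = ≤ℝ-stable ν (fromℕ (suc n)) λ neg → f≢0 λ s →
    ≃⇒≈ℝ (vanishes f (𝐑.trans (𝐑.reflexive (≡.sym (rat≡ (+ suc n ℚ./ 1)))) (rat-/1 (suc n)))
      (λ s → 𝐑.trans ⟪ eigen s ⟫ (𝐑.reflexive (≡.sym (⊗≡ ν (at f s))))) neg s)

-- An eigenvector for the value n + 1

rat-⨁ : ∀ {a} {A : Set a} (xs : List A) (f : A → ℚ) →
        rat (FiniteSums.⨁ (CommutativeRing.commutativeSemiring ℚ.+-*-commutativeRing) xs f)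
        ≃ ⨁ xs (rat ∘ f)
rat-⨁ []       f = 𝐑.refl
rat-⨁ (x ∷ xs) f = 𝐑.trans (rat-+ (f x) _) (𝐑.+-congˡ (rat-⨁ xs f))

rat-/1-cancel : ∀ n .{{_ : NonZero n}} {x y} → rat (+ n ℚ./ 1) ⊗ x ≃ rat (+ n ℚ./ 1) ⊗ y → x ≃ y
rat-/1-cancel n {x} {y} eq = 𝐑.trans (𝐑.sym (unit x)) (𝐑.trans (𝐑.*-congˡ eq) (unit y))
  where
  unit : ∀ z → rat (+ 1 ℚ./ n) ⊗ (rat (+ n ℚ./ 1) ⊗ z) ≃ z
  unit z = 𝐑.trans (𝐑.sym (𝐑.*-assoc _ _ _)) (𝐑.trans
    (𝐑.*-congʳ (𝐑.trans (𝐑.*-comm _ _) (rat-m*k/m n 1))) (𝐑.*-identityˡ z))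

module Eigenvector {p} {n : ℕ} (X : SetFamily p) (isPure : IsPureComplex n X)
    (colouring : Colouring n X) where
  open SetFamily X
  open IsPureComplex isPure
  open Laplacian X isPure
  open LaplacianProperties X isPure
  open Colouring colouring
  open Vandermonde (suc n)

  private
    V = List.allFin #Ver
    𝒫 = allSubsets #Ver

  module _ {i : ℕ} (i<n : i ℕ.< n) where

    pullback : ∀ {k} → Vec (Fin #Ver) k → ℚ
    pullback a = coclosed (Vec.map colour a)

    eigencochain : C i
    eigencochain = record
      { at   = λ s → rat (pullback (vertices s))
      ; even = λ s t r → ≃⇒≈ℝ (𝐑.reflexive (≡.cong rat
          (≡.trans (coclosed-~ (map-~ colour r)) (ℚ.*-identityˡ _))))
      ; odd  = λ s t r → ≃⇒≈ℝ (𝐑.trans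
          (𝐑.reflexive (≡.cong rat (≡.trans (coclosed-~ (map-~ colour r))
            (≡.trans (≡.sym (ℚ.neg-distribˡ-* 1ℚ (pullback (vertices s))))
                     (≡.cong ℚ.-_ (ℚ.*-identityˡ _))))))
          (𝐑.trans (rat-neg (pullback (vertices s)))
                   (𝐑.reflexive (⊝≡ (rat (pullback (vertices s)))))))
      }

    open Cochain eigencochain

    -- Inside a chamber distinct vertices always form a simplex, and a repeated vertex repeats its
    -- colour, where `coclosed` vanishes as `F` does.
    F≃ : ∀ {σ a} → Simplex σ → ⟦ a ⟧ ⊆ σ → F a ≃ rat (pullback a)
    F≃ {σ} {a} σ∈ a⊆ = go (VecAllPairs.allPairs? (λ x y → ¬? (x Fin.≟ y)) a)
      where
      go : Dec (Unique a) → F a ≃ rat (pullback a)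
      go (yes a!) = F-vertices (simplex a (a! , face σ∈ (⟦⟧-nonempty a) a⊆))
      go (no ¬a!) = 𝐑.trans (F-repetition ¬a!)
        (𝐑.reflexive (≡.cong rat (≡.sym (coclosed-repetition (¬a! ∘ Unique-map⁻ colour)))))

    -- Colours identify the vertices of `σ` with those of the full simplex, which reduces the claim
    -- to `div-coclosed`.
    divergence-zero : ∀ {σ b} → IsSimplex n σ → ⟦ b ⟧ ⊆ σ → divergence σ b ≃ rat 0ℚ
    divergence-zero {σ} {b} σ∈ b⊆ = 𝐑.trans (⨁-cong V λ v → 𝟙-congˡ (v Sub.∈? σ) λ v∈ →
        F≃ (proj₁ σ∈) (⟦∷⟧⊆⁺ b v∈ b⊆))
      (𝐑.trans (⨁-bijection (Sub._∈? σ) colour (onto σ∈) (injective σ∈)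
          (λ t → rat (coclosed (t ∷ Vec.map colour b))))
      (𝐑.trans (𝐑.sym (rat-⨁ T (λ t → coclosed (t ∷ Vec.map colour b))))
               (𝐑.reflexive (≡.cong rat (div-coclosed (Vec.map colour b))))))

    dδ-zero : ∀ {σ a} → IsSimplex n σ → ⟦ a ⟧ ⊆ σ → dδ σ a ≃ rat 0ℚ
    dδ-zero {σ} {a} σ∈ a⊆ = 𝐑.trans (⨁-cong J λ j → 𝐑.trans
        (𝐑.*-congˡ (divergence-zero σ∈ λ x∈ → a⊆ (⟦removeAt⟧⊆ a j x∈))) (𝐑.zeroʳ _))
      (⨁-zero J)
      where J = List.allFin (suc i)

    eigen-equation : ∀ s → Δ (at eigencochain) s ≃ rat (+ suc n ℚ./ 1) ⊗ at eigencochain s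
    eigen-equation s = rat-/1-cancel (w s) {{w-nonZero s}} (𝐑.trans
      (𝐑.sym (𝐑.trans (𝐑.+-congˡ (𝐑.trans (⨁-cong 𝒫 λ σ → 𝐑.trans
          (𝟙-congˡ (over? ⟦ vertices s ⟧ σ) λ (σ∈ , s⊆) → dδ-zero {a = vertices s} σ∈ s⊆)
              (𝐑.zeroʳ _)) (⨁-zero 𝒫)))
        (𝐑.+-identityʳ _)))
      (𝐑.trans (w*Δ⊕dδ≃ s) (𝐑.*-congˡ (𝐑.*-cong (𝐑.sym (rat-/1 (suc n))) (F-vertices s)))))

    private
      chamber : ∃ (IsSimplex n)
      chamber = let (_ , ρ∈) = inhabited ; (σ , σ∈ , _) = pure ρ∈ in σ , σ∈

      σ₀ = proj₁ chamber
      σ₀∈ = proj₂ chamber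

      vertexOf : Fin (suc n) → Fin #Ver
      vertexOf t = proj₁ (onto σ₀∈ t)

      -- The hypothesis `i < n` enters here: an ordered i-simplex has i + 1 entries among n + 1
      -- colours, and one colour must be left over.
      i<1+n : suc i ℕ.< suc n
      i<1+n = ℕ.s≤s i<n

      a₀ : Vec (Fin #Ver) (suc i)
      a₀ = Vec.map vertexOf (initial i<1+n)

      colour-a₀ : Vec.map colour a₀ ≡ initial i<1+n
      colour-a₀ = ≡.trans (≡.sym (Vec.map-∘ colour vertexOf _))
        (≡.trans (Vec.map-cong (λ t → proj₂ (proj₂ (onto σ₀∈ t))) _) (Vec.map-id _))

      a₀-unique : Unique a₀
      a₀-unique = Unique-map⁻ colour (≡.subst Unique (≡.sym colour-a₀) (initial-unique i<1+n))

      a₀⊆σ₀ : ⟦ a₀ ⟧ ⊆ σ₀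
      a₀⊆σ₀ = ⟦⟧⊆⁺ a₀ λ j → ≡.subst (_∈ σ₀) (≡.sym (Vec.lookup-map j vertexOf (initial i<1+n)))
        (proj₁ (proj₂ (onto σ₀∈ (Vec.lookup (initial i<1+n) j))))

      s₀ : OrderedSimplex i
      s₀ = simplex a₀ (a₀-unique , face (proj₁ σ₀∈) (⟦⟧-nonempty a₀) a₀⊆σ₀)

    eigencochain-≢0 : ¬ (∀ s → at eigencochain s ≈ℝ 0ℝ)
    eigencochain-≢0 zero-at = coclosed-initial-≢0 i<1+n
      (≡.trans (≡.cong coclosed (≡.sym colour-a₀)) (rat-injective ⟪ zero-at s₀ ⟫))
      where
      rat-injective : ∀ {q} → rat q ≃ 0ℝ → q ≡ 0ℚ
      rat-injective {q} ⟪ eq ⟫ = decidable-stable (q ℚ.≟ 0ℚ) λ q≢0 →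
        let 0<∣q∣ = ℚ.≰⇒> λ ∣q∣≤0 → q≢0 (ℚ.∣p∣≡0⇒p≡0 q (ℚ.≤-antisym ∣q∣≤0 (ℚ.0≤∣p∣ q)))
            (N , h) = eq ℚ.∣ q ∣ 0<∣q∣
        in ℚ.<-irrefl (≡.cong ℚ.∣_∣ (≡.trans (ℚ.+-identityʳ _) (seq-rat q N))) (h N ℕ.≤-refl)

    eigenvalue : IsEigenvalue i (fromℕ (suc n))
    eigenvalue = eigencochain , eigencochain-≢0 , λ s → ≃⇒≈ℝ (𝐑.trans (eigen-equation s)
      (𝐑.sym (fromℚ*≃ (+ suc n ℚ./ 1) (at eigencochain s))))

theorem2p21 : ∀ {c r} (G : FiniteGroup c r) (ℓ : ℕ) (T : TitsSystem G (suc ℓ)) →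
    Σ (IsPureComplex ℓ (building T)) λ isPure →
    ∀ i → i < ℓ →
    Laplacian.IsMaximalEigenvalue (building T) isPure i (fromℕ (suc ℓ))
theorem2p21 G ℓ T = building-pure , λ i i<ℓ →
    Eigenvector.eigenvalue (building T) building-pure building-colouring i<ℓ
  , UpperBound.eigenvalue-≤ (building T) building-pure
  where open BuildingProperties T
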